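{- Define $g(n)$ by $\sum_{n\ge0}g(n)q^n=\dfrac{(q^2;q^2)_\infty^5}{(q;q)_\infty^4}$. Then for all integers $\alpha\ge1$ and $n\ge0$, $$g\left(3^{2\alpha-1}n+\frac{3^{2\alpha}-1}{4}\right)\equiv0\pmod{3^{2\alpha}}.$$
   Context: $(a;q)_\infty=\prod_{k\ge0}(1-aq^k)$, as a formal power series in $q$. -}

module Defs where

open import Data.Bool using (if_then_else_)
open import Data.Nat as ℕ using (ℕ; zero; suc; _≡ᵇ_)
open import Data.Integer as ℤ using (ℤ; +_; _+_; _*_; -_)
open import Data.List using (List; []; _∷_)

-- Formal power series in q with integer coefficients: n ↦ coefficient of q^n.
Series : Set
Series = ℕ → ℤ

one : Series
one zero    = + 1
one (suc _) = + 0

_⊛_ : Series → Series → Series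
(f ⊛ g) n = go n
  where
  go : ℕ → ℤ
  go zero    = f 0 * g n
  go (suc i) = f (suc i) * g (n ℕ.∸ suc i) + go i

infixl 7 _⊛_

_^ˢ_ : Series → ℕ → Series
f ^ˢ zero  = one
f ^ˢ suc k = f ⊛ (f ^ˢ k)

oneMinusQ^suc : ℕ → Series
oneMinusQ^suc m zero    = + 1
oneMinusQ^suc m (suc n) = if n ≡ᵇ m then - (+ 1) else + 0

prodBelow : (ℕ → Series) → ℕ → Series
prodBelow F zero    = one
prodBelow F (suc N) = prodBelow F N ⊛ F N

-- Infinite product ∏_{k ≥ 0} F k, for families with F k ≡ 1 (mod q^(k+1)):
-- the coefficient of q^n is already determined by the factors k < n+1.
infProd : (ℕ → Series) → Series
infProd F n = prodBelow F (suc n) n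

-- (q^d ; q^d)_∞ = ∏_{k ≥ 0} (1 - q^(d(k+1))) = ∏_{k≥0} (1 - q^(d*k + d)), for d ≥ 1
qPoch : ℕ → Series
qPoch d = infProd (λ k → oneMinusQ^suc (d ℕ.* k ℕ.+ d ℕ.∸ 1))

-- Multiplicative inverse of a series f with constant term 1:
-- h 0 = 1,  h n = - Σ_{i=1}^{n} f i * h (n - i).
-- invRev f n is the list [h n, h (n-1), ..., h 0].
invRev : Series → ℕ → List ℤ
invRev f zero    = + 1 ∷ []
invRev f (suc n) = - conv 1 prev ∷ prev
  where
  prev : List ℤ
  prev = invRev f n
  conv : ℕ → List ℤ → ℤ
  conv i []       = + 0
  conv i (x ∷ xs) = f i * x + conv (suc i) xs

inv : Series → Series
inv f n with invRev f n
... | x ∷ _ = x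
... | []    = + 0

G : Series
G = (qPoch 2 ^ˢ 5) ⊛ inv (qPoch 1 ^ˢ 4)

g : ℕ → ℤ
g = G

module Submission where

-- Let P = (q;q)²/(q²;q²) and ψ = (q²;q²)²/(q;q), so that the generating function is G = ψ²/P.
-- The Jacobi triple product, summed over exponents in residue classes mod 3, gives
-- P(q) = P(q⁹)(1 - 2q w(q³)) and ψ(q) = ψ(q⁹)(w(q³)⁻¹ + q) with w an eta quotient, and comparing norms
-- over ℤ[[q³]] gives P(q)⁴ = P(q³)⁴(1 - 8q w³).  Put y = P(q³)⁴/P⁴ and B = ψ(q³)² P(q³)³/P⁴.  Then y is a
-- root of a monic cubic whose coefficients are integer polynomials in y(q³), so for each r the series with
-- coefficients [q^(3n+r)] h y^k obey a three-term linear recurrence in k with coefficients in ℤ[y].  It follows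
-- that extracting the exponents 3n+2 sends G to 9B and the lattice spanned by G y and 9 G y² (3y)^k into 9 times
-- the lattice spanned by B and B y (3y)^k, while extracting the exponents 3n sends the latter lattice into the
-- former.  Alternating the two extractions gains a factor 9 each time.

open import Defs
open import Algebra.Bundles using (CommutativeRing)
open import Algebra.Structures using (IsCommutativeRing)
open import Data.Bool using (true; false; if_then_else_)
open import Data.Nat as ℕ using (ℕ; zero; suc; _<_; _≤_; z≤n; s≤s; s≤s⁻¹)
open import Data.Nat.DivMod using (m*n/n≡m)
open import Data.Nat.Solver using (module +-*-Solver)
open import Data.Integer as ℤ using (ℤ; +_; -[1+_]; _⊖_)
open import Data.Integer.Divisibility using (_∣_)
open import Data.List using (List; []; _∷_)
open import Data.Maybe.Base using (just; nothing; Maybe)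
open import Data.Product using (∃; _,_; proj₁)
open import Data.Sum using (inj₁; inj₂)
open import Level using (Level; 0ℓ)
open import Relation.Nullary using (yes; no)
open import Relation.Binary.PropositionalEquality as ≡ using (_≡_; _≗_)
import Data.Integer.Properties as ℤₚ
import Data.Integer.Solver as ℤ-Solver
import Data.Nat.Divisibility as ℕᵈ
import Data.Nat.Properties as ℕₚ

-- The factor 9 cannot be read off from the recurrence: its coefficients 30y - 108y² + 81y³, 12y -
-- 9y² and y are only partly divisible by 3, and the last one is a unit. The weights of the lattices
-- compensate for this. Scaling the k-th series by 3^k turns the coefficients into 3σ₁, 9σ₂ and 27y,
-- and these map both lattices into themselves. The generators 9 G y² (3y)^k carry the factor 9 that
-- extracting 3n+2 brings out, and extracting 3n restores it. Only G y has no such weight; there the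
-- 9 has to come out of an explicit computation. Each sequence is fixed by three initial values.
-- They are taken at non-positive powers of y, because 1/y = 1 - 8q w³ and P = P(q⁹)(1 - 2u) with u
-- = q w(q³). Up to a factor in ℤ[[q³]] each series is then a polynomial in u, and as u³ is itself a
-- series in q³, extraction merely selects every third coefficient.

-- Polynomial identities with integer coefficients over a commutative ring

module IntegerSolver {c ℓ : Level} (R : CommutativeRing c ℓ) where

  open CommutativeRing R
  open import Relation.Binary.Reasoning.Setoid setoid
  open import Algebra.Properties.Ring ring
  open import Algebra.Properties.AbelianGroup +-abelianGroup using (⁻¹-∙-comm)
  open import Algebra.Properties.Semiring.Mult.TCOptimised semiring
  open import Algebra.Solver.Ring.AlmostCommutativeRing

  -- The solver has to decide equality of coefficients, which is impossible for power series, so the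
  -- coefficients are integers. With the optimised multiple, `ι (+ 1)` reduces to `1#`.
  ι : ℤ → Carrier
  ι (+ n)    = n × 1#
  ι -[1+ n ] = - (suc n × 1#)

  private
    cancel-suc : ∀ x a b → x + a - (x + b) ≈ a - b
    cancel-suc x a b = begin
      x + a - (x + b)       ≈⟨ +-congˡ (⁻¹-∙-comm x b) ⟨
      x + a + (- x - b)     ≈⟨ +-congʳ (+-comm x a) ⟩
      a + x + (- x - b)     ≈⟨ +-assoc a x _ ⟩
      a + (x + (- x - b))   ≈⟨ +-congˡ (+-assoc x (- x) (- b)) ⟨
      a + (x - x - b)       ≈⟨ +-congˡ (+-congʳ (-‿inverseʳ x)) ⟩
      a + (0# - b)          ≈⟨ +-congˡ (+-identityˡ _) ⟩
      a - b                 ∎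

    ι-⊖ : ∀ m n → ι (m ⊖ n) ≈ m × 1# - n × 1#
    ι-⊖ m zero = begin
      ι (m ⊖ 0)      ≡⟨⟩
      m × 1#         ≈⟨ +-identityʳ _ ⟨
      m × 1# + 0#    ≈⟨ +-congˡ -0#≈0# ⟨
      m × 1# - 0#    ∎
    ι-⊖ zero (suc n) = sym (+-identityˡ _)
    ι-⊖ (suc m) (suc n) = begin
      ι (suc m ⊖ suc n)            ≡⟨ ≡.cong ι (ℤₚ.[1+m]⊖[1+n]≡m⊖n m n) ⟩
      ι (m ⊖ n)                    ≈⟨ ι-⊖ m n ⟩
      m × 1# - n × 1#              ≈⟨ cancel-suc 1# _ _ ⟨
      1# + m × 1# - (1# + n × 1#)  ≈⟨ +-cong (1+× m 1#) (-‿cong (1+× n 1#)) ⟨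
      suc m × 1# - suc n × 1#      ∎

    ι-+ : ∀ x y → ι (x ℤ.+ y) ≈ ι x + ι y
    ι-+ (+ m) (+ n) = ×-homo-+ 1# m n
    ι-+ (+ m) -[1+ n ] = ι-⊖ m (suc n)
    ι-+ -[1+ m ] (+ n) = trans (ι-⊖ n (suc m)) (+-comm _ _)
    ι-+ -[1+ m ] -[1+ n ] = begin
      - (suc (suc (m ℕ.+ n)) × 1#)       ≡⟨ ≡.cong (λ k → - (suc k × 1#)) (≡.sym (ℕₚ.+-suc m n)) ⟩
      - ((suc m ℕ.+ suc n) × 1#)         ≈⟨ -‿cong (×-homo-+ 1# (suc m) (suc n)) ⟩
      - (suc m × 1# + suc n × 1#)        ≈⟨ ⁻¹-∙-comm _ _ ⟨
      - (suc m × 1#) - suc n × 1#        ∎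

    ι-neg : ∀ x → ι (ℤ.- x) ≈ - ι x
    ι-neg (+ zero)  = sym -0#≈0#
    ι-neg (+ suc n) = refl
    ι-neg -[1+ n ]  = sym (-‿involutive _)

    ι-+* : ∀ m y → ι (+ m ℤ.* y) ≈ ι (+ m) * ι y
    ι-+* zero y = begin
      ι (+ 0 ℤ.* y)   ≡⟨ ≡.cong ι (ℤₚ.*-zeroˡ y) ⟩
      0#              ≈⟨ zeroˡ _ ⟨
      0# * ι y        ∎
    ι-+* (suc m) y = begin
      ι (+ suc m ℤ.* y)           ≡⟨ ≡.cong ι (ℤₚ.suc-* (+ m) y) ⟩
      ι (y ℤ.+ + m ℤ.* y)         ≈⟨ ι-+ y _ ⟩
      ι y + ι (+ m ℤ.* y)         ≈⟨ +-cong (sym (*-identityˡ _)) (ι-+* m y) ⟩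
      1# * ι y + (m × 1#) * ι y   ≈⟨ distribʳ _ _ _ ⟨
      (1# + m × 1#) * ι y         ≈⟨ *-congʳ (1+× m 1#) ⟨
      (suc m × 1#) * ι y          ∎

    ι-* : ∀ x y → ι (x ℤ.* y) ≈ ι x * ι y
    ι-* (+ m) y = ι-+* m y
    ι-* -[1+ m ] y = begin
      ι (-[1+ m ] ℤ.* y)         ≡⟨ ≡.cong ι (≡.sym (ℤₚ.neg-distribˡ-* (+ suc m) y)) ⟩
      ι (ℤ.- (+ suc m ℤ.* y))    ≈⟨ ι-neg (+ suc m ℤ.* y) ⟩
      - ι (+ suc m ℤ.* y)        ≈⟨ -‿cong (ι-+* (suc m) y) ⟩
      - ((suc m × 1#) * ι y)     ≈⟨ -‿distribˡ-* _ _ ⟩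
      - (suc m × 1#) * ι y       ∎

    morphism : ℤ.+-*-rawRing -Raw-AlmostCommutative⟶ fromCommutativeRing R
    morphism = record
      { ⟦_⟧ = ι ; +-homo = ι-+ ; *-homo = ι-* ; -‿homo = ι-neg
      ; 0-homo = refl ; 1-homo = refl }

    _coeff≟_ : ∀ x y → Maybe (ι x ≈ ι y)
    x coeff≟ y with x ℤ.≟ y
    ... | yes ≡.refl = just refl
    ... | no _       = nothing

  open import Algebra.Solver.Ring ℤ.+-*-rawRing (fromCommutativeRing R) morphism _coeff≟_ public
    using (solve; con; _:+_; _:*_; _:-_; :-_; _:^_; _:=_; Polynomial)

-- The commutative ring of formal power series

module SeriesRing where

  open ℤ-Solver.+-*-Solver
  open ≡ using (refl; sym; trans; cong; cong₂)
  open ≡.≡-Reasoning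
  open import Data.Integer using (_+_; _*_; -_)

  -- Opaque, so that unification treats sums as injective instead of unfolding them pointwise.
  infixl 6 _⊕_
  opaque
    _⊕_ : Series → Series → Series
    (f ⊕ g) n = f n + g n

    ⊝_ : Series → Series
    (⊝ f) n = - f n

    ⊕-at : ∀ f g n → (f ⊕ g) n ≡ f n + g n
    ⊕-at f g n = refl

    ⊝-at : ∀ f n → (⊝ f) n ≡ - f n
    ⊝-at f n = refl

  𝟘 : Series
  𝟘 _ = + 0

  tail : Series → Series
  tail f n = f (suc n)

  private
    +ˡ : ∀ a {x y} → x ≡ y → a + x ≡ a + y
    +ˡ a = cong (λ t → a + t)

  infixr 7 _·_
  _·_ : ℤ → Series → Series
  (c · f) n = c * f n

  -- The partial sums inside _⊛_ are local to Defs; unification recovers them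
  -- once the outer index of the convolution is abstracted.
  mutual
    partial : Series → Series → ℕ → ℕ → ℤ
    partial = _

    ⊛-unfold : ∀ f g n → (f ⊛ g) (suc n) ≡ f (suc n) * g (n ℕ.∸ n) + partial f g (suc n) n
    ⊛-unfold f g n with suc n
    ... | m = refl

  -- The definition exposes the term with the top index of `f`. Exposing the term with index 0
  -- instead leaves a convolution with `tail f` in degree one less, so that the ring laws follow by
  -- induction.
  ⊛-suc : ∀ f g n → (f ⊛ g) (suc n) ≡ f 0 * g (suc n) + (tail f ⊛ g) n
  ⊛-suc f g n = shift n
    where
    shift : ∀ i → partial f g (suc n) (suc i) ≡ f 0 * g (suc n) + partial (tail f) g n i
    shift zero    = ℤₚ.+-comm (f 1 * g n) (f 0 * g (suc n))
    shift (suc i) = begin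
      a + partial f g (suc n) (suc i)  ≡⟨ +ˡ (a) (shift i) ⟩
      a + (b + c)                      ≡⟨ solve 3 (λ a b c → a :+ (b :+ c) := b :+ (a :+ c)) refl a b c ⟩
      b + (a + c)                      ∎
      where
      a = f (suc (suc i)) * g (n ℕ.∸ suc i)
      b = f 0 * g (suc n)
      c = partial (tail f) g n i

  ⊛-sucʳ : ∀ f g n → (f ⊛ g) (suc n) ≡ (f ⊛ tail g) n + f (suc n) * g 0
  ⊛-sucʳ f g zero    = ℤₚ.+-comm (f 1 * g 0) (f 0 * g 1)
  ⊛-sucʳ f g (suc n) = begin
    (f ⊛ g) (suc (suc n))                                            ≡⟨ ⊛-suc f g (suc n) ⟩
    f 0 * g (suc (suc n)) + (tail f ⊛ g) (suc n)                     ≡⟨ +ˡ (f 0 * g (suc (suc n))) (⊛-sucʳ (tail f) g n) ⟩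
    f 0 * g (suc (suc n)) + ((tail f ⊛ tail g) n + f (2 ℕ.+ n) * g 0)  ≡⟨ ℤₚ.+-assoc (f 0 * g (suc (suc n))) _ _ ⟨
    f 0 * g (suc (suc n)) + (tail f ⊛ tail g) n + f (2 ℕ.+ n) * g 0    ≡⟨ cong (_+ f (2 ℕ.+ n) * g 0) (⊛-suc f (tail g) n) ⟨
    (f ⊛ tail g) (suc n) + f (2 ℕ.+ n) * g 0                         ∎

  ⊛-cong : ∀ {f f′ g g′} → f ≗ f′ → g ≗ g′ → f ⊛ g ≗ f′ ⊛ g′
  ⊛-cong p r zero = cong₂ _*_ (p 0) (r 0)
  ⊛-cong {f} {f′} {g} {g′} p r (suc n) = begin
    (f ⊛ g) (suc n)                            ≡⟨ ⊛-suc f g n ⟩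
    f 0 * g (suc n) + (tail f ⊛ g) n           ≡⟨ cong₂ _+_ (cong₂ _*_ (p 0) (r (suc n))) (⊛-cong (λ m → p (suc m)) r n) ⟩
    f′ 0 * g′ (suc n) + (tail f′ ⊛ g′) n       ≡⟨ ⊛-suc f′ g′ n ⟨
    (f′ ⊛ g′) (suc n)                          ∎

  ⊛-comm : ∀ f g → f ⊛ g ≗ g ⊛ f
  ⊛-comm f g zero    = ℤₚ.*-comm (f 0) (g 0)
  ⊛-comm f g (suc n) = begin
    (f ⊛ g) (suc n)                      ≡⟨ ⊛-suc f g n ⟩
    f 0 * g (suc n) + (tail f ⊛ g) n     ≡⟨ cong₂ _+_ (ℤₚ.*-comm (f 0) _) (⊛-comm (tail f) g n) ⟩
    g (suc n) * f 0 + (g ⊛ tail f) n     ≡⟨ ℤₚ.+-comm (g (suc n) * f 0) _ ⟩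
    (g ⊛ tail f) n + g (suc n) * f 0     ≡⟨ ⊛-sucʳ g f n ⟨
    (g ⊛ f) (suc n)                      ∎

  ·-⊛ : ∀ c f g → (c · f) ⊛ g ≗ c · (f ⊛ g)
  ·-⊛ c f g zero    = ℤₚ.*-assoc c (f 0) (g 0)
  ·-⊛ c f g (suc n) = begin
    ((c · f) ⊛ g) (suc n)                        ≡⟨ ⊛-suc (c · f) g n ⟩
    c * f 0 * x + ((c · tail f) ⊛ g) n           ≡⟨ +ˡ (c * f 0 * x) (·-⊛ c (tail f) g n) ⟩
    c * f 0 * x + c * y                          ≡⟨ solve 4 (λ c a x y → c :* a :* x :+ c :* y := c :* (a :* x :+ y)) refl c (f 0) x y ⟩
    c * (f 0 * x + y)                            ≡⟨ cong (c *_) (⊛-suc f g n) ⟨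
    (c · (f ⊛ g)) (suc n)                        ∎
    where
    x = g (suc n)
    y = (tail f ⊛ g) n

  ⊛-zeroˡ : ∀ f → 𝟘 ⊛ f ≗ 𝟘
  ⊛-zeroˡ f zero    = ℤₚ.*-zeroˡ (f 0)
  ⊛-zeroˡ f (suc n) = trans (⊛-suc 𝟘 f n) (cong₂ _+_ (ℤₚ.*-zeroˡ (f (suc n))) (⊛-zeroˡ f n))

  ⊛-identityˡ : ∀ f → one ⊛ f ≗ f
  ⊛-identityˡ f zero    = ℤₚ.*-identityˡ (f 0)
  ⊛-identityˡ f (suc n) = begin
    (one ⊛ f) (suc n)              ≡⟨ ⊛-suc one f n ⟩
    + 1 * f (suc n) + (𝟘 ⊛ f) n    ≡⟨ cong₂ _+_ (ℤₚ.*-identityˡ (f (suc n))) (⊛-zeroˡ f n) ⟩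
    f (suc n) + + 0                ≡⟨ ℤₚ.+-identityʳ _ ⟩
    f (suc n)                      ∎

  ⊛-identityʳ : ∀ f → f ⊛ one ≗ f
  ⊛-identityʳ f n = trans (⊛-comm f one n) (⊛-identityˡ f n)

  infix 4 _≋_
  -- A record and not the bare pointwise equality, so that both series can be inferred from the type
  -- of an equation.
  record _≋_ (f g : Series) : Set where
    constructor coeffwise
    field at : f ≗ g
  open _≋_ public

  opaque
    unfolding _⊕_

    ⊛-distribʳ : ∀ h f g → (f ⊕ g) ⊛ h ≗ f ⊛ h ⊕ g ⊛ h
    ⊛-distribʳ h f g zero    = ℤₚ.*-distribʳ-+ (h 0) (f 0) (g 0)
    ⊛-distribʳ h f g (suc n) = begin
      ((f ⊕ g) ⊛ h) (suc n)                          ≡⟨ ⊛-suc (f ⊕ g) h n ⟩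
      (f 0 + g 0) * x + ((tail f ⊕ tail g) ⊛ h) n    ≡⟨ +ˡ ((f 0 + g 0) * x) (⊛-distribʳ h (tail f) (tail g) n) ⟩
      (f 0 + g 0) * x + (y + z)                      ≡⟨ solve 5 (λ a b x y z → (a :+ b) :* x :+ (y :+ z) := (a :* x :+ y) :+ (b :* x :+ z)) refl (f 0) (g 0) x y z ⟩
      (f 0 * x + y) + (g 0 * x + z)                  ≡⟨ cong₂ _+_ (⊛-suc f h n) (⊛-suc g h n) ⟨
      (f ⊛ h ⊕ g ⊛ h) (suc n)                        ∎
      where
      x y z : ℤ
      x = h (suc n)
      y = (tail f ⊛ h) n
      z = (tail g ⊛ h) n

    ⊛-assoc : ∀ f g h → (f ⊛ g) ⊛ h ≗ f ⊛ (g ⊛ h)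
    ⊛-assoc f g h zero    = ℤₚ.*-assoc (f 0) (g 0) (h 0)
    ⊛-assoc f g h (suc n) = begin
      ((f ⊛ g) ⊛ h) (suc n)                                  ≡⟨ ⊛-suc (f ⊛ g) h n ⟩
      f 0 * g 0 * x + (tail (f ⊛ g) ⊛ h) n                   ≡⟨ +ˡ (f 0 * g 0 * x) (⊛-cong (⊛-suc f g) (λ _ → refl) n) ⟩
      f 0 * g 0 * x + ((f 0 · tail g ⊕ tail f ⊛ g) ⊛ h) n    ≡⟨ +ˡ (f 0 * g 0 * x) (⊛-distribʳ h (f 0 · tail g) (tail f ⊛ g) n) ⟩
      f 0 * g 0 * x + (((f 0 · tail g) ⊛ h) n + ((tail f ⊛ g) ⊛ h) n)
        ≡⟨ +ˡ (f 0 * g 0 * x) (cong₂ _+_ (·-⊛ (f 0) (tail g) h n) (⊛-assoc (tail f) g h n)) ⟩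
      f 0 * g 0 * x + (f 0 * y + z)                          ≡⟨ solve 5 (λ a b x y z → a :* b :* x :+ (a :* y :+ z) := a :* (b :* x :+ y) :+ z) refl (f 0) (g 0) x y z ⟩
      f 0 * (g 0 * x + y) + z                                ≡⟨ cong (λ t → f 0 * t + z) (⊛-suc g h n) ⟨
      f 0 * (g ⊛ h) (suc n) + z                              ≡⟨ ⊛-suc f (g ⊛ h) n ⟨
      (f ⊛ (g ⊛ h)) (suc n)                                  ∎
      where
      x y z : ℤ
      x = h (suc n)
      y = (tail g ⊛ h) n
      z = (tail f ⊛ (g ⊛ h)) n

    ⊛-distribˡ : ∀ h f g → h ⊛ (f ⊕ g) ≗ h ⊛ f ⊕ h ⊛ g
    ⊛-distribˡ h f g n = begin
      (h ⊛ (f ⊕ g)) n             ≡⟨ ⊛-comm h (f ⊕ g) n ⟩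
      ((f ⊕ g) ⊛ h) n             ≡⟨ ⊛-distribʳ h f g n ⟩
      (f ⊛ h) n + (g ⊛ h) n       ≡⟨ cong₂ _+_ (⊛-comm f h n) (⊛-comm g h n) ⟩
      (h ⊛ f) n + (h ⊛ g) n       ∎

    isCommutativeRing : IsCommutativeRing _≋_ _⊕_ _⊛_ ⊝_ 𝟘 one
    isCommutativeRing = record
      { isRing = record
        { +-isAbelianGroup = record
          { isGroup = record
            { isMonoid = record
              { isSemigroup = record
                { isMagma = record
                  { isEquivalence = record
                    { refl  = coeffwise λ _ → refl
                    ; sym   = λ p → coeffwise λ n → sym (at p n)
                    ; trans = λ p r → coeffwise λ n → trans (at p n) (at r n)
                    }
                  ; ∙-cong = λ p r → coeffwise λ n → cong₂ _+_ (at p n) (at r n)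
                  }
                ; assoc = λ f g h → coeffwise λ n → ℤₚ.+-assoc (f n) (g n) (h n)
                }
              ; identity = (λ f → coeffwise λ n → ℤₚ.+-identityˡ (f n)) , (λ f → coeffwise λ n → ℤₚ.+-identityʳ (f n))
              }
            ; inverse = (λ f → coeffwise λ n → ℤₚ.+-inverseˡ (f n)) , (λ f → coeffwise λ n → ℤₚ.+-inverseʳ (f n))
            ; ⁻¹-cong = λ p → coeffwise λ n → cong -_ (at p n)
            }
          ; comm = λ f g → coeffwise λ n → ℤₚ.+-comm (f n) (g n)
          }
        ; *-cong     = λ p r → coeffwise (⊛-cong (at p) (at r))
        ; *-assoc    = λ f g h → coeffwise (⊛-assoc f g h)
        ; *-identity = (λ f → coeffwise (⊛-identityˡ f)) , (λ f → coeffwise (⊛-identityʳ f))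
        ; distrib    = (λ h f g → coeffwise (⊛-distribˡ h f g)) , (λ h f g → coeffwise (⊛-distribʳ h f g))
        }
      ; *-comm = λ f g → coeffwise (⊛-comm f g)
      }

  seriesRing : CommutativeRing 0ℓ 0ℓ
  seriesRing = record { isCommutativeRing = isCommutativeRing }

module Congruence where

  open SeriesRing
  open CommutativeRing seriesRing
  open IntegerSolver seriesRing
  open import Algebra.Properties.Semiring.Exp semiring
    using (_^_; ^-congˡ; ^-homo-*; ^-assocʳ)
  open import Relation.Binary.Reasoning.Setoid setoid

  -- Congruence modulo q^K and infinite products

  module Truncation where

    infix 4 _≈[_]_
    record _≈[_]_ (f : Series) (K : ℕ) (u : Series) : Set where
      constructor below
      field at< : ∀ n → n < K → f n ≡ u n
    open _≈[_]_ public

    private variable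
      f f′ u u′ h : Series
      F F′ : ℕ → Series
      K L N : ℕ

    ≈⇒≈[] : f ≈ u → f ≈[ K ] u
    ≈⇒≈[] p = below λ n _ → at p n

    ≈[]⇒≈ : (∀ K → f ≈[ K ] u) → f ≈ u
    ≈[]⇒≈ p = coeffwise λ n → at< (p (suc n)) n ℕₚ.≤-refl

    ≈[]-sym : f ≈[ K ] u → u ≈[ K ] f
    ≈[]-sym p = below λ n n<K → ≡.sym (at< p n n<K)

    infixr 4 _⊙_
    _⊙_ : f ≈[ K ] u → u ≈[ K ] h → f ≈[ K ] h
    p ⊙ r = below λ n n<K → ≡.trans (at< p n n<K) (at< r n n<K)

    ≈[]-weaken : L ≤ K → f ≈[ K ] u → f ≈[ L ] u
    ≈[]-weaken L≤K p = below λ n n<L → at< p n (ℕₚ.≤-trans n<L L≤K)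

    +-cong[] : f ≈[ K ] f′ → u ≈[ K ] u′ → f + u ≈[ K ] f′ + u′
    +-cong[] {f} {K} {f′} {u} {u′} p r = below λ n n<K →
      ≡.trans (⊕-at f u n) (≡.trans (≡.cong₂ ℤ._+_ (at< p n n<K) (at< r n n<K)) (≡.sym (⊕-at f′ u′ n)))

    -‿cong[] : f ≈[ K ] u → - f ≈[ K ] - u
    -‿cong[] {f} {K} {u} p = below λ n n<K →
      ≡.trans (⊝-at f n) (≡.trans (≡.cong ℤ.-_ (at< p n n<K)) (≡.sym (⊝-at u n)))

    tail-cong[] : f ≈[ suc K ] u → tail f ≈[ K ] tail u
    tail-cong[] p = below λ n n<K → at< p (suc n) (s≤s n<K)

    *-cong[] : f ≈[ K ] f′ → u ≈[ K ] u′ → f * u ≈[ K ] f′ * u′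
    *-cong[] p r = below (go p r)
      where
      go : f ≈[ K ] f′ → u ≈[ K ] u′ → ∀ n → n < K → (f * u) n ≡ (f′ * u′) n
      go p r zero n<K = ≡.cong₂ ℤ._*_ (at< p 0 n<K) (at< r 0 n<K)
      go {f} {suc K} {f′} {u} {u′} p r (suc n) (s≤s n<K) =
        ≡.trans (⊛-suc f u n)
          (≡.trans (≡.cong₂ ℤ._+_
                      (≡.cong₂ ℤ._*_ (at< p 0 (s≤s z≤n)) (at< r (suc n) (s≤s n<K)))
                      (go (tail-cong[] p) (≈[]-weaken (ℕₚ.n≤1+n K) r) n n<K))
            (≡.sym (⊛-suc f′ u′ n)))

    *-order : f ≈[ K ] 0# → u ≈[ L ] 0# → f * u ≈[ K ℕ.+ L ] 0#
    *-order {K = zero} {u = u} {L} p r =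
      *-cong[] (≈⇒≈[] refl) r ⊙ ≈⇒≈[] (zeroʳ _)
    *-order {f} {suc K} {u} {L} p r = below go
      where
      go : ∀ n → n < suc K ℕ.+ L → (f * u) n ≡ + 0
      go zero    _         = ≡.cong (ℤ._* u 0) (at< p 0 (s≤s z≤n))
      go (suc n) (s≤s n<)  =
        ≡.trans (⊛-suc f u n)
          (≡.cong₂ ℤ._+_ (≡.cong (ℤ._* u (suc n)) (at< p 0 (s≤s z≤n)))
                         (at< (*-order {tail f} {K} {u} {L} (tail-cong[] p) r) n n<))

    ^-order : f ≈[ 1 ] 0# → ∀ n → f ^ n ≈[ n ] 0#
    ^-order p zero    = below λ _ ()
    ^-order p (suc n) = *-order p (^-order p n)

    1+order : u ≈[ K ] 0# → 1# + u ≈[ K ] 1#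
    1+order p = +-cong[] (≈⇒≈[] {1#} refl) p ⊙ ≈⇒≈[] (+-identityʳ 1#)

    *-unit[] : f ≈[ K ] 1# → u ≈[ K ] 1# → f * u ≈[ K ] 1#
    *-unit[] p r = *-cong[] p r ⊙ ≈⇒≈[] (*-identityˡ 1#)

    prod-cong : (∀ k → F k ≈ F′ k) → ∀ N → prodBelow F N ≈ prodBelow F′ N
    prod-cong p zero    = refl
    prod-cong p (suc N) = *-cong (prod-cong p N) (p N)

    prod-shift : ∀ F N → prodBelow F (suc N) ≈ F 0 * prodBelow (λ k → F (suc k)) N
    prod-shift F zero    = *-comm _ _
    prod-shift F (suc N) = trans (*-congʳ (prod-shift F N)) (*-assoc _ _ _)

    prod-* : ∀ F F′ N → prodBelow (λ k → F k * F′ k) N ≈ prodBelow F N * prodBelow F′ N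
    prod-* F F′ zero    = sym (*-identityˡ 1#)
    prod-* F F′ (suc N) = trans (*-congʳ (prod-* F F′ N))
      (solve 4 (λ a b c d → a :* b :* (c :* d) := a :* c :* (b :* d)) refl _ _ _ _)

    prod-unit[] : (∀ k → F k ≈[ K ] 1#) → ∀ N → prodBelow F N ≈[ K ] 1#
    prod-unit[] p zero    = ≈⇒≈[] refl
    prod-unit[] p (suc N) = *-unit[] (prod-unit[] p N) (p N)

    -- Order k for the k-th factor, and not k + 1, because a factor 1 + a Q^k with a unit `a`
    -- reaches no more. This still suffices: `infProd` reads the coefficient of q^n from the factors
    -- up to index n, and all later ones are 1 modulo q^(n+1).
    Tame : (ℕ → Series) → Set
    Tame F = ∀ k → F k ≈[ k ] 1#

    prod-stable : Tame F → ∀ N d → prodBelow F (d ℕ.+ N) ≈[ N ] prodBelow F N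
    prod-stable t N zero    = ≈⇒≈[] refl
    prod-stable {F} t N (suc d) =
      *-cong[] (prod-stable t N d) (≈[]-weaken (ℕₚ.m≤n+m N d) (t (d ℕ.+ N))) ⊙ ≈⇒≈[] (*-identityʳ _)

    prod-stable-≤ : Tame F → ∀ {M} → N ≤ M → prodBelow F M ≈[ N ] prodBelow F N
    prod-stable-≤ {F} {N} t {M} N≤M =
      ≡.subst (λ m → prodBelow F m ≈[ N ] prodBelow F N) (ℕₚ.m∸n+n≡m N≤M) (prod-stable t N (M ℕ.∸ N))

    infProd≈[] : Tame F → ∀ N → infProd F ≈[ N ] prodBelow F N
    infProd≈[] t N = below λ n n<N → ≡.sym (at< (prod-stable-≤ t n<N) n ℕₚ.≤-refl)

    infProd-cong : (∀ k → F k ≈ F′ k) → infProd F ≈ infProd F′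
    infProd-cong p = coeffwise λ n → at (prod-cong p (suc n)) n

    *-tame : Tame F → Tame F′ → Tame (λ k → F k * F′ k)
    *-tame t t′ k = *-unit[] (t k) (t′ k)

    infProd-* : Tame F → Tame F′ → infProd (λ k → F k * F′ k) ≈ infProd F * infProd F′
    infProd-* {F} {F′} t t′ = ≈[]⇒≈ λ K →
      infProd≈[] (*-tame t t′) K ⊙ ≈⇒≈[] (prod-* F F′ K)
        ⊙ ≈[]-sym (*-cong[] (infProd≈[] t K) (infProd≈[] t′ K))

    prod-2 : ∀ F N → prodBelow F (N ℕ.* 2) ≈ prodBelow (λ k → F (k ℕ.* 2) * F (1 ℕ.+ k ℕ.* 2)) N
    prod-2 F zero    = refl
    prod-2 F (suc N) = trans (*-assoc _ _ _) (*-congʳ (prod-2 F N))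

    prod-3 : ∀ F N → prodBelow F (N ℕ.* 3) ≈
      prodBelow (λ k → F (k ℕ.* 3) * F (1 ℕ.+ k ℕ.* 3) * F (2 ℕ.+ k ℕ.* 3)) N
    prod-3 F zero    = refl
    prod-3 F (suc N) = trans
      (solve 4 (λ a b c d → a :* b :* c :* d := a :* (b :* c :* d)) refl _ _ _ _)
      (*-congʳ (prod-3 F N))

    n≤n*[1+d] : ∀ n d → n ≤ n ℕ.* suc d
    n≤n*[1+d] n d = ℕₚ.m≤m*n n (suc d)

    private
      ≤-shift : ∀ k d i → k ≤ i ℕ.+ k ℕ.* suc d
      ≤-shift k d i = ℕₚ.≤-trans (n≤n*[1+d] k d) (ℕₚ.m≤n+m _ i)

    subfamily-tame : Tame F → ∀ i d → Tame (λ k → F (i ℕ.+ k ℕ.* suc d))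
    subfamily-tame t i d k = ≈[]-weaken (≤-shift k d i) (t _)

    infProd-2 : Tame F →
      infProd F ≈ infProd (λ k → F (k ℕ.* 2)) * infProd (λ k → F (1 ℕ.+ k ℕ.* 2))
    infProd-2 {F} t = trans
      (≈[]⇒≈ λ K → ≈[]-weaken (n≤n*[1+d] K 1) (infProd≈[] t (K ℕ.* 2)) ⊙ ≈⇒≈[] (prod-2 F K)
         ⊙ ≈[]-sym (infProd≈[] (*-tame (subfamily-tame t 0 1) (subfamily-tame t 1 1)) K))
      (infProd-* (subfamily-tame t 0 1) (subfamily-tame t 1 1))

    infProd-3 : Tame F → infProd F ≈
      infProd (λ k → F (k ℕ.* 3)) * infProd (λ k → F (1 ℕ.+ k ℕ.* 3)) * infProd (λ k → F (2 ℕ.+ k ℕ.* 3))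
    infProd-3 {F} t = trans
      (≈[]⇒≈ λ K → ≈[]-weaken (n≤n*[1+d] K 2) (infProd≈[] t (K ℕ.* 3)) ⊙ ≈⇒≈[] (prod-3 F K)
         ⊙ ≈[]-sym (infProd≈[] (*-tame (*-tame t₀ t₁) t₂) K))
      (trans (infProd-* (*-tame t₀ t₁) t₂) (*-congʳ (infProd-* t₀ t₁)))
      where
      t₀ = subfamily-tame t 0 2
      t₁ = subfamily-tame t 1 2
      t₂ = subfamily-tame t 2 2

  open Truncation

  -- The Jacobi triple product as a limit of its finite form

  module JacobiTripleProduct where

    private variable
      A B : ℕ → Series
      K : ℕ

    sumBelow : (ℕ → Series) → ℕ → Series
    sumBelow A zero    = 0#
    sumBelow A (suc n) = sumBelow A n + A n

    sum-cong : (∀ k → A k ≈ B k) → ∀ n → sumBelow A n ≈ sumBelow B n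
    sum-cong p zero    = refl
    sum-cong p (suc n) = +-cong (sum-cong p n) (p n)

    sum-cong[] : ∀ n → (∀ k → k < n → A k ≈[ K ] B k) → sumBelow A n ≈[ K ] sumBelow B n
    sum-cong[] zero    p = ≈⇒≈[] refl
    sum-cong[] (suc n) p =
      +-cong[] (sum-cong[] n (λ k k<n → p k (ℕₚ.m<n⇒m<1+n k<n))) (p n ℕₚ.≤-refl)

    sum-+ : ∀ A B n → sumBelow (λ k → A k + B k) n ≈ sumBelow A n + sumBelow B n
    sum-+ A B zero    = sym (+-identityˡ 0#)
    sum-+ A B (suc n) = trans (+-congʳ (sum-+ A B n))
      (solve 4 (λ a b c d → a :+ b :+ (c :+ d) := a :+ c :+ (b :+ d)) refl _ _ _ _)

    sum-* : ∀ c A n → sumBelow (λ k → c * A k) n ≈ c * sumBelow A n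
    sum-* c A zero    = sym (zeroʳ c)
    sum-* c A (suc n) = trans (+-congʳ (sum-* c A n)) (sym (distribˡ c _ _))

    sum-shift : ∀ A n → sumBelow A (suc n) ≈ A 0 + sumBelow (λ k → A (suc k)) n
    sum-shift A zero    = +-comm 0# (A 0)
    sum-shift A (suc n) = trans (+-congʳ (sum-shift A n)) (+-assoc _ _ _)

    sum-3 : ∀ A n → sumBelow A (n ℕ.* 3) ≈
      sumBelow (λ k → A (k ℕ.* 3) + A (1 ℕ.+ k ℕ.* 3) + A (2 ℕ.+ k ℕ.* 3)) n
    sum-3 A zero    = refl
    sum-3 A (suc n) = trans
      (solve 4 (λ a b c d → a :+ b :+ c :+ d := a :+ (b :+ c :+ d)) refl _ _ _ _)
      (+-congʳ (sum-3 A n))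

    module QBinomial (Q : Series) where

      -- Gaussian binomial coefficients by the q-Pascal rule, which avoids dividing by q-factorials.
      gauss : ℕ → ℕ → Series
      gauss m       zero    = 1#
      gauss zero    (suc k) = 0#
      gauss (suc m) (suc k) = gauss m k + Q ^ suc k * gauss m (suc k)

      gauss-above : ∀ m d → gauss m (suc m ℕ.+ d) ≈ 0#
      gauss-above zero    d = refl
      gauss-above (suc m) d = begin
        gauss m (suc m ℕ.+ d) + Q ^ suc (suc m ℕ.+ d) * gauss m (suc (suc m ℕ.+ d))
          ≈⟨ +-cong (gauss-above m d) (*-congˡ (trans (reflexive (≡.cong (gauss m) (≡.sym (ℕₚ.+-suc (suc m) d)))) (gauss-above m (suc d)))) ⟩
        0# + Q ^ suc (suc m ℕ.+ d) * 0#
          ≈⟨ solve 1 (λ x → con (+ 0) :+ x :* con (+ 0) := con (+ 0)) refl _ ⟩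
        0# ∎

      -- The q-Pascal rule summed against an arbitrary sequence. The induction steps of the
      -- q-binomial theorem and of the finite triple product are both instances.
      sum-pascal : ∀ m (A : ℕ → Series) →
        sumBelow (λ k → gauss (suc m) k * A k) (suc (suc m)) ≈
        sumBelow (λ k → gauss m k * (A (suc k) + Q ^ k * A k)) (suc m)
      sum-pascal m A = begin
        sumBelow (λ k → gauss (suc m) k * A k) (suc (suc m))
          ≈⟨ sum-shift _ (suc m) ⟩
        1# * A 0 + sumBelow (λ k → gauss (suc m) (suc k) * A (suc k)) (suc m)
          ≈⟨ +-congˡ (trans (sum-cong (λ k → distribʳ _ _ _) (suc m)) (sum-+ _ _ (suc m))) ⟩
        1# * A 0 + (S + sumBelow (λ k → Q ^ suc k * gauss m (suc k) * A (suc k)) (suc m))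
          ≈⟨ solve 3 (λ a s r → con (+ 1) :* a :+ (s :+ r) := s :+ (con (+ 1) :* (con (+ 1) :* a) :+ r)) refl _ _ _ ⟩
        S + (1# * (1# * A 0) + sumBelow (λ k → Q ^ suc k * gauss m (suc k) * A (suc k)) (suc m))
          ≈⟨ +-congˡ (+-congˡ (sum-cong (λ k → solve 3 (λ a b c → a :* b :* c := b :* (a :* c)) refl _ _ _) (suc m))) ⟩
        S + (1# * (1# * A 0) + sumBelow (λ k → gauss m (suc k) * (Q ^ suc k * A (suc k))) (suc m))
          ≈⟨ +-congˡ (sum-shift _ (suc m)) ⟨
        S + (sumBelow (λ k → gauss m k * (Q ^ k * A k)) (suc m) + gauss m (suc m) * (Q ^ suc m * A (suc m)))
          ≈⟨ +-congˡ (trans (+-congˡ (trans (*-congʳ above) (zeroˡ _))) (+-identityʳ _)) ⟩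
        S + sumBelow (λ k → gauss m k * (Q ^ k * A k)) (suc m)
          ≈⟨ sum-+ _ _ (suc m) ⟨
        sumBelow (λ k → gauss m k * A (suc k) + gauss m k * (Q ^ k * A k)) (suc m)
          ≈⟨ sum-cong (λ k → distribˡ _ _ _) (suc m) ⟨
        sumBelow (λ k → gauss m k * (A (suc k) + Q ^ k * A k)) (suc m) ∎
        where
        S = sumBelow (λ k → gauss m k * A (suc k)) (suc m)
        above : gauss m (suc m) ≈ 0#
        above = trans (reflexive (≡.cong (λ n → gauss m (suc n)) (≡.sym (ℕₚ.+-identityʳ m)))) (gauss-above m 0)

      1-Q^ : ℕ → ℕ → Series
      1-Q^ j l = 1# - Q ^ (suc j ℕ.+ l)

      rising : ℕ → ℕ → Series
      rising j = prodBelow (1-Q^ j)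

      rising-shift : ∀ j n → rising j (suc n) ≈ 1-Q^ j 0 * rising (suc j) n
      rising-shift j n = trans (prod-shift _ n) (*-congˡ (prod-cong step n))
        where
        step : ∀ k → 1-Q^ j (suc k) ≈ 1-Q^ (suc j) k
        step k = reflexive (≡.cong (λ n → 1# - Q ^ n) (ℕₚ.+-suc (suc j) k))

      -- The product formula without division, by q-Pascal in i and j together. The parameters i and
      -- j are the two distances that grow in the limit.
      gauss-closed : ∀ i j → gauss (i ℕ.+ j) i * rising 0 i ≈ rising j i
      gauss-closed zero    j       = *-identityˡ 1#
      gauss-closed (suc i) zero    = begin
        gauss (suc i ℕ.+ 0) (suc i) * rising 0 (suc i)   ≈⟨ *-congʳ (+-congˡ (trans (*-congˡ above) (zeroʳ _))) ⟩
        (gauss (i ℕ.+ 0) i + 0#) * (rising 0 i * 1-Q^ 0 i)  ≈⟨ solve 3 (λ g r f → (g :+ con (+ 0)) :* (r :* f) := g :* r :* f) refl _ _ _ ⟩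
        gauss (i ℕ.+ 0) i * rising 0 i * 1-Q^ 0 i      ≈⟨ *-congʳ (gauss-closed i 0) ⟩
        rising 0 (suc i)                               ∎
        where
        above : gauss (i ℕ.+ 0) (suc i) ≈ 0#
        above = trans (reflexive (≡.cong (λ n → gauss n (suc i)) (ℕₚ.+-identityʳ i)))
                  (trans (reflexive (≡.cong (λ n → gauss i (suc n)) (≡.sym (ℕₚ.+-identityʳ i)))) (gauss-above i 0))
      gauss-closed (suc i) (suc j) = begin
        (gauss (i ℕ.+ suc j) i + Q ^ suc i * gauss (i ℕ.+ suc j) (suc i)) * (rising 0 i * 1-Q^ 0 i)
          ≈⟨ solve 5 (λ g h q r f → (g :+ q :* h) :* (r :* f) := g :* r :* f :+ q :* (h :* (r :* f))) refl _ _ _ _ _ ⟩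
        gauss (i ℕ.+ suc j) i * rising 0 i * 1-Q^ 0 i + Q ^ suc i * (gauss (i ℕ.+ suc j) (suc i) * rising 0 (suc i))
          ≈⟨ +-cong (*-congʳ (gauss-closed i (suc j))) (*-congˡ (trans (*-congʳ (reflexive (≡.cong (λ n → gauss n (suc i)) (ℕₚ.+-suc i j)))) (gauss-closed (suc i) j))) ⟩
        rising (suc j) i * 1-Q^ 0 i + Q ^ suc i * rising j (suc i)
          ≈⟨ +-congˡ (*-congˡ (rising-shift j i)) ⟩
        rising (suc j) i * 1-Q^ 0 i + Q ^ suc i * (1-Q^ j 0 * rising (suc j) i)
          ≈⟨ solve 3 (λ r x y → r :* (con (+ 1) :- x) :+ x :* ((con (+ 1) :- y) :* r) := r :* (con (+ 1) :- y :* x)) refl _ _ _ ⟩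
        rising (suc j) i * (1# - Q ^ (suc j ℕ.+ 0) * Q ^ suc i)
          ≈⟨ *-congˡ (+-congˡ (-‿cong exponent)) ⟩
        rising (suc j) (suc i) ∎
        where
        exponent : Q ^ (suc j ℕ.+ 0) * Q ^ suc i ≈ Q ^ (suc (suc j) ℕ.+ i)
        exponent = trans (sym (^-homo-* Q (suc j ℕ.+ 0) (suc i)))
          (reflexive (≡.cong (Q ^_) (≡.trans (≡.cong (ℕ._+ suc i) (ℕₚ.+-identityʳ (suc j))) (ℕₚ.+-suc (suc j) i))))

      -- a^n Q^(n(n-1)/2), the n-th term (n ≥ 0) of Ramanujan's theta series f(a , Q/a)
      term : Series → ℕ → Series
      term a = prodBelow (λ k → a * Q ^ k)

      1+aQ^ : Series → ℕ → Series
      1+aQ^ a k = 1# + a * Q ^ k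

      term-Q : ∀ a k → term (a * Q) k ≈ Q ^ k * term a k
      term-Q a zero    = sym (*-identityˡ 1#)
      term-Q a (suc k) = trans (*-congʳ (term-Q a k))
        (solve 4 (λ a q x t → x :* t :* (a :* q :* x) := q :* x :* (t :* (a :* x))) refl _ _ _ _)

      q-binomial : ∀ a n → prodBelow (1+aQ^ a) n ≈ sumBelow (λ k → gauss n k * term a k) (suc n)
      q-binomial a zero    = solve 0 (con (+ 1) := con (+ 0) :+ con (+ 1) :* con (+ 1)) refl
      q-binomial a (suc n) = begin
        prodBelow (1+aQ^ a) (suc n)                                   ≈⟨ prod-shift (1+aQ^ a) n ⟩
        1+aQ^ a 0 * prodBelow (λ k → 1+aQ^ a (suc k)) n               ≈⟨ *-congˡ (prod-cong (λ k → +-congˡ (sym (*-assoc a Q _))) n) ⟩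
        1+aQ^ a 0 * prodBelow (1+aQ^ (a * Q)) n                       ≈⟨ *-congˡ (q-binomial (a * Q) n) ⟩
        1+aQ^ a 0 * sumBelow (λ k → gauss n k * term (a * Q) k) (suc n) ≈⟨ sum-* _ _ (suc n) ⟨
        sumBelow (λ k → 1+aQ^ a 0 * (gauss n k * term (a * Q) k)) (suc n)  ≈⟨ sum-cong step (suc n) ⟩
        sumBelow (λ k → gauss n k * (term a (suc k) + Q ^ k * term a k)) (suc n)  ≈⟨ sum-pascal n (term a) ⟨
        sumBelow (λ k → gauss (suc n) k * term a k) (suc (suc n))     ∎
        where
        step : ∀ k → 1+aQ^ a 0 * (gauss n k * term (a * Q) k) ≈ gauss n k * (term a (suc k) + Q ^ k * term a k)
        step k = trans (*-congˡ (*-congˡ (term-Q a k)))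
          (solve 4 (λ a g x t → (con (+ 1) :+ a :* con (+ 1)) :* (g :* (x :* t)) := g :* (t :* (a :* x) :+ x :* t)) refl _ _ _ _)

      -- biterm a b M k is the term of index k - M of f(a , b).
      biterm : Series → Series → ℕ → ℕ → Series
      biterm a b zero    k       = term a k
      biterm a b (suc M) zero    = term b (suc M)
      biterm a b (suc M) (suc k) = biterm a b M k

      biterm-0 : ∀ a b M → biterm a b M 0 ≈ term b M
      biterm-0 a b zero    = refl
      biterm-0 a b (suc M) = refl

      biterm-right : ∀ a b M r → biterm a b M (M ℕ.+ r) ≈ term a r
      biterm-right a b zero    r = refl
      biterm-right a b (suc M) r = biterm-right a b M r

      biterm-left : ∀ a b k r → biterm a b (k ℕ.+ r) k ≈ term b r
      biterm-left a b zero    r = biterm-0 a b r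
      biterm-left a b (suc k) r = biterm-left a b k r

      module _ (a b : Series) (ab≈Q : a * b ≈ Q) where

        -- The terms of index n - 1 and n of f(a, b) have the ratio a^n b^(n-1), that is Q^n / b;
        -- here n = k - M.
        biterm-step : ∀ M k → biterm a b M k * (b * Q ^ M) ≈ Q ^ k * biterm a b (suc M) k
        biterm-step zero    zero    = solve 1 (λ b → con (+ 1) :* (b :* con (+ 1)) := con (+ 1) :* (con (+ 1) :* (b :* con (+ 1)))) refl b
        biterm-step zero    (suc k) = begin
          term a k * (a * Q ^ k) * (b * 1#)   ≈⟨ solve 4 (λ t a b x → t :* (a :* x) :* (b :* con (+ 1)) := a :* b :* x :* t) refl _ _ _ _ ⟩
          a * b * Q ^ k * term a k            ≈⟨ *-congʳ (*-congʳ ab≈Q) ⟩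
          Q ^ suc k * term a k                ∎
        biterm-step (suc M) zero    = sym (*-identityˡ _)
        biterm-step (suc M) (suc k) = begin
          biterm a b M k * (b * (Q * Q ^ M))   ≈⟨ solve 4 (λ t b q x → t :* (b :* (q :* x)) := q :* (t :* (b :* x))) refl _ _ _ _ ⟩
          Q * (biterm a b M k * (b * Q ^ M))   ≈⟨ *-congˡ (biterm-step M k) ⟩
          Q * (Q ^ k * biterm a b (suc M) k)   ≈⟨ *-assoc _ _ _ ⟨
          Q ^ suc k * biterm a b (suc M) k     ∎

        -- Induction on the number of factors in `b`: each new one moves the origin of the two-sided
        -- index by one place, and q-Pascal merges the two sums that result. For M = 0 this is the
        -- q-binomial theorem.
        finite-jacobi : ∀ M N → prodBelow (1+aQ^ a) N * prodBelow (1+aQ^ b) M ≈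
          sumBelow (λ k → gauss (M ℕ.+ N) k * biterm a b M k) (suc (M ℕ.+ N))
        finite-jacobi zero    N = trans (*-identityʳ _) (q-binomial a N)
        finite-jacobi (suc M) N = begin
          prodBelow (1+aQ^ a) N * (prodBelow (1+aQ^ b) M * 1+aQ^ b M)
            ≈⟨ *-assoc _ _ _ ⟨
          prodBelow (1+aQ^ a) N * prodBelow (1+aQ^ b) M * 1+aQ^ b M
            ≈⟨ *-congʳ (finite-jacobi M N) ⟩
          sumBelow (λ k → gauss (M ℕ.+ N) k * biterm a b M k) (suc (M ℕ.+ N)) * 1+aQ^ b M
            ≈⟨ *-comm _ _ ⟩
          1+aQ^ b M * sumBelow (λ k → gauss (M ℕ.+ N) k * biterm a b M k) (suc (M ℕ.+ N))
            ≈⟨ sum-* _ _ (suc (M ℕ.+ N)) ⟨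
          sumBelow (λ k → 1+aQ^ b M * (gauss (M ℕ.+ N) k * biterm a b M k)) (suc (M ℕ.+ N))
            ≈⟨ sum-cong step (suc (M ℕ.+ N)) ⟩
          sumBelow (λ k → gauss (M ℕ.+ N) k * (biterm a b (suc M) (suc k) + Q ^ k * biterm a b (suc M) k)) (suc (M ℕ.+ N))
            ≈⟨ sum-pascal (M ℕ.+ N) (biterm a b (suc M)) ⟨
          sumBelow (λ k → gauss (suc M ℕ.+ N) k * biterm a b (suc M) k) (suc (suc M ℕ.+ N)) ∎
          where
          step : ∀ k → 1+aQ^ b M * (gauss (M ℕ.+ N) k * biterm a b M k) ≈
            gauss (M ℕ.+ N) k * (biterm a b (suc M) (suc k) + Q ^ k * biterm a b (suc M) k)
          step k = trans
            (solve 3 (λ y g t → (con (+ 1) :+ y) :* (g :* t) := g :* (t :+ t :* y)) refl _ _ _)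
            (*-congˡ (+-congˡ (biterm-step M k)))

      qInf : Series
      qInf = infProd (1-Q^ 0)

      -- Ramanujan's f(a, b) in product form, for arguments with a b = Q.
      theta : Series → Series → Series
      theta a b = qInf * infProd (1+aQ^ a) * infProd (1+aQ^ b)

      module _ (Q-order : Q ≈[ 1 ] 0#) where

        1+aQ^-tame : ∀ a → Tame (1+aQ^ a)
        1+aQ^-tame a k = 1+order (*-cong[] (≈⇒≈[] {a} refl) (^-order Q-order k) ⊙ ≈⇒≈[] (zeroʳ a))

        1-Q^-unit : ∀ j l → 1-Q^ j l ≈[ suc j ℕ.+ l ] 1#
        1-Q^-unit j l = 1+order (-‿cong[] (^-order Q-order (suc j ℕ.+ l)) ⊙ ≈⇒≈[] -0#≈0#)
          where open import Algebra.Properties.Ring ring using (-0#≈0#)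

        1-Q^-tame : Tame (1-Q^ 0)
        1-Q^-tame l = ≈[]-weaken (ℕₚ.n≤1+n l) (1-Q^-unit 0 l)

        -- By `gauss-closed`, multiplying by the first i factors of (Q;Q)_∞ leaves only factors 1 -
        -- Q^l with l > j; the factors beyond the i-th are 1 to the required order anyway.
        gauss-limit : ∀ i j → K ≤ i → K ≤ j → gauss (i ℕ.+ j) i * qInf ≈[ K ] 1#
        gauss-limit i j K≤i K≤j =
          *-cong[] (≈⇒≈[] refl) (≈[]-weaken K≤i (infProd≈[] 1-Q^-tame i))
            ⊙ ≈⇒≈[] (gauss-closed i j)
            ⊙ prod-unit[] (λ l → ≈[]-weaken (ℕₚ.≤-trans K≤j (ℕₚ.≤-trans (ℕₚ.n≤1+n j) (ℕₚ.m≤m+n (suc j) l))) (1-Q^-unit j l)) i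

        -- Only the power Q^r in the last factor is counted, since `a` may be a unit: it is 1 in the
        -- theta series of ψ.
        term-order : ∀ a r → term a (suc r) ≈[ r ] 0#
        term-order a r = *-cong[] (≈⇒≈[] {term a r} refl)
          (*-cong[] (≈⇒≈[] {a} refl) (^-order Q-order r) ⊙ ≈⇒≈[] (zeroʳ a)) ⊙ ≈⇒≈[] (zeroʳ _)

        -- The Gaussian binomial is 1/(Q;Q)_∞ up to order d, and the term has order r - 1.
        gauss-term-limit : ∀ a {i j d r n L} → i ℕ.+ j ≡ n → r ℕ.+ d ≡ suc L → d ≤ i → d ≤ j →
          gauss n i * qInf * term a r ≈[ L ] term a r
        gauss-term-limit a {i} {j} {r = zero} {L = L} ≡.refl ≡.refl d≤i d≤j =
          ≈[]-weaken (ℕₚ.n≤1+n L) (*-cong[] (gauss-limit i j d≤i d≤j) (≈⇒≈[] refl)) ⊙ ≈⇒≈[] (*-identityˡ _)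
        gauss-term-limit a {i} {j} {r = suc r} ≡.refl ≡.refl d≤i d≤j =
          ≈⇒≈[] (solve 2 (λ g t → g :* t := t :+ t :* (g :- con (+ 1))) refl _ _)
            ⊙ +-cong[] (≈⇒≈[] {term a (suc r)} refl)
                (*-order (term-order a r) (+-cong[] (gauss-limit i j d≤i d≤j) (≈⇒≈[] { - 1#} refl)
                  ⊙ ≈⇒≈[] (-‿inverseʳ 1#)))
            ⊙ ≈⇒≈[] (+-identityʳ _)

        -- Modulo q^L only the indices from -(L+1) to L+1 of the two-sided sum are kept. The window
        -- reaches one place beyond L because `term-order` loses one order.
        jacobi : ∀ a b → a * b ≈ Q → ∀ L →
          theta a b ≈[ L ] sumBelow (biterm a b (suc L)) (suc (suc L ℕ.+ suc L))
        jacobi a b ab≈Q L =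
          ≈[]-weaken (ℕₚ.n≤1+n L)
            (*-cong[] (*-cong[] (≈⇒≈[] {qInf} refl) (infProd≈[] (1+aQ^-tame a) N)) (infProd≈[] (1+aQ^-tame b) N)
              ⊙ ≈⇒≈[] (trans (*-assoc _ _ _) (*-congˡ (finite-jacobi a b ab≈Q N N)))
              ⊙ ≈⇒≈[] (sym (sum-* qInf _ (suc (N ℕ.+ N)))))
          ⊙ sum-cong[] (suc (N ℕ.+ N)) (λ k k<2N+1 → ≈⇒≈[] (solve 3 (λ x y z → x :* (y :* z) := y :* x :* z) refl _ _ _)
               ⊙ limit k k<2N+1)
          where
          N = suc L

          limit-at : ∀ c {i j d r} → biterm a b N i ≈ term c r → i ℕ.+ j ≡ N ℕ.+ N → r ℕ.+ d ≡ N → d ≤ i → d ≤ j →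
            gauss (N ℕ.+ N) i * qInf * biterm a b N i ≈[ L ] biterm a b N i
          limit-at c eq i+j≡2N r+d≡N d≤i d≤j =
            ≈⇒≈[] (*-congˡ eq) ⊙ gauss-term-limit c i+j≡2N r+d≡N d≤i d≤j ⊙ ≈⇒≈[] (sym eq)

          limit : ∀ k → k < suc (N ℕ.+ N) → gauss (N ℕ.+ N) k * qInf * biterm a b N k ≈[ L ] biterm a b N k
          -- Let r be the distance of k from the centre N. The term has order at least r - 1, and
          -- the Gaussian binomial agrees with its limit to order N - r, the smaller of k and 2N -
          -- k; together this is L.
          limit k k<2N+1 with ℕₚ.≤-total k N
          ... | inj₁ k≤N = limit-at b {j = N ℕ.+ r}
                  (≡.subst (λ n → biterm a b n k ≈ term b r) k+r≡N (biterm-left a b k r))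
                  (≡.trans (≡.cong (k ℕ.+_) (ℕₚ.+-comm N r)) (≡.trans (≡.sym (ℕₚ.+-assoc k r N)) (≡.cong (ℕ._+ N) k+r≡N)))
                  (ℕₚ.m∸n+n≡m k≤N) ℕₚ.≤-refl (ℕₚ.≤-trans k≤N (ℕₚ.m≤m+n N r))
            where
            r = N ℕ.∸ k
            k+r≡N : k ℕ.+ r ≡ N
            k+r≡N = ℕₚ.m+[n∸m]≡n k≤N
          ... | inj₂ N≤k = limit-at a {j = d}
                  (≡.subst (λ n → biterm a b N n ≈ term a r) N+r≡k (biterm-right a b N r))
                  (≡.trans (≡.cong (ℕ._+ d) (≡.sym N+r≡k)) (≡.trans (ℕₚ.+-assoc N r d) (≡.cong (N ℕ.+_) r+d≡N)))
                  r+d≡N (ℕₚ.≤-trans (ℕₚ.m∸n≤m N r) N≤k) ℕₚ.≤-refl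
            where
            r = k ℕ.∸ N
            d = N ℕ.∸ r
            N+r≡k : N ℕ.+ r ≡ k
            N+r≡k = ℕₚ.m+[n∸m]≡n N≤k
            r≤N : r ≤ N
            r≤N = ℕₚ.+-cancelˡ-≤ N r N (≡.subst (_≤ N ℕ.+ N) (≡.sym N+r≡k) (s≤s⁻¹ k<2N+1))
            r+d≡N : r ℕ.+ d ≡ N
            r+d≡N = ℕₚ.m+[n∸m]≡n r≤N

  open JacobiTripleProduct

  -- Splitting a theta series by its index modulo 3

  module ThetaDissection (Q : Series) where

    open QBinomial
    private
      Q⁹ = Q ^ 9

    cube-power : ∀ m → Q⁹ ^ m ≈ Q ^ (m ℕ.* 3) * Q ^ (m ℕ.* 3) * Q ^ (m ℕ.* 3)
    cube-power zero    = solve 0 (con (+ 1) := con (+ 1) :* con (+ 1) :* con (+ 1)) refl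
    cube-power (suc m) = trans (*-congˡ (cube-power m))
      (solve 2 (λ q z → q :^ 9 :* (z :* z :* z) := q :* (q :* (q :* z)) :* (q :* (q :* (q :* z))) :* (q :* (q :* (q :* z)))) refl _ _)

    -- The exponent 3m(3m-1)/2 of Q equals 3m + 9 m(m-1)/2, so every third term is again a theta
    -- term, now with base Q⁹. The other two classes behave alike.
    term-3m : ∀ c m → term Q c (m ℕ.* 3) ≈ term Q⁹ (c ^ 3 * Q ^ 3) m
    term-3m c zero    = refl
    term-3m c (suc m) = begin
      term Q c (m ℕ.* 3) * (c * z) * (c * (Q * z)) * (c * (Q * (Q * z)))
        ≈⟨ solve 4 (λ c q z t → t :* (c :* z) :* (c :* (q :* z)) :* (c :* (q :* (q :* z))) := t :* (c :^ 3 :* q :^ 3 :* (z :* z :* z))) refl _ _ _ _ ⟩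
      term Q c (m ℕ.* 3) * (c ^ 3 * Q ^ 3 * (z * z * z))
        ≈⟨ *-cong (term-3m c m) (*-congˡ (sym (cube-power m))) ⟩
      term Q⁹ (c ^ 3 * Q ^ 3) (suc m) ∎
      where z = Q ^ (m ℕ.* 3)

    term-3m+1 : ∀ c m → term Q c (1 ℕ.+ m ℕ.* 3) ≈ c * term Q⁹ (c ^ 3 * Q ^ 6) m
    term-3m+1 c zero    = solve 1 (λ c → con (+ 1) :* (c :* con (+ 1)) := c :* con (+ 1)) refl c
    term-3m+1 c (suc m) = begin
      term Q c (1 ℕ.+ m ℕ.* 3) * (c * (Q * z)) * (c * (Q * (Q * z))) * (c * (Q * (Q * (Q * z))))
        ≈⟨ solve 4 (λ c q z t → t :* (c :* (q :* z)) :* (c :* (q :* (q :* z))) :* (c :* (q :* (q :* (q :* z)))) := t :* (c :^ 3 :* q :^ 6 :* (z :* z :* z))) refl _ _ _ _ ⟩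
      term Q c (1 ℕ.+ m ℕ.* 3) * (c ^ 3 * Q ^ 6 * (z * z * z))
        ≈⟨ *-cong (term-3m+1 c m) (*-congˡ (sym (cube-power m))) ⟩
      c * term Q⁹ (c ^ 3 * Q ^ 6) m * (c ^ 3 * Q ^ 6 * Q⁹ ^ m)
        ≈⟨ *-assoc _ _ _ ⟩
      c * term Q⁹ (c ^ 3 * Q ^ 6) (suc m) ∎
      where z = Q ^ (m ℕ.* 3)

    -- Reading 3m + 2 as 3(m + 1) - 1 explains the shifted index on the right and the prefactor `d`,
    -- which is Q / c.
    term-3m+2 : ∀ c d → c * d ≈ Q → ∀ m → term Q c (2 ℕ.+ m ℕ.* 3) ≈ d * term Q⁹ (c ^ 3) (suc m)
    term-3m+2 c d cd≈Q zero    = begin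
      1# * (c * 1#) * (c * (Q * 1#))          ≈⟨ *-congˡ (*-congˡ (*-congʳ (sym cd≈Q))) ⟩
      1# * (c * 1#) * (c * (c * d * 1#))      ≈⟨ solve 2 (λ c d → con (+ 1) :* (c :* con (+ 1)) :* (c :* (c :* d :* con (+ 1))) := d :* (con (+ 1) :* (c :^ 3 :* con (+ 1)))) refl c d ⟩
      d * (1# * (c ^ 3 * 1#))                 ∎
    term-3m+2 c d cd≈Q (suc m) = begin
      term Q c (2 ℕ.+ m ℕ.* 3) * (c * (Q * (Q * z))) * (c * (Q * (Q * (Q * z)))) * (c * (Q * (Q * (Q * (Q * z)))))
        ≈⟨ solve 4 (λ c q z t → t :* (c :* (q :* (q :* z))) :* (c :* (q :* (q :* (q :* z)))) :* (c :* (q :* (q :* (q :* (q :* z))))) := t :* (c :^ 3 :* (q :^ 9 :* (z :* z :* z)))) refl _ _ _ _ ⟩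
      term Q c (2 ℕ.+ m ℕ.* 3) * (c ^ 3 * (Q⁹ * (z * z * z)))
        ≈⟨ *-cong (term-3m+2 c d cd≈Q m) (*-congˡ (*-congˡ (sym (cube-power m)))) ⟩
      d * term Q⁹ (c ^ 3) (suc m) * (c ^ 3 * Q⁹ ^ suc m)
        ≈⟨ *-assoc _ _ _ ⟩
      d * term Q⁹ (c ^ 3) (suc (suc m)) ∎
      where z = Q ^ (m ℕ.* 3)

    module _ (a b : Series) (ab≈Q : a * b ≈ Q) where

      -- The window is centred at position 3M + 1, so the positions 1 + 3k, 2 + 3k and 3k carry the
      -- indices 3(k - M), 3(k - M) + 1 and 3(k - M) - 1.
      biterm-3m : ∀ M k → biterm Q a b (suc (M ℕ.* 3)) (1 ℕ.+ k ℕ.* 3) ≈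
        biterm Q⁹ (a ^ 3 * Q ^ 3) (b ^ 3 * Q ^ 3) M k
      biterm-3m zero    k       = term-3m a k
      biterm-3m (suc M) zero    = term-3m b (suc M)
      biterm-3m (suc M) (suc k) = biterm-3m M k

      biterm-3m+1 : ∀ M k → biterm Q a b (suc (M ℕ.* 3)) (2 ℕ.+ k ℕ.* 3) ≈
        a * biterm Q⁹ (a ^ 3 * Q ^ 6) (b ^ 3) M k
      biterm-3m+1 zero    k       = term-3m+1 a k
      biterm-3m+1 (suc M) zero    = term-3m+2 b a (trans (*-comm b a) ab≈Q) M
      biterm-3m+1 (suc M) (suc k) = biterm-3m+1 M k

      biterm-3m-1 : ∀ M k → biterm Q a b (suc (M ℕ.* 3)) (k ℕ.* 3) ≈
        b * biterm Q⁹ (a ^ 3) (b ^ 3 * Q ^ 6) M k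
      biterm-3m-1 M       zero    = trans (term-3m+1 b M) (*-congˡ (sym (biterm-0 Q⁹ _ _ M)))
      biterm-3m-1 zero    (suc k) = term-3m+2 a b ab≈Q k
      biterm-3m-1 (suc M) (suc k) = biterm-3m-1 M k

      theta-3-dissection : Q ≈[ 1 ] 0# → theta Q a b ≈
        theta Q⁹ (a ^ 3 * Q ^ 3) (b ^ 3 * Q ^ 3)
          + a * theta Q⁹ (a ^ 3 * Q ^ 6) (b ^ 3)
          + b * theta Q⁹ (a ^ 3) (b ^ 3 * Q ^ 6)
      theta-3-dissection Q-order = ≈[]⇒≈ λ L → let M = suc L; n = suc (M ℕ.+ M) in
        ≈[]-weaken (ℕₚ.≤-trans (ℕₚ.n≤1+n L) (n≤n*[1+d] M 2)) (jacobi Q Q-order a b ab≈Q (M ℕ.* 3))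
        -- The window has 2(3M + 1) + 1 = 3(2M + 1) positions and therefore splits evenly into
        -- triples.
        ⊙ ≈⇒≈[] (reflexive (≡.cong (sumBelow _) (length M)))
        ⊙ ≈⇒≈[] (sum-3 _ n)
        ⊙ ≈⇒≈[] (sum-cong (λ k → +-cong (+-cong (biterm-3m-1 M k) (biterm-3m M k)) (biterm-3m+1 M k)) n)
        ⊙ ≈⇒≈[] (sum-cong (λ k → solve 3 (λ x y z → x :+ y :+ z := y :+ z :+ x) refl _ _ _) n)
        ⊙ ≈⇒≈[] (trans (sum-+ _ _ n) (+-cong (trans (sum-+ _ _ n) (+-congˡ (sum-* a _ n))) (sum-* b _ n)))
        ⊙ ≈[]-sym (+-cong[] (+-cong[] (jac (solve 3 (λ a b q → a :^ 3 :* q :^ 3 :* (b :^ 3 :* q :^ 3) := (a :* b) :^ 3 :* q :^ 6) refl a b Q) L)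
                    (*-cong[] (≈⇒≈[] refl) (jac (solve 3 (λ a b q → a :^ 3 :* q :^ 6 :* b :^ 3 := (a :* b) :^ 3 :* q :^ 6) refl a b Q) L)))
                    (*-cong[] (≈⇒≈[] refl) (jac (solve 3 (λ a b q → a :^ 3 :* (b :^ 3 :* q :^ 6) := (a :* b) :^ 3 :* q :^ 6) refl a b Q) L)))
        where
        length : ∀ M → suc (suc (M ℕ.* 3) ℕ.+ suc (M ℕ.* 3)) ≡ suc (M ℕ.+ M) ℕ.* 3
        length M = ≡.cong (λ n → suc (suc n))
          (≡.trans (ℕₚ.+-suc (M ℕ.* 3) (M ℕ.* 3)) (≡.cong suc (≡.sym (ℕₚ.*-distribʳ-+ 3 M M))))

        Q⁹-order : Q⁹ ≈[ 1 ] 0#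
        Q⁹-order = ≈[]-weaken (s≤s z≤n) (^-order Q-order 9)

        jac : ∀ {c d} → c * d ≈ (a * b) ^ 3 * Q ^ 6 → ∀ L →
          theta Q⁹ c d ≈[ L ] sumBelow (biterm Q⁹ c d (suc L)) (suc (suc L ℕ.+ suc L))
        jac cd = jacobi Q⁹ Q⁹-order _ _ (trans cd (trans (*-congʳ (^-congˡ 3 ab≈Q)) (sym (^-homo-* Q 3 6))))

  -- Theta series as eta products

  module EtaProducts where

    pochhammer : Series → Series → Series
    pochhammer a Q = infProd (λ k → 1# - a * Q ^ k)

    e : Series → Series
    e t = pochhammer t t

    private variable
      a a′ a″ b Q Q′ t : Series

    pochhammer-cong : a ≈ a′ → Q ≈ Q′ → pochhammer a Q ≈ pochhammer a′ Q′
    pochhammer-cong p r = infProd-cong λ k → +-congˡ (-‿cong (*-cong p (^-congˡ k r)))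

    theta-cong : ∀ {a a′ b b′} → Q ≈ Q′ → a ≈ a′ → b ≈ b′ → QBinomial.theta Q a b ≈ QBinomial.theta Q′ a′ b′
    theta-cong p r s = *-cong (*-cong
      (infProd-cong λ k → +-congˡ (-‿cong (*-cong p (^-congˡ k p))))
      (infProd-cong λ k → +-congˡ (*-cong r (^-congˡ k p))))
      (infProd-cong λ k → +-congˡ (*-cong s (^-congˡ k p)))

    pochhammer-tame : Q ≈[ 1 ] 0# → Tame (λ k → 1# - a * Q ^ k)
    pochhammer-tame {Q} {a} o k = 1+order
      (-‿cong[] (*-cong[] (≈⇒≈[] {a} refl) (^-order o k)) ⊙ ≈⇒≈[] (solve 1 (λ a → :- (a :* con (+ 0)) := con (+ 0)) refl a))

    module _ {Q : Series} (o : Q ≈[ 1 ] 0#) where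

      pochhammer-2 : a′ ≈ a * Q → Q′ ≈ Q ^ 2 → pochhammer a Q ≈ pochhammer a Q′ * pochhammer a′ Q′
      pochhammer-2 {a′} {a} {Q′} p r = trans (infProd-2 (pochhammer-tame {a = a} o))
        (*-cong (infProd-cong λ k → +-congˡ (-‿cong (*-congˡ (power k))))
                (infProd-cong λ k → +-congˡ (-‿cong (shifted k))))
        where
        power : ∀ k → Q ^ (k ℕ.* 2) ≈ Q′ ^ k
        power zero    = refl
        power (suc k) = trans (sym (*-assoc Q Q _)) (*-cong (trans (solve 1 (λ q → q :* q := q :^ 2) refl Q) (sym r)) (power k))
        shifted : ∀ k → a * (Q * Q ^ (k ℕ.* 2)) ≈ a′ * Q′ ^ k
        shifted k = trans (sym (*-assoc a Q _)) (*-cong (sym p) (power k))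

      pochhammer-3 : a′ ≈ a * Q → a″ ≈ a * Q ^ 2 → Q′ ≈ Q ^ 3 →
        pochhammer a Q ≈ pochhammer a Q′ * pochhammer a′ Q′ * pochhammer a″ Q′
      pochhammer-3 {a′} {a} {a″} {Q′} p p′ r = trans (infProd-3 (pochhammer-tame {a = a} o))
        (*-cong (*-cong
          (infProd-cong λ k → +-congˡ (-‿cong (*-congˡ (power k))))
          (infProd-cong λ k → +-congˡ (-‿cong (trans (sym (*-assoc a Q _)) (*-cong (sym p) (power k))))))
          (infProd-cong λ k → +-congˡ (-‿cong (trans (solve 3 (λ a q x → a :* (q :* (q :* x)) := a :* q :^ 2 :* x) refl _ _ _) (*-cong (sym p′) (power k))))))
        where
        power : ∀ k → Q ^ (k ℕ.* 3) ≈ Q′ ^ k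
        power zero    = refl
        power (suc k) = trans (solve 2 (λ q x → q :* (q :* (q :* x)) := q :^ 3 :* x) refl Q _) (*-cong (sym r) (power k))

      pochhammer-± : b ≈ - a → a′ ≈ a ^ 2 → Q′ ≈ Q ^ 2 → pochhammer b Q * pochhammer a Q ≈ pochhammer a′ Q′
      pochhammer-± {b} {a} {a′} {Q′} p r s = trans
        (sym (infProd-* (pochhammer-tame {a = b} o) (pochhammer-tame {a = a} o)))
        (infProd-cong λ k → trans (*-congʳ (+-congˡ (-‿cong (*-congʳ p))))
          (trans (solve 2 (λ a x → (con (+ 1) :- (:- a) :* x) :* (con (+ 1) :- a :* x) := con (+ 1) :- a :^ 2 :* (x :* x)) refl _ _)
            (+-congˡ (-‿cong (*-cong (sym r) (power k))))))
        where
        power : ∀ k → Q ^ k * Q ^ k ≈ Q′ ^ k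
        power zero    = *-identityˡ 1#
        power (suc k) = trans (solve 2 (λ q x → q :* x :* (q :* x) := q :^ 2 :* (x :* x)) refl Q _) (*-cong (sym s) (power k))

      pochhammer-shift : pochhammer a Q ≈ (1# - a) * pochhammer (a * Q) Q
      pochhammer-shift {a} = ≈[]⇒≈ λ K →
        ≈[]-weaken (ℕₚ.n≤1+n K) (infProd≈[] (pochhammer-tame {a = a} o) (suc K))
        ⊙ ≈⇒≈[] (trans (prod-shift _ K) (*-cong (+-congˡ (-‿cong (*-identityʳ a))) (prod-cong (λ k → +-congˡ (-‿cong (sym (*-assoc a Q _)))) K)))
        ⊙ ≈[]-sym (*-cong[] (≈⇒≈[] {1# - a} refl) (infProd≈[] (pochhammer-tame {a = a * Q} o) K))

    theta-pochhammer : ∀ {a b a′ b′} → a ≈ - a′ → b ≈ - b′ →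
      QBinomial.theta Q a b ≈ e Q * pochhammer a′ Q * pochhammer b′ Q
    theta-pochhammer {Q} p r = *-cong (*-congˡ (infProd-cong λ k → +-congˡ (neg p k))) (infProd-cong λ k → +-congˡ (neg r k))
      where
      neg : ∀ {a a′} → a ≈ - a′ → ∀ k → a * Q ^ k ≈ - (a′ * Q ^ k)
      neg p k = trans (*-congʳ p) (solve 2 (λ a x → (:- a) :* x := :- (a :* x)) refl _ _)

    module _ {t : Series} (o : t ≈[ 1 ] 0#) where

      private
        power-order : ∀ n → t ^ suc n ≈[ 1 ] 0#
        power-order n = ≈[]-weaken (s≤s z≤n) (^-order o (suc n))

        odd-part : e t ≈ pochhammer t (t ^ 2) * e (t ^ 2)
        odd-part = pochhammer-2 o (solve 1 (λ t → t :^ 2 := t :* t) refl t) refl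

      -- The theta series is φ(-t). Here and in the next products denominators are multiplied out,
      -- so that inverses of series enter only later.
      φ-product : QBinomial.theta (t ^ 2) (- t) (- t) * e (t ^ 2) ≈ e t * e t
      φ-product = begin
        QBinomial.theta (t ^ 2) (- t) (- t) * e (t ^ 2)   ≈⟨ *-congʳ (theta-pochhammer refl refl) ⟩
        e (t ^ 2) * p * p * e (t ^ 2)                     ≈⟨ solve 2 (λ e p → e :* p :* p :* e := p :* e :* (p :* e)) refl _ _ ⟩
        p * e (t ^ 2) * (p * e (t ^ 2))                   ≈⟨ *-cong odd-part odd-part ⟨
        e t * e t                                         ∎
        where p = pochhammer t (t ^ 2)

      -- The odd exponents split into the classes 1, 3 and 5 modulo 6. The theta series supplies 1
      -- and 5, and e(t³) supplies 3.
      ω-product : QBinomial.theta (t ^ 6) (- t) (- (t ^ 5)) * (e (t ^ 2) * e (t ^ 3)) ≈ e t * e (t ^ 6) * e (t ^ 6)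
      ω-product = begin
        QBinomial.theta (t ^ 6) (- t) (- (t ^ 5)) * (e (t ^ 2) * e (t ^ 3))  ≈⟨ *-cong (theta-pochhammer refl refl) (*-congˡ e₃) ⟩
        e₆ * p₁ * p₅ * (e (t ^ 2) * (p₃ * e₆))                  ≈⟨ solve 5 (λ e6 e2 p1 p3 p5 → e6 :* p1 :* p5 :* (e2 :* (p3 :* e6)) := p1 :* p3 :* p5 :* e2 :* e6 :* e6) refl _ _ _ _ _ ⟩
        p₁ * p₃ * p₅ * e (t ^ 2) * e₆ * e₆                      ≈⟨ *-congʳ (*-congʳ (*-congʳ thirds)) ⟨
        pochhammer t (t ^ 2) * e (t ^ 2) * e₆ * e₆              ≈⟨ *-congʳ (*-congʳ odd-part) ⟨
        e t * e₆ * e₆                                           ∎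
        where
        e₆ = e (t ^ 6)
        p₁ = pochhammer t (t ^ 6)
        p₃ = pochhammer (t ^ 3) (t ^ 6)
        p₅ = pochhammer (t ^ 5) (t ^ 6)
        thirds : pochhammer t (t ^ 2) ≈ p₁ * p₃ * p₅
        thirds = pochhammer-3 (power-order 1) (solve 1 (λ t → t :^ 3 := t :* t :^ 2) refl t)
          (solve 1 (λ t → t :^ 5 := t :* (t :^ 2) :^ 2) refl t) (solve 1 (λ t → t :^ 6 := (t :^ 2) :^ 3) refl t)
        e₃ : e (t ^ 3) ≈ p₃ * e₆
        e₃ = pochhammer-2 (power-order 2) (solve 1 (λ t → t :^ 6 := t :^ 3 :* t :^ 3) refl t) (solve 1 (λ t → t :^ 6 := (t :^ 3) :^ 2) refl t)

      private
        plus : pochhammer (- t) t * e t ≈ e (t ^ 2)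
        plus = pochhammer-± o refl refl refl

      -- The theta series supplies the factors 1 + t^n with n prime to 3. Those with 3 dividing n
      -- come from e(t⁶) = (-t³;t³)_∞ e(t³), and the complete product is again a quotient of eta
      -- products.
      a-product : QBinomial.theta (t ^ 3) t (t ^ 2) * (e t * e (t ^ 6)) ≈ e (t ^ 3) * e (t ^ 3) * e (t ^ 2)
      a-product = begin
        QBinomial.theta (t ^ 3) t (t ^ 2) * (e t * e (t ^ 6))     ≈⟨ *-cong (theta-pochhammer (neg² t) (neg² (t ^ 2))) (*-congˡ (sym e₆)) ⟩
        e₃ * m₁ * m₂ * (e t * (m₃ * e₃))            ≈⟨ solve 5 (λ e3 m1 m2 m3 e1 → e3 :* m1 :* m2 :* (e1 :* (m3 :* e3)) := e3 :* e3 :* (m1 :* m2 :* m3 :* e1)) refl _ _ _ _ _ ⟩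
        e₃ * e₃ * (m₁ * m₂ * m₃ * e t)              ≈⟨ *-congˡ (*-congʳ thirds) ⟨
        e₃ * e₃ * (pochhammer (- t) t * e t)        ≈⟨ *-congˡ plus ⟩
        e₃ * e₃ * e (t ^ 2)                         ∎
        where
        neg² : ∀ a → a ≈ - - a
        neg² = solve 1 (λ a → a := :- :- a) refl
        e₃ = e (t ^ 3)
        m₁ = pochhammer (- t) (t ^ 3)
        m₂ = pochhammer (- (t ^ 2)) (t ^ 3)
        m₃ = pochhammer (- (t ^ 3)) (t ^ 3)
        thirds : pochhammer (- t) t ≈ m₁ * m₂ * m₃
        thirds = pochhammer-3 o (solve 1 (λ t → :- (t :^ 2) := :- t :* t) refl t) (solve 1 (λ t → :- (t :^ 3) := :- t :* t :^ 2) refl t) refl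
        e₆ : m₃ * e₃ ≈ e (t ^ 6)
        e₆ = pochhammer-± (power-order 2) refl (solve 1 (λ t → t :^ 6 := (t :^ 3) :^ 2) refl t) (solve 1 (λ t → t :^ 6 := (t :^ 3) :^ 2) refl t)

      -- f(1, t) is 2ψ(t): the 2 is the leading factor 1 - (-1) of (-1;t)_∞.
      ψ-product : QBinomial.theta t 1# t * e t ≈ ι (+ 2) * (e (t ^ 2) * e (t ^ 2))
      ψ-product = begin
        QBinomial.theta t 1# t * e t                          ≈⟨ *-congʳ (theta-pochhammer (solve 0 (con (+ 1) := :- :- con (+ 1)) refl) (solve 1 (λ a → a := :- :- a) refl t)) ⟩
        e t * pochhammer (- 1#) t * m * e t                   ≈⟨ *-congʳ (*-congʳ (*-congˡ (trans (pochhammer-shift o) (*-congˡ (pochhammer-cong (solve 1 (λ t → :- con (+ 1) :* t := :- t) refl t) refl))))) ⟩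
        e t * ((1# - - 1#) * m) * m * e t                     ≈⟨ solve 2 (λ e m → e :* ((con (+ 1) :- (:- con (+ 1))) :* m) :* m :* e := con (+ 2) :* (m :* e :* (m :* e))) refl _ _ ⟩
        ι (+ 2) * (m * e t * (m * e t))                       ≈⟨ *-congˡ (*-cong plus plus) ⟩
        ι (+ 2) * (e (t ^ 2) * e (t ^ 2))                     ∎
        where m = pochhammer (- t) t

  open EtaProducts

  -- Sections of a series in the residue classes modulo 3

  module Trisection where

    q : Series
    q zero          = + 0
    q (suc zero)    = + 1
    q (suc (suc _)) = + 0

    tail-q : ∀ n → tail q n ≡ one n
    tail-q zero    = ≡.refl
    tail-q (suc n) = ≡.refl

    0*x+y : ∀ x y → + 0 ℤ.* x ℤ.+ y ≡ y
    0*x+y x y = ≡.trans (≡.cong (ℤ._+ y) (ℤₚ.*-zeroˡ x)) (ℤₚ.+-identityˡ y)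

    q*-suc : ∀ f n → (q * f) (suc n) ≡ f n
    q*-suc f n = ≡.trans (⊛-suc q f n) (≡.trans (0*x+y (f (suc n)) _)
      (≡.trans (⊛-cong {g = f} tail-q (λ _ → ≡.refl) n) (⊛-identityˡ f n)))

    q-order : q ≈[ 1 ] 0#
    q-order = below λ { zero _ → ≡.refl ; (suc n) (s≤s ()) }

    -- f(q) ↦ f(q³)
    expand : Series → Series
    expand f zero                = f 0
    expand f (suc zero)          = + 0
    expand f (suc (suc zero))    = + 0
    expand f (suc (suc (suc n))) = expand (tail f) n

    section : ℕ → Series → Series
    section r f n = f (n ℕ.* 3 ℕ.+ r)

    section-cong : ∀ r {f h} → f ≈ h → section r f ≈ section r h
    section-cong r p = coeffwise λ n → at p (n ℕ.* 3 ℕ.+ r)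

    section-+ : ∀ r f h → section r (f + h) ≈ section r f + section r h
    section-+ r f h = coeffwise λ n →
      ≡.trans (⊕-at f h (n ℕ.* 3 ℕ.+ r)) (≡.sym (⊕-at (section r f) (section r h) n))

    section-‿ : ∀ r f → section r (- f) ≈ - section r f
    section-‿ r f = coeffwise λ n →
      ≡.trans (⊝-at f (n ℕ.* 3 ℕ.+ r)) (≡.sym (⊝-at (section r f) n))

    section-ext : ∀ {f h} → section 0 f ≈ section 0 h → section 1 f ≈ section 1 h → section 2 f ≈ section 2 h → f ≈ h
    section-ext p₀ p₁ p₂ = coeffwise (go (at p₀) (at p₁) (at p₂))
      where
      go : ∀ {f h} → (∀ n → section 0 f n ≡ section 0 h n) → (∀ n → section 1 f n ≡ section 1 h n) →
        (∀ n → section 2 f n ≡ section 2 h n) → ∀ n → f n ≡ h n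
      go p₀ p₁ p₂ zero                = p₀ 0
      go p₀ p₁ p₂ (suc zero)          = p₁ 0
      go p₀ p₁ p₂ (suc (suc zero))    = p₂ 0
      go {f} {h} p₀ p₁ p₂ (suc (suc (suc n))) =
        go {λ m → f (3 ℕ.+ m)} {λ m → h (3 ℕ.+ m)} (λ m → p₀ (suc m)) (λ m → p₁ (suc m)) (λ m → p₂ (suc m)) n

    private
      expand-*-step : ∀ f h n → (expand f * h) (3 ℕ.+ n) ≡ f 0 ℤ.* h (3 ℕ.+ n) ℤ.+ (expand (tail f) * h) n
      expand-*-step f h n = ≡.trans (⊛-suc (expand f) h (2 ℕ.+ n)) (≡.cong (λ x → f 0 ℤ.* h (3 ℕ.+ n) ℤ.+ x)
        (≡.trans (⊛-suc (tail (expand f)) h (suc n)) (≡.trans (0*x+y (h (2 ℕ.+ n)) _)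
          (≡.trans (⊛-suc (tail (tail (expand f))) h n) (0*x+y (h (suc n)) _)))))

      expand-*-from : ∀ r → (∀ f h → (expand f * h) r ≡ f 0 ℤ.* h r) →
        ∀ n f h → (expand f * h) (n ℕ.* 3 ℕ.+ r) ≡ (f * section r h) n
      expand-*-from r base zero    f h = base f h
      expand-*-from r base (suc n) f h = ≡.trans (expand-*-step f h (n ℕ.* 3 ℕ.+ r))
        (≡.trans (≡.cong (λ x → f 0 ℤ.* h (3 ℕ.+ (n ℕ.* 3 ℕ.+ r)) ℤ.+ x) (expand-*-from r base n (tail f) h))
          (≡.sym (⊛-suc f (section r h) n)))

    -- Sections are linear over ℤ[[q³]]. This is what turns an algebraic relation with coefficients
    -- in q³ into a recurrence between sections.
    section₀-* : ∀ f h → section 0 (expand f * h) ≈ f * section 0 h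
    section₀-* f h = coeffwise λ n → expand-*-from 0 (λ _ _ → ≡.refl) n f h

    section₁-* : ∀ f h → section 1 (expand f * h) ≈ f * section 1 h
    section₁-* f h = coeffwise λ n → expand-*-from 1 base n f h
      where
      base : ∀ f h → (expand f * h) 1 ≡ f 0 ℤ.* h 1
      base f h = 0*x+y (h 0) (f 0 ℤ.* h 1)

    section₂-* : ∀ f h → section 2 (expand f * h) ≈ f * section 2 h
    section₂-* f h = coeffwise λ n → expand-*-from 2 base n f h
      where
      base : ∀ f h → (expand f * h) 2 ≡ f 0 ℤ.* h 2
      base f h = ≡.trans (0*x+y (h 0) _) (0*x+y (h 1) (f 0 ℤ.* h 2))

    section₀-expand : ∀ f → section 0 (expand f) ≈ f
    section₀-expand f = coeffwise (go f)
      where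
      go : ∀ f n → expand f (n ℕ.* 3 ℕ.+ 0) ≡ f n
      go f zero    = ≡.refl
      go f (suc n) = go (tail f) n

    section₁-expand : ∀ f → section 1 (expand f) ≈ 0#
    section₁-expand f = coeffwise (go f)
      where
      go : ∀ f n → expand f (n ℕ.* 3 ℕ.+ 1) ≡ + 0
      go f zero    = ≡.refl
      go f (suc n) = go (tail f) n

    section₂-expand : ∀ f → section 2 (expand f) ≈ 0#
    section₂-expand f = coeffwise (go f)
      where
      go : ∀ f n → expand f (n ℕ.* 3 ℕ.+ 2) ≡ + 0
      go f zero    = ≡.refl
      go f (suc n) = go (tail f) n

    section₁-q : ∀ f → section 1 (q * f) ≈ section 0 f
    section₁-q f = coeffwise λ n →
      ≡.trans (≡.cong (q * f) (ℕₚ.+-suc (n ℕ.* 3) 0)) (q*-suc f (n ℕ.* 3 ℕ.+ 0))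

    section₂-q : ∀ f → section 2 (q * f) ≈ section 1 f
    section₂-q f = coeffwise λ n →
      ≡.trans (≡.cong (q * f) (ℕₚ.+-suc (n ℕ.* 3) 1)) (q*-suc f (n ℕ.* 3 ℕ.+ 1))

    section₀-q : ∀ f → section 0 (q * f) ≈ q * section 2 f
    section₀-q f = coeffwise λ where
      zero    → ≡.refl
      (suc n) → ≡.trans (q*-suc f (2 ℕ.+ (n ℕ.* 3 ℕ.+ 0)))
        (≡.trans (≡.cong f (≡.sym (≡.trans (ℕₚ.+-suc (n ℕ.* 3) 1) (≡.cong suc (ℕₚ.+-suc (n ℕ.* 3) 0)))))
          (≡.sym (q*-suc (section 2 f) n)))

    module _ (a b c : Series) where

      trisected : Series
      trisected = expand a + q * expand b + q * (q * expand c)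

      private
        section-sum : ∀ r → section r trisected ≈ section r (expand a) + section r (q * expand b) + section r (q * (q * expand c))
        section-sum r = trans (section-+ r _ _) (+-congʳ (section-+ r _ _))

      section₀-trisected : section 0 trisected ≈ a
      section₀-trisected = trans (section-sum 0) (trans
        (+-cong (+-cong (section₀-expand a) (trans (section₀-q _) (*-congˡ (section₂-expand b))))
          (trans (section₀-q _) (*-congˡ (trans (section₂-q _) (section₁-expand c)))))
        (solve 2 (λ a q → a :+ q :* con (+ 0) :+ q :* con (+ 0) := a) refl a q))

      section₁-trisected : section 1 trisected ≈ b
      section₁-trisected = trans (section-sum 1) (trans
        (+-cong (+-cong (section₁-expand a) (trans (section₁-q _) (section₀-expand b)))
          (trans (section₁-q _) (trans (section₀-q _) (*-congˡ (section₂-expand c)))))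
        (solve 2 (λ b q → con (+ 0) :+ b :+ q :* con (+ 0) := b) refl b q))

      section₂-trisected : section 2 trisected ≈ c
      section₂-trisected = trans (section-sum 2) (trans
        (+-cong (+-cong (section₂-expand a) (trans (section₂-q _) (section₁-expand b)))
          (trans (section₂-q _) (trans (section₁-q _) (section₀-expand c))))
        (solve 1 (λ c → con (+ 0) :+ con (+ 0) :+ c := c) refl c))

    trisect : ∀ f → f ≈ trisected (section 0 f) (section 1 f) (section 2 f)
    trisect f = section-ext (sym (section₀-trisected _ _ _)) (sym (section₁-trisected _ _ _)) (sym (section₂-trisected _ _ _))

    expand-unique : ∀ {f h} → section 0 h ≈ f → section 1 h ≈ 0# → section 2 h ≈ 0# → expand f ≈ h
    expand-unique p₀ p₁ p₂ = section-ext (trans (section₀-expand _) (sym p₀))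
      (trans (section₁-expand _) (sym p₁)) (trans (section₂-expand _) (sym p₂))

    expand-cong : ∀ {f h} → f ≈ h → expand f ≈ expand h
    expand-cong p = expand-unique (trans (section₀-expand _) (sym p)) (section₁-expand _) (section₂-expand _)

    expand-+ : ∀ f h → expand (f + h) ≈ expand f + expand h
    expand-+ f h = expand-unique
      (trans (section-+ 0 _ _) (+-cong (section₀-expand f) (section₀-expand h)))
      (trans (section-+ 1 _ _) (trans (+-cong (section₁-expand f) (section₁-expand h)) (+-identityˡ 0#)))
      (trans (section-+ 2 _ _) (trans (+-cong (section₂-expand f) (section₂-expand h)) (+-identityˡ 0#)))

    expand-‿ : ∀ f → expand (- f) ≈ - expand f
    expand-‿ f = expand-unique
      (trans (section-‿ 0 _) (-‿cong (section₀-expand f)))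
      (trans (section-‿ 1 _) (trans (-‿cong (section₁-expand f)) -0#≈0#))
      (trans (section-‿ 2 _) (trans (-‿cong (section₂-expand f)) -0#≈0#))
      where open import Algebra.Properties.Ring ring using (-0#≈0#)

    expand-* : ∀ f h → expand (f * h) ≈ expand f * expand h
    expand-* f h = expand-unique
      (trans (section₀-* f _) (*-congˡ (section₀-expand h)))
      (trans (section₁-* f _) (trans (*-congˡ (section₁-expand h)) (zeroʳ f)))
      (trans (section₂-* f _) (trans (*-congˡ (section₂-expand h)) (zeroʳ f)))

    expand-1 : expand 1# ≈ 1#
    expand-1 = expand-unique (coeffwise λ { zero → ≡.refl ; (suc n) → ≡.refl })
      (coeffwise λ n → ≡.cong one (ℕₚ.+-suc (n ℕ.* 3) 0)) (coeffwise λ n → ≡.cong one (ℕₚ.+-suc (n ℕ.* 3) 1))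

    expand-q : expand q ≈ q ^ 3
    expand-q = expand-unique
      (trans (section₀-q _) (trans (*-congˡ (trans (section₂-q _) (section₁-q₁))) (*-identityʳ q)))
      (trans (section₁-q _) (trans (section₀-q _) (trans (*-congˡ (trans (section₂-q _) section₁-1)) (zeroʳ q))))
      (trans (section₂-q _) (trans (section₁-q _) (trans (section₀-q _) (trans (*-congˡ section₂-1) (zeroʳ q)))))
      where
      section₁-1 : section 1 1# ≈ 0#
      section₁-1 = trans (section-cong 1 (sym expand-1)) (section₁-expand 1#)
      section₂-1 : section 2 1# ≈ 0#
      section₂-1 = trans (section-cong 2 (sym expand-1)) (section₂-expand 1#)
      section₁-q₁ : section 1 (q * 1#) ≈ 1#
      section₁-q₁ = trans (section₁-q _) (trans (section-cong 0 (sym expand-1)) (section₀-expand 1#))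

    expand-^ : ∀ f n → expand (f ^ n) ≈ expand f ^ n
    expand-^ f zero    = expand-1
    expand-^ f (suc n) = trans (expand-* f (f ^ n)) (*-congˡ (expand-^ f n))

  open Trisection

  -- The norm from ℤ[[q]] to ℤ[[q³]]

  module CubicNorm where

    private variable
      f h a b c y : Series
      F : ℕ → Series
      K : ℕ

    expand-cong[] : f ≈[ K ] h → expand f ≈[ K ] expand h
    expand-cong[] p = below (go p)
      where
      go : f ≈[ K ] h → ∀ n → n < K → expand f n ≡ expand h n
      go p zero                n<K = at< p 0 n<K
      go p (suc zero)          n<K = ≡.refl
      go p (suc (suc zero))    n<K = ≡.refl
      go {f} {suc K} {h} p (suc (suc (suc n))) (s≤s n<K) =
        go {tail f} {K} {tail h} (tail-cong[] p) n (ℕₚ.≤-trans (ℕₚ.m≤n+m (suc n) 2) n<K)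

    expand-prod : ∀ F N → expand (prodBelow F N) ≈ prodBelow (λ k → expand (F k)) N
    expand-prod F zero    = expand-1
    expand-prod F (suc N) = trans (expand-* _ _) (*-congʳ (expand-prod F N))

    expand-infProd : Tame F → expand (infProd F) ≈ infProd (λ k → expand (F k))
    expand-infProd {F} t = ≈[]⇒≈ λ K →
      expand-cong[] (infProd≈[] t K) ⊙ ≈⇒≈[] (expand-prod F K)
        ⊙ ≈[]-sym (infProd≈[] (λ k → expand-cong[] (t k) ⊙ ≈⇒≈[] expand-1) K)

    expand-pochhammer : ∀ {a Q} → Q ≈[ 1 ] 0# → expand (pochhammer a Q) ≈ pochhammer (expand a) (expand Q)
    expand-pochhammer {a} {Q} o = trans (expand-infProd (pochhammer-tame {a = a} o))
      (infProd-cong λ k → trans (expand-+ _ _) (+-cong expand-1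
        (trans (expand-‿ _) (-‿cong (trans (expand-* a _) (*-congˡ (expand-^ Q k)))))))

    expand-e : ∀ n → expand (e (q ^ suc n)) ≈ e ((q ^ 3) ^ suc n)
    expand-e n = trans (expand-pochhammer (≈[]-weaken (s≤s z≤n) (^-order q-order (suc n)))) (pochhammer-cong eq eq)
      where
      eq : expand (q ^ suc n) ≈ (q ^ 3) ^ suc n
      eq = trans (expand-^ q (suc n)) (^-congˡ (suc n) expand-q)

    -- The determinant of multiplication by a + bq + cq² on the basis 1, q, q² over ℤ[[q³]], with q³
    -- renamed to q. In this form no cube root of unity has to be adjoined.
    normForm : Series → Series → Series → Series
    normForm a b c = a ^ 3 + q * b ^ 3 + q ^ 2 * c ^ 3 - ι (+ 3) * q * a * b * c

    -- f(q) f(ζq) f(ζ²q) for a primitive cube root of unity ζ, as a series in q³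
    norm : Series → Series
    norm f = normForm (section 0 f) (section 1 f) (section 2 f)

    normForm-cong : ∀ {a a′ b b′ c c′} → a ≈ a′ → b ≈ b′ → c ≈ c′ → normForm a b c ≈ normForm a′ b′ c′
    normForm-cong p r s = +-cong (+-cong (+-cong (^-congˡ 3 p) (*-congˡ (^-congˡ 3 r))) (*-congˡ (^-congˡ 3 s)))
      (-‿cong (*-cong (*-cong (*-congˡ p) r) s))

    norm-cong : f ≈ h → norm f ≈ norm h
    norm-cong p = normForm-cong (section-cong 0 p) (section-cong 1 p) (section-cong 2 p)

    norm-trisected : f ≈ trisected a b c → norm f ≈ normForm a b c
    norm-trisected p = trans (norm-cong p)
      (normForm-cong (section₀-trisected _ _ _) (section₁-trisected _ _ _) (section₂-trisected _ _ _))

    trisected-* : ∀ a b c a′ b′ c′ → trisected a b c * trisected a′ b′ c′ ≈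
      trisected (a * a′ + q * (b * c′ + c * b′)) (a * b′ + b * a′ + q * (c * c′)) (a * c′ + c * a′ + b * b′)
    trisected-* a b c a′ b′ c′ = begin
      trisected a b c * trisected a′ b′ c′
        ≈⟨ solve 7 (λ q a b c a′ b′ c′ →
             (a :+ q :* b :+ q :* (q :* c)) :* (a′ :+ q :* b′ :+ q :* (q :* c′)) :=
             (a :* a′ :+ q :^ 3 :* (b :* c′ :+ c :* b′)) :+ q :* (a :* b′ :+ b :* a′ :+ q :^ 3 :* (c :* c′))
               :+ q :* (q :* (a :* c′ :+ c :* a′ :+ b :* b′))) refl q A B C A′ B′ C′ ⟩
      (A * A′ + q ^ 3 * (B * C′ + C * B′)) + q * (A * B′ + B * A′ + q ^ 3 * (C * C′)) + q * (q * (A * C′ + C * A′ + B * B′))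
        ≈⟨ +-cong (+-cong (trans (expand-+ _ _) (+-cong (expand-* a a′) (trans (expand-* q _) (*-cong expand-q (sum₂ b c′ c b′)))))
             (*-congˡ (trans (expand-+ _ _) (+-cong (sum₂ a b′ b a′) (trans (expand-* q _) (*-cong expand-q (expand-* c c′)))))))
             (*-congˡ (*-congˡ (trans (expand-+ _ _) (+-cong (sum₂ a c′ c a′) (expand-* b b′))))) ⟨
      trisected (a * a′ + q * (b * c′ + c * b′)) (a * b′ + b * a′ + q * (c * c′)) (a * c′ + c * a′ + b * b′) ∎
      where
      A = expand a ; B = expand b ; C = expand c ; A′ = expand a′ ; B′ = expand b′ ; C′ = expand c′
      sum₂ : ∀ x y x′ y′ → expand (x * y + x′ * y′) ≈ expand x * expand y + expand x′ * expand y′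
      sum₂ x y x′ y′ = trans (expand-+ _ _) (+-cong (expand-* x y) (expand-* x′ y′))

    norm-* : ∀ f h → norm (f * h) ≈ norm f * norm h
    norm-* f h = trans (norm-trisected (trans (*-cong (trisect f) (trisect h)) (trisected-* _ _ _ _ _ _)))
      (solve 7 (λ q a b c a′ b′ c′ →
        let N = λ a b c → a :^ 3 :+ q :* b :^ 3 :+ q :^ 2 :* c :^ 3 :- con (+ 3) :* q :* a :* b :* c in
        N (a :* a′ :+ q :* (b :* c′ :+ c :* b′)) (a :* b′ :+ b :* a′ :+ q :* (c :* c′)) (a :* c′ :+ c :* a′ :+ b :* b′)
          := N a b c :* N a′ b′ c′) refl q _ _ _ _ _ _)

    expand-0 : expand 0# ≈ 0#
    expand-0 = expand-unique (coeffwise λ _ → ≡.refl) (coeffwise λ _ → ≡.refl) (coeffwise λ _ → ≡.refl)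

    norm-1 : norm 1# ≈ 1#
    norm-1 = trans (norm-trisected {a = 1#} {0#} {0#} (sym (trans (+-cong (+-cong expand-1 (*-congˡ expand-0)) (*-congˡ (*-congˡ expand-0)))
        (solve 1 (λ q → con (+ 1) :+ q :* con (+ 0) :+ q :* (q :* con (+ 0)) := con (+ 1)) refl q))))
      (solve 1 (λ q → con (+ 1) :^ 3 :+ q :* con (+ 0) :^ 3 :+ q :^ 2 :* con (+ 0) :^ 3 :- con (+ 3) :* q :* con (+ 1) :* con (+ 0) :* con (+ 0) := con (+ 1)) refl q)

    section-cong[] : ∀ r → r ≤ 2 → f ≈[ K ℕ.* 3 ] h → section r f ≈[ K ] section r h
    section-cong[] r r≤2 p = below λ n n<K → at< p (n ℕ.* 3 ℕ.+ r)
      (ℕₚ.≤-trans (s≤s (ℕₚ.≤-trans (ℕₚ.+-monoʳ-≤ (n ℕ.* 3) r≤2) (ℕₚ.≤-reflexive (ℕₚ.+-comm (n ℕ.* 3) 2)))) (ℕₚ.*-monoˡ-≤ 3 n<K))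

    ^-cong[] : ∀ n → f ≈[ K ] h → f ^ n ≈[ K ] h ^ n
    ^-cong[] zero    p = ≈⇒≈[] refl
    ^-cong[] (suc n) p = *-cong[] p (^-cong[] n p)

    norm-cong[] : f ≈[ K ℕ.* 3 ] h → norm f ≈[ K ] norm h
    norm-cong[] {f} {K} {h} p =
      +-cong[] (+-cong[] (+-cong[] (^-cong[] 3 p₀) (*-cong[] (≈⇒≈[] {q} refl) (^-cong[] 3 p₁))) (*-cong[] (≈⇒≈[] {q ^ 2} refl) (^-cong[] 3 p₂)))
        (-‿cong[] (*-cong[] (*-cong[] (*-cong[] (≈⇒≈[] {ι (+ 3) * q} refl) p₀) p₁) p₂))
      where
      p₀ = section-cong[] {f} {K} {h} 0 z≤n p
      p₁ = section-cong[] {f} {K} {h} 1 (s≤s z≤n) p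
      p₂ = section-cong[] {f} {K} {h} 2 (s≤s (s≤s z≤n)) p

    norm-prod : ∀ F N → norm (prodBelow F N) ≈ prodBelow (λ k → norm (F k)) N
    norm-prod F zero    = norm-1
    norm-prod F (suc N) = trans (norm-* _ _) (*-congʳ (norm-prod F N))

    norm-infProd : Tame F → Tame (λ k → norm (F k)) → norm (infProd F) ≈ infProd (λ k → norm (F k))
    norm-infProd {F} t t′ = ≈[]⇒≈ λ K →
      norm-cong[] (infProd≈[] t (K ℕ.* 3)) ⊙ ≈⇒≈[] (norm-prod F (K ℕ.* 3))
        ⊙ ≈[]-weaken (n≤n*[1+d] K 2) (≈[]-sym (infProd≈[] t′ (K ℕ.* 3)))

    -- The two equations for Q are those satisfied by a power R of q: then R(q³) and R³ coincide.
    module _ {Q R : Series} (o : Q ≈[ 1 ] 0#) (Q≈ER : Q ≈ expand R) (Q≈R³ : Q ≈ R ^ 3) where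

      private
        factor-power : ∀ {a u y} → a ≈ u * expand y → ∀ k → a * Q ^ k ≈ u * expand (y * R ^ k)
        factor-power {a} {u} {y} p k = begin
          a * Q ^ k                      ≈⟨ *-cong p (trans (^-congˡ k Q≈ER) (sym (expand-^ R k))) ⟩
          u * expand y * expand (R ^ k)  ≈⟨ *-assoc _ _ _ ⟩
          u * (expand y * expand (R ^ k)) ≈⟨ *-congˡ (expand-* y (R ^ k)) ⟨
          u * expand (y * R ^ k)         ∎

        cube-power : ∀ k → (R ^ k) ^ 3 ≈ Q ^ k
        cube-power k = trans (^-assocʳ R k 3) (trans (reflexive (≡.cong (R ^_) (ℕₚ.*-comm k 3)))
          (trans (sym (^-assocʳ R 3 k)) (^-congˡ k (sym Q≈R³))))

        value : ∀ {a u y} → a ≈ u * y ^ 3 → ∀ k → u * (y * R ^ k) ^ 3 ≈ a * Q ^ k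
        value {a} {u} {y} p k = trans (solve 3 (λ u y r → u :* (y :* r) :^ 3 := u :* y :^ 3 :* r :^ 3) refl _ _ _) (*-cong (sym p) (cube-power k))

        norm-factor₀ : ∀ {a} y → a ≈ expand y → norm (1# - a) ≈ (1# - y) ^ 3
        norm-factor₀ {a} y p = trans (norm-trisected {a = 1# - y} {0#} {0#}
            (trans (+-congˡ (-‿cong p)) (sym (trans (+-cong (+-cong (trans (expand-+ _ _) (+-cong expand-1 (expand-‿ y))) (*-congˡ expand-0)) (*-congˡ (*-congˡ expand-0)))
              (solve 2 (λ q y → con (+ 1) :- y :+ q :* con (+ 0) :+ q :* (q :* con (+ 0)) := con (+ 1) :- y) refl q _)))))
          (solve 2 (λ q a → a :^ 3 :+ q :* con (+ 0) :^ 3 :+ q :^ 2 :* con (+ 0) :^ 3 :- con (+ 3) :* q :* a :* con (+ 0) :* con (+ 0) := a :^ 3) refl q _)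

        norm-factor₁ : ∀ {a} y → a ≈ q * expand y → norm (1# - a) ≈ 1# - q * y ^ 3
        norm-factor₁ {a} y p = trans (norm-trisected {a = 1#} { - y} {0#}
            (trans (+-congˡ (-‿cong p)) (sym (trans (+-cong (+-cong expand-1 (*-congˡ (expand-‿ y))) (*-congˡ (*-congˡ expand-0)))
              (solve 2 (λ q y → con (+ 1) :+ q :* (:- y) :+ q :* (q :* con (+ 0)) := con (+ 1) :- q :* y) refl q _)))))
          (solve 2 (λ q y → con (+ 1) :^ 3 :+ q :* (:- y) :^ 3 :+ q :^ 2 :* con (+ 0) :^ 3 :- con (+ 3) :* q :* con (+ 1) :* (:- y) :* con (+ 0) := con (+ 1) :- q :* y :^ 3) refl q _)

        norm-factor₂ : ∀ {a} y → a ≈ q ^ 2 * expand y → norm (1# - a) ≈ 1# - q ^ 2 * y ^ 3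
        norm-factor₂ {a} y p = trans (norm-trisected {a = 1#} {0#} { - y}
            (trans (+-congˡ (-‿cong p)) (sym (trans (+-cong (+-cong expand-1 (*-congˡ expand-0)) (*-congˡ (*-congˡ (expand-‿ y))))
              (solve 2 (λ q y → con (+ 1) :+ q :* con (+ 0) :+ q :* (q :* (:- y)) := con (+ 1) :- q :^ 2 :* y) refl q _)))))
          (solve 2 (λ q y → con (+ 1) :^ 3 :+ q :* con (+ 0) :^ 3 :+ q :^ 2 :* (:- y) :^ 3 :- con (+ 3) :* q :* con (+ 1) :* con (+ 0) :* (:- y) := con (+ 1) :- q :^ 2 :* y :^ 3) refl q _)

        norm-fixed : ∀ {a} → (∀ k → norm (1# - a * Q ^ k) ≈ 1# - a * Q ^ k) → norm (pochhammer a Q) ≈ pochhammer a Q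
        norm-fixed {a} p = trans
          (norm-infProd (pochhammer-tame {a = a} o) (λ k → ≈⇒≈[] (p k) ⊙ pochhammer-tame {a = a} o k))
          (infProd-cong p)

      -- For n prime to 3 the conjugates of 1 - q^n multiply to 1 - q^(3n). Renaming q³ to q gives
      -- back the original factor.
      norm-pochhammer₁ : a ≈ q * expand y → a ≈ q * y ^ 3 → norm (pochhammer a Q) ≈ pochhammer a Q
      norm-pochhammer₁ {a} {y} p r = norm-fixed λ k →
        trans (norm-factor₁ (y * R ^ k) (factor-power p k)) (+-congˡ (-‿cong (value r k)))

      norm-pochhammer₂ : a ≈ q ^ 2 * expand y → a ≈ q ^ 2 * y ^ 3 → norm (pochhammer a Q) ≈ pochhammer a Q
      norm-pochhammer₂ {a} {y} p r = norm-fixed λ k →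
        trans (norm-factor₂ (y * R ^ k) (factor-power p k)) (+-congˡ (-‿cong (value r k)))

      -- When all exponents are divisible by 3 the three conjugates of a factor coincide, so the
      -- norm is a cube.
      norm-e : R ≈[ 1 ] 0# → norm (e Q) ≈ e R ^ 3
      norm-e o′ = trans (norm-infProd (pochhammer-tame {a = Q} o) (λ k → ≈⇒≈[] (factor k) ⊙ cube-tame k))
          (trans (infProd-cong factor) cubes)
        where
        P : ℕ → Series
        P k = 1# - R * R ^ k
        t : Tame P
        t = pochhammer-tame {a = R} o′
        factor : ∀ k → norm (1# - Q * Q ^ k) ≈ P k * (P k * P k)
        factor k = trans (norm-factor₀ (R * R ^ k) (trans (factor-power {u = 1#} (trans Q≈ER (sym (*-identityˡ _))) k) (*-identityˡ _)))
          (solve 1 (λ x → x :^ 3 := x :* (x :* x)) refl _)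
        cube-tame : Tame (λ k → P k * (P k * P k))
        cube-tame = *-tame t (*-tame t t)
        cubes : infProd (λ k → P k * (P k * P k)) ≈ e R ^ 3
        cubes = trans (infProd-* t (*-tame t t)) (trans (*-congˡ (infProd-* t t)) (solve 1 (λ x → x :* (x :* x) := x :^ 3) refl _))

    q^-order : ∀ n → q ^ suc n ≈[ 1 ] 0#
    q^-order n = ≈[]-weaken (s≤s z≤n) (^-order q-order (suc n))

    norm-e₁ : norm (e q) * e (q ^ 3) ≈ e q ^ 4
    norm-e₁ = begin
      norm (e q) * e (q ^ 3)                          ≈⟨ *-congʳ (trans (norm-cong thirds) (trans (norm-* _ _) (*-congʳ (norm-* _ _)))) ⟩
      norm p₁ * norm p₂ * norm (e (q ^ 3)) * e (q ^ 3)  ≈⟨ *-congʳ (*-cong (*-cong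
          (norm-pochhammer₁ o (sym expand-q) refl {y = 1#} (trans (sym (*-identityʳ q)) (*-congˡ (sym expand-1))) (solve 1 (λ q → q := q :* con (+ 1) :^ 3) refl q))
          (norm-pochhammer₂ o (sym expand-q) refl {y = 1#} (trans (sym (*-identityʳ _)) (*-congˡ (sym expand-1))) (solve 1 (λ q → q :^ 2 := q :^ 2 :* con (+ 1) :^ 3) refl q)))
          (norm-e o (sym expand-q) refl q-order)) ⟩
      p₁ * p₂ * e q ^ 3 * e (q ^ 3)                   ≈⟨ solve 4 (λ a b c d → a :* b :* c :* d := a :* b :* d :* c) refl _ _ _ _ ⟩
      p₁ * p₂ * e (q ^ 3) * e q ^ 3                   ≈⟨ *-congʳ thirds ⟨
      e q * e q ^ 3 ∎
      where
      o = q^-order 2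
      p₁ = pochhammer q (q ^ 3)
      p₂ = pochhammer (q ^ 2) (q ^ 3)
      thirds : e q ≈ p₁ * p₂ * e (q ^ 3)
      thirds = pochhammer-3 q-order (solve 1 (λ q → q :^ 2 := q :* q) refl q) refl refl

    norm-e₂ : norm (e (q ^ 2)) * e (q ^ 6) ≈ e (q ^ 2) ^ 4
    norm-e₂ = begin
      norm (e (q ^ 2)) * e (q ^ 6)                          ≈⟨ *-congʳ (trans (norm-cong thirds) (trans (norm-* _ _) (*-congʳ (norm-* _ _)))) ⟩
      norm p₂ * norm p₄ * norm (e (q ^ 6)) * e (q ^ 6)  ≈⟨ *-congʳ (*-cong (*-cong
          (norm-pochhammer₂ o E6 c6 {y = 1#} (trans (sym (*-identityʳ _)) (*-congˡ (sym expand-1))) (solve 1 (λ q → q :^ 2 := q :^ 2 :* con (+ 1) :^ 3) refl q))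
          (norm-pochhammer₁ o E6 c6 {y = q} (*-congˡ (sym expand-q)) refl))
          (norm-e o E6 c6 (q^-order 1))) ⟩
      p₂ * p₄ * e (q ^ 2) ^ 3 * e (q ^ 6)               ≈⟨ solve 4 (λ a b c d → a :* b :* c :* d := a :* b :* d :* c) refl _ _ _ _ ⟩
      p₂ * p₄ * e (q ^ 6) * e (q ^ 2) ^ 3               ≈⟨ *-congʳ thirds ⟨
      e (q ^ 2) * e (q ^ 2) ^ 3 ∎
      where
      o = q^-order 5
      E6 : q ^ 6 ≈ expand (q ^ 2)
      E6 = sym (trans (expand-^ q 2) (trans (^-congˡ 2 expand-q) (solve 1 (λ q → (q :^ 3) :^ 2 := q :^ 6) refl q)))
      c6 : q ^ 6 ≈ (q ^ 2) ^ 3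
      c6 = solve 1 (λ q → q :^ 6 := (q :^ 2) :^ 3) refl q
      p₂ = pochhammer (q ^ 2) (q ^ 6)
      p₄ = pochhammer (q ^ 4) (q ^ 6)
      thirds : e (q ^ 2) ≈ p₂ * p₄ * e (q ^ 6)
      thirds = pochhammer-3 (q^-order 1) (solve 1 (λ q → q :^ 4 := q :^ 2 :* q :^ 2) refl q)
        (solve 1 (λ q → q :^ 6 := q :^ 2 :* (q :^ 2) :^ 2) refl q) c6

  open CubicNorm

  -- Inverse series, and the 3-dissections of P and ψ

  module ThetaDissections where

    mutual
      -- The `conv` local to `invRev`. Abstracting its index and its list as variables in
      -- `invRev-unfold` lets unification recover it.
      convolve : Series → ℕ → ℕ → List ℤ → ℤ
      convolve = _

      invRev-unfold : ∀ f n → invRev f (suc n) ≡ (ℤ.- convolve f n 1 (invRev f n)) ∷ invRev f n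
      invRev-unfold f n with invRev f n | 1
      ... | _ | _ = ≡.refl

    -- The offset `i` grows while the list is consumed, so the induction needs `f` shifted by an
    -- arbitrary amount, which is `h`.
    convolve-invRev : ∀ f n i h m → (∀ j → h j ≡ f (i ℕ.+ j)) → convolve f n i (invRev f m) ≡ (h ⊛ inv f) m
    convolve-invRev f n i h zero    p = ≡.trans (ℤₚ.+-identityʳ _) (≡.cong (ℤ._* + 1) (≡.sym (≡.trans (p 0) (≡.cong f (ℕₚ.+-identityʳ i)))))
    convolve-invRev f n i h (suc m) p = ≡.trans
      (≡.cong₂ (λ x y → x ℤ.* inv f (suc m) ℤ.+ y) (≡.sym (≡.trans (p 0) (≡.cong f (ℕₚ.+-identityʳ i))))
        (convolve-invRev f n (suc i) (tail h) m λ j → ≡.trans (p (suc j)) (≡.cong f (ℕₚ.+-suc i j))))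
      (≡.sym (⊛-suc h (inv f) m))

    inv-inverse : ∀ f → f ≈[ 1 ] 1# → f * inv f ≈ 1#
    inv-inverse f p = coeffwise go
      where
      f₀ : f 0 ≡ + 1
      f₀ = at< p 0 (s≤s z≤n)
      go : ∀ n → (f * inv f) n ≡ one n
      go zero    = ≡.cong (ℤ._* + 1) f₀
      go (suc n) = ≡.trans (⊛-suc f (inv f) n) (≡.trans
        (≡.cong₂ ℤ._+_ (≡.trans (≡.cong (ℤ._* inv f (suc n)) f₀) (ℤₚ.*-identityˡ _)) (≡.sym (convolve-invRev f n 1 (tail f) n (λ _ → ≡.refl))))
        (ℤₚ.+-inverseˡ (convolve f n 1 (invRev f n))))

    module _ {t : Series} (o : t ≈[ 1 ] 0#) where

      e-unit : e t ≈[ 1 ] 1#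
      e-unit = infProd≈[] (pochhammer-tame {a = t} o) 1
        ⊙ *-cong[] (≈⇒≈[] {1#} refl) (1+order (-‿cong[] (*-cong[] o (≈⇒≈[] {1#} refl)) ⊙ ≈⇒≈[] (solve 0 (:- (con (+ 0) :* con (+ 1)) := con (+ 0)) refl)))
        ⊙ ≈⇒≈[] (*-identityˡ 1#)

      e-inverse : e t * inv (e t) ≈ 1#
      e-inverse = inv-inverse (e t) e-unit

    private
      q^-at : ∀ m n → (q ^ m) n ≡ (if n ℕ.≡ᵇ m then + 1 else + 0)
      q^-at zero    zero    = ≡.refl
      q^-at zero    (suc n) = ≡.refl
      q^-at (suc m) zero    = ≡.refl
      q^-at (suc m) (suc n) = ≡.trans (q*-suc (q ^ m) n) (q^-at m n)

      if-neg : ∀ b → (if b then ℤ.- (+ 1) else + 0) ≡ ℤ.- (if b then + 1 else + 0)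
      if-neg true  = ≡.refl
      if-neg false = ≡.refl

    oneMinusQ : ∀ m → oneMinusQ^suc m ≈ 1# - q ^ suc m
    oneMinusQ m = coeffwise λ n → ≡.sym (≡.trans (⊕-at 1# (- (q ^ suc m)) n)
      (≡.trans (≡.cong (λ x → one n ℤ.+ x) (≡.trans (⊝-at (q ^ suc m) n) (≡.cong ℤ.-_ (q^-at (suc m) n)))) (go n)))
      where
      go : ∀ n → one n ℤ.+ ℤ.- (if n ℕ.≡ᵇ suc m then + 1 else + 0) ≡ oneMinusQ^suc m n
      go zero    = ≡.refl
      go (suc n) = ≡.trans (ℤₚ.+-identityˡ _) (≡.sym (if-neg (n ℕ.≡ᵇ m)))

    qPoch≈e : ∀ d → qPoch (suc d) ≈ e (q ^ suc d)
    qPoch≈e d = infProd-cong λ k → trans (oneMinusQ _) (+-congˡ (-‿cong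
      (trans (reflexive (≡.cong (q ^_) (exponent k))) (trans (^-homo-* q (suc d) (suc d ℕ.* k)) (*-congˡ (sym (^-assocʳ q (suc d) k)))))))
      where
      exponent : ∀ k → suc (suc d ℕ.* k ℕ.+ suc d ℕ.∸ 1) ≡ suc d ℕ.+ suc d ℕ.* k
      exponent k = ≡.trans (≡.cong (λ n → suc (n ℕ.∸ 1)) (ℕₚ.+-suc (suc d ℕ.* k) d)) (≡.trans (≡.sym (ℕₚ.+-suc (suc d ℕ.* k) d)) (ℕₚ.+-comm (suc d ℕ.* k) (suc d)))

    e₁ e₂ e₃ e₆ e₉ e₁₈ i₁ i₂ i₃ i₆ i₉ i₁₈ : Series
    e₁  = e q
    e₂  = e (q ^ 2)
    e₃  = e (q ^ 3)
    e₆  = e (q ^ 6)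
    e₉  = e (q ^ 9)
    e₁₈ = e (q ^ 18)
    i₁  = inv e₁
    i₂  = inv e₂
    i₃  = inv e₃
    i₆  = inv e₆
    i₉  = inv e₉
    i₁₈ = inv e₁₈

    e₁i₁ : e₁ * i₁ ≈ 1#
    e₁i₁ = e-inverse q-order
    e₂i₂ : e₂ * i₂ ≈ 1#
    e₂i₂ = e-inverse (q^-order 1)
    e₃i₃ : e₃ * i₃ ≈ 1#
    e₃i₃ = e-inverse (q^-order 2)
    e₆i₆ : e₆ * i₆ ≈ 1#
    e₆i₆ = e-inverse (q^-order 5)
    e₉i₉ : e₉ * i₉ ≈ 1#
    e₉i₉ = e-inverse (q^-order 8)
    e₁₈i₁₈ : e₁₈ * i₁₈ ≈ 1#
    e₁₈i₁₈ = e-inverse (q^-order 17)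

    private
      e-cong : ∀ {a b} → a ≈ b → e a ≈ e b
      e-cong p = pochhammer-cong p p

      power³ : ∀ n → (q ^ 3) ^ n ≈ q ^ (3 ℕ.* n)
      power³ n = ^-assocʳ q 3 n

    expand-e₁ : expand e₁ ≈ e₃
    expand-e₁ = trans (expand-cong (e-cong (sym (*-identityʳ q)))) (trans (expand-e 0) (e-cong (power³ 1)))
    expand-e₂ : expand e₂ ≈ e₆
    expand-e₂ = trans (expand-e 1) (e-cong (power³ 2))
    expand-e₃ : expand e₃ ≈ e₉
    expand-e₃ = trans (expand-e 2) (e-cong (power³ 3))
    expand-e₆ : expand e₆ ≈ e₁₈
    expand-e₆ = trans (expand-e 5) (e-cong (power³ 6))

    inverse-unique : ∀ {x y z} → x * y ≈ 1# → x * z ≈ 1# → y ≈ z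
    inverse-unique {x} {y} {z} p r = begin
      y            ≈⟨ *-identityʳ y ⟨
      y * 1#       ≈⟨ *-congˡ r ⟨
      y * (x * z)  ≈⟨ solve 3 (λ x y z → y :* (x :* z) := x :* y :* z) refl x y z ⟩
      x * y * z    ≈⟨ *-congʳ p ⟩
      1# * z       ≈⟨ *-identityˡ z ⟩
      z            ∎

    expand-inverse : ∀ {x x′ y y′} → expand x ≈ x′ → x * y ≈ 1# → x′ * y′ ≈ 1# → expand y ≈ y′
    expand-inverse {x} {x′} {y} p r r′ = inverse-unique
      (trans (*-congʳ (sym p)) (trans (sym (expand-* x y)) (trans (expand-cong r) expand-1))) r′

    expand-i₁ : expand i₁ ≈ i₃
    expand-i₁ = expand-inverse expand-e₁ e₁i₁ e₃i₃
    expand-i₂ : expand i₂ ≈ i₆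
    expand-i₂ = expand-inverse expand-e₂ e₂i₂ e₆i₆
    expand-i₃ : expand i₃ ≈ i₉
    expand-i₃ = expand-inverse expand-e₃ e₃i₃ e₉i₉
    expand-i₆ : expand i₆ ≈ i₁₈
    expand-i₆ = expand-inverse expand-e₆ e₆i₆ e₁₈i₁₈

    unit-cancel : ∀ {x u i y} → u * i ≈ 1# → x * u ≈ y → x ≈ y * i
    unit-cancel {x} {u} {i} {y} p r = begin
      x            ≈⟨ *-identityʳ x ⟨
      x * 1#       ≈⟨ *-congˡ p ⟨
      x * (u * i)  ≈⟨ *-assoc x u i ⟨
      x * u * i    ≈⟨ *-congʳ r ⟩
      y * i        ∎

    unit-* : ∀ {u i v j} → u * i ≈ 1# → v * j ≈ 1# → (u * v) * (i * j) ≈ 1#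
    unit-* {u} {i} {v} {j} p r = trans (solve 4 (λ u i v j → u :* v :* (i :* j) := u :* i :* (v :* j)) refl u i v j)
      (trans (*-cong p r) (*-identityˡ 1#))

    -- φ(-q), its reciprocal, ψ(q), and the cubic continued fraction w with its reciprocal a
    P P⁻¹ ψ w a : Series
    P   = e₁ * e₁ * i₂
    P⁻¹ = e₂ * (i₁ * i₁)
    ψ   = e₂ * e₂ * i₁
    w   = e₁ * e₆ ^ 3 * (i₂ * i₃ ^ 3)
    a   = e₂ * e₃ ^ 3 * (i₁ * i₆ ^ 3)

    private
      u^3 : ∀ {u i} → u * i ≈ 1# → u ^ 3 * i ^ 3 ≈ 1#
      u^3 {u} {i} p = trans (solve 2 (λ u i → u :^ 3 :* i :^ 3 := (u :* i) :^ 3) refl u i)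
        (trans (^-congˡ 3 p) (solve 0 (con (+ 1) :^ 3 := con (+ 1)) refl))

    P-inverse : P * P⁻¹ ≈ 1#
    P-inverse = trans (solve 4 (λ e1 e2 i1 i2 → e1 :* e1 :* i2 :* (e2 :* (i1 :* i1)) := e1 :* e1 :* (i1 :* i1) :* (e2 :* i2)) refl e₁ e₂ i₁ i₂)
      (trans (*-cong (unit-* e₁i₁ e₁i₁) e₂i₂) (*-identityˡ 1#))

    wa≈1 : w * a ≈ 1#
    wa≈1 = trans (solve 8 (λ e1 e2 e3 e6 i1 i2 i3 i6 → e1 :* e6 :* (i2 :* i3) :* (e2 :* e3 :* (i1 :* i6)) := (e1 :* e6) :* (i1 :* i6) :* ((e2 :* e3) :* (i2 :* i3))) refl e₁ e₂ (e₃ ^ 3) (e₆ ^ 3) i₁ i₂ (i₃ ^ 3) (i₆ ^ 3))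
      (trans (*-cong (unit-* e₁i₁ (u^3 e₆i₆)) (unit-* e₂i₂ (u^3 e₃i₃))) (*-identityˡ 1#))

    private
      expand-product : ∀ {x x′ y y′} → expand x ≈ x′ → expand y ≈ y′ → expand (x * y) ≈ x′ * y′
      expand-product p r = trans (expand-* _ _) (*-cong p r)

      expand-cube : ∀ {x x′} → expand x ≈ x′ → expand (x ^ 3) ≈ x′ ^ 3
      expand-cube p = trans (expand-^ _ 3) (^-congˡ 3 p)

      P₃≈ : expand P ≈ e₃ * e₃ * i₆
      P₃≈ = expand-product (expand-product expand-e₁ expand-e₁) expand-i₂

    P₃ P₉ ψ₃ ψ₉ : Series
    P₃ = expand P
    P₉ = expand P₃
    ψ₃ = expand ψ
    ψ₉ = expand ψ₃

    private
      P₉≈ : P₉ ≈ e₉ * e₉ * i₁₈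
      P₉≈ = trans (expand-cong P₃≈) (expand-product (expand-product expand-e₃ expand-e₃) expand-i₆)

      ψ₉≈ : ψ₉ ≈ e₁₈ * e₁₈ * i₉
      ψ₉≈ = trans (expand-cong (expand-product (expand-product expand-e₂ expand-e₂) expand-i₁)) (expand-product (expand-product expand-e₆ expand-e₆) expand-i₃)

      ŵ≈ : expand w ≈ e₃ * e₁₈ ^ 3 * (i₆ * i₉ ^ 3)
      ŵ≈ = expand-product (expand-product expand-e₁ (expand-cube expand-e₆)) (expand-product expand-i₂ (expand-cube expand-i₃))

      â≈ : expand a ≈ e₆ * e₉ ^ 3 * (i₃ * i₁₈ ^ 3)
      â≈ = expand-product (expand-product expand-e₂ (expand-cube expand-e₃)) (expand-product expand-i₁ (expand-cube expand-i₆))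

    theta-comm : ∀ Q a b → QBinomial.theta Q a b ≈ QBinomial.theta Q b a
    theta-comm Q a b = solve 3 (λ x y z → x :* y :* z := x :* z :* y) refl _ _ _

    private
      module Θ = QBinomial

      theta₁ : Θ.theta (q ^ 2) (- q) (- q) ≈ P
      theta₁ = unit-cancel e₂i₂ (φ-product q-order)

      theta₉ : Θ.theta ((q ^ 2) ^ 9) ((- q) ^ 3 * (q ^ 2) ^ 3) ((- q) ^ 3 * (q ^ 2) ^ 3) ≈ P₉
      theta₉ = trans
        (theta-cong (solve 1 (λ q → (q :^ 2) :^ 9 := (q :^ 9) :^ 2) refl q) eq eq)
        (trans (unit-cancel e₁₈i₁₈ (trans (*-congˡ (sym e18)) (φ-product (q^-order 8)))) (sym P₉≈))
        where
        e18 : e ((q ^ 9) ^ 2) ≈ e₁₈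
        e18 = e-cong (^-assocʳ q 9 2)
        eq : (- q) ^ 3 * (q ^ 2) ^ 3 ≈ - (q ^ 9)
        eq = solve 1 (λ q → (:- q) :^ 3 :* (q :^ 2) :^ 3 := :- (q :^ 9)) refl q

      Pŵ : Θ.theta ((q ^ 2) ^ 9) ((- q) ^ 3) ((- q) ^ 3 * (q ^ 2) ^ 6) ≈ P₉ * expand w
      Pŵ = begin
        Θ.theta ((q ^ 2) ^ 9) ((- q) ^ 3) ((- q) ^ 3 * (q ^ 2) ^ 6)
          ≈⟨ theta-cong (solve 1 (λ q → (q :^ 2) :^ 9 := (q :^ 3) :^ 6) refl q) (solve 1 (λ q → (:- q) :^ 3 := :- (q :^ 3)) refl q)
               (solve 1 (λ q → (:- q) :^ 3 :* (q :^ 2) :^ 6 := :- ((q :^ 3) :^ 5)) refl q) ⟩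
        Θ.theta ((q ^ 3) ^ 6) (- (q ^ 3)) (- ((q ^ 3) ^ 5))
          ≈⟨ unit-cancel (unit-* e₆i₆ e₉i₉) (trans (*-congˡ (*-cong (e-cong (sym (power³ 2))) (e-cong (sym (power³ 3)))))
               (trans (ω-product (q^-order 2)) (*-cong (*-congˡ (e-cong (power³ 6))) (e-cong (power³ 6))))) ⟩
        e₃ * e₁₈ * e₁₈ * (i₆ * i₉)
          -- Units are inserted to supply the inverse pairs by which the product P(q⁹) w(q³) is not
          -- in lowest terms.
          ≈⟨ trans (*-identityˡ _) (*-identityˡ _) ⟨
        1# * (1# * (e₃ * e₁₈ * e₁₈ * (i₆ * i₉)))
          ≈⟨ *-cong (sym e₁₈i₁₈) (*-congʳ (sym (unit-* e₉i₉ e₉i₉))) ⟩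
        e₁₈ * i₁₈ * (e₉ * e₉ * (i₉ * i₉) * (e₃ * e₁₈ * e₁₈ * (i₆ * i₉)))
          ≈⟨ solve 6 (λ e3 e9 e18 i6 i9 i18 → e18 :* i18 :* (e9 :* e9 :* (i9 :* i9) :* (e3 :* e18 :* e18 :* (i6 :* i9)))
               := e9 :* e9 :* i18 :* (e3 :* e18 :^ 3 :* (i6 :* i9 :^ 3))) refl e₃ e₉ e₁₈ i₆ i₉ i₁₈ ⟩
        e₉ * e₉ * i₁₈ * (e₃ * e₁₈ ^ 3 * (i₆ * i₉ ^ 3))
          ≈⟨ *-cong P₉≈ ŵ≈ ⟨
        P₉ * expand w ∎

    -- In f(-q, -q) the index classes 1 and -1 contribute the same series by symmetry, hence the
    -- coefficient 2.
    P-dissection : P ≈ P₉ * (1# - ι (+ 2) * q * expand w)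
    P-dissection = begin
      P                                     ≈⟨ theta₁ ⟨
      Θ.theta (q ^ 2) (- q) (- q)           ≈⟨ ThetaDissection.theta-3-dissection (q ^ 2) (- q) (- q) (solve 1 (λ q → (:- q) :* (:- q) := q :^ 2) refl q) (q^-order 1) ⟩
      _                                     ≈⟨ +-cong (+-cong theta₉ (*-congˡ (trans (theta-comm _ _ _) Pŵ))) (*-congˡ Pŵ) ⟩
      P₉ + - q * (P₉ * expand w) + - q * (P₉ * expand w)
        ≈⟨ solve 3 (λ p q w → p :+ (:- q) :* (p :* w) :+ (:- q) :* (p :* w) := p :* (con (+ 1) :- con (+ 2) :* q :* w)) refl P₉ q (expand w) ⟩
      P₉ * (1# - ι (+ 2) * q * expand w)    ∎

    ι-at : ∀ c f n → (ι c * f) n ≡ c ℤ.* f n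
    ι-at c f n = ≡.trans (⊛-cong {g = f} (at (ι≈ c)) (λ _ → ≡.refl) n)
      (≡.trans (·-⊛ c one f n) (≡.cong (c ℤ.*_) (⊛-identityˡ f n)))
      where
      open import Algebra.Properties.Semiring.Mult.TCOptimised semiring using (1+×)
      ι+≈ : ∀ m → ι (+ m) ≈ (+ m) · one
      ι+≈ zero    = coeffwise λ n → ≡.sym (ℤₚ.*-zeroˡ (one n))
      ι+≈ (suc m) = trans (1+× m 1#) (trans (+-congˡ (ι+≈ m)) (coeffwise λ n →
        ≡.trans (⊕-at one ((+ m) · one) n) (≡.sym (ℤₚ.suc-* (+ m) (one n)))))
      ι≈ : ∀ c → ι c ≈ c · one
      ι≈ (+ m)        = ι+≈ m
      ι≈ ℤ.-[1+ m ] = trans (-‿cong (ι+≈ (suc m))) (coeffwise λ n →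
        ≡.trans (⊝-at ((+ suc m) · one) n) (ℤₚ.neg-distribˡ-* (+ suc m) (one n)))

    private
      halve : ∀ {f h} → ι (+ 2) * f ≈ ι (+ 2) * h → f ≈ h
      halve {f} {h} p = coeffwise λ n → ℤₚ.*-cancelˡ-≡ (+ 2) (f n) (h n)
        (≡.trans (≡.sym (ι-at (+ 2) f n)) (≡.trans (at p n) (ι-at (+ 2) h n)))

      theta₁′ : Θ.theta q 1# q ≈ ι (+ 2) * ψ
      theta₁′ = trans (unit-cancel e₁i₁ (ψ-product q-order)) (*-assoc _ _ _)

      theta₉′ : Θ.theta (q ^ 9) (1# ^ 3) (q ^ 3 * q ^ 6) ≈ ι (+ 2) * ψ₉
      theta₉′ = trans (theta-cong refl (solve 0 (con (+ 1) :^ 3 := con (+ 1)) refl) (solve 1 (λ q → q :^ 3 :* q :^ 6 := q :^ 9) refl q))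
        (trans (unit-cancel e₉i₉ (trans (ψ-product (q^-order 8)) (*-congˡ (*-cong (e-cong (^-assocʳ q 9 2)) (e-cong (^-assocʳ q 9 2))))))
          (trans (*-assoc _ _ _) (*-congˡ (sym ψ₉≈))))

      ψâ : Θ.theta (q ^ 9) (1# ^ 3 * q ^ 3) (q ^ 3 * q ^ 3) ≈ ψ₉ * expand a
      ψâ = begin
        Θ.theta (q ^ 9) (1# ^ 3 * q ^ 3) (q ^ 3 * q ^ 3)
          ≈⟨ theta-cong (solve 1 (λ q → q :^ 9 := (q :^ 3) :^ 3) refl q) (solve 1 (λ q → con (+ 1) :^ 3 :* q :^ 3 := q :^ 3) refl q)
               (solve 1 (λ q → q :^ 3 :* q :^ 3 := (q :^ 3) :^ 2) refl q) ⟩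
        Θ.theta ((q ^ 3) ^ 3) (q ^ 3) ((q ^ 3) ^ 2)
          ≈⟨ unit-cancel (unit-* e₃i₃ e₁₈i₁₈) (trans (*-congˡ (*-congˡ (e-cong (sym (power³ 6)))))
               (trans (a-product (q^-order 2)) (*-cong (*-cong (e-cong (power³ 3)) (e-cong (power³ 3))) (e-cong (power³ 2))))) ⟩
        e₉ * e₉ * e₆ * (i₃ * i₁₈)
          ≈⟨ trans (*-identityˡ _) (*-identityˡ _) ⟨
        1# * (1# * (e₉ * e₉ * e₆ * (i₃ * i₁₈)))
          ≈⟨ *-cong (sym e₉i₉) (*-congʳ (sym (unit-* e₁₈i₁₈ e₁₈i₁₈))) ⟩
        e₉ * i₉ * (e₁₈ * e₁₈ * (i₁₈ * i₁₈) * (e₉ * e₉ * e₆ * (i₃ * i₁₈)))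
          ≈⟨ solve 6 (λ e6 e9 e18 i3 i9 i18 → e9 :* i9 :* (e18 :* e18 :* (i18 :* i18) :* (e9 :* e9 :* e6 :* (i3 :* i18)))
               := e18 :* e18 :* i9 :* (e6 :* e9 :^ 3 :* (i3 :* i18 :^ 3))) refl e₆ e₉ e₁₈ i₃ i₉ i₁₈ ⟩
        e₁₈ * e₁₈ * i₉ * (e₆ * e₉ ^ 3 * (i₃ * i₁₈ ^ 3))
          ≈⟨ *-cong ψ₉≈ â≈ ⟨
        ψ₉ * expand a ∎

      ψâ′ : Θ.theta (q ^ 9) (1# ^ 3 * q ^ 6) (q ^ 3) ≈ ψ₉ * expand a
      ψâ′ = trans (theta-comm _ _ _) (trans
        (theta-cong refl (solve 1 (λ q → q :^ 3 := con (+ 1) :^ 3 :* q :^ 3) refl q) (solve 1 (λ q → con (+ 1) :^ 3 :* q :^ 6 := q :^ 3 :* q :^ 3) refl q)) ψâ)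

    -- In 2ψ = f(1, q) the index classes 0 and 1 contribute the same series, while the class -1 is q
    -- times f(1, q⁹) = 2ψ(q⁹). A common factor 2 remains to be cancelled.
    ψ-dissection : ψ ≈ ψ₉ * (expand a + q)
    ψ-dissection = halve (begin
      ι (+ 2) * ψ         ≈⟨ theta₁′ ⟨
      Θ.theta q 1# q      ≈⟨ ThetaDissection.theta-3-dissection q 1# q (*-identityˡ q) q-order ⟩
      _                   ≈⟨ +-cong (+-cong ψâ (*-congˡ ψâ′)) (*-congˡ theta₉′) ⟩
      ψ₉ * expand a + 1# * (ψ₉ * expand a) + q * (ι (+ 2) * ψ₉)
        ≈⟨ solve 3 (λ p q a → p :* a :+ con (+ 1) :* (p :* a) :+ q :* (con (+ 2) :* p) := con (+ 2) :* (p :* (a :+ q))) refl ψ₉ q (expand a) ⟩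
      ι (+ 2) * (ψ₉ * (expand a + q))  ∎)

    -- Comparing the norms of both sides of P e₂ = e₁², where P has the dissection above.
    P⁴-relation : P ^ 4 ≈ P₃ ^ 4 * (1# - ι (+ 8) * q * w ^ 3)
    P⁴-relation = begin
      P ^ 4
        ≈⟨ solve 2 (λ e1 i2 → (e1 :* e1 :* i2) :^ 4 := e1 :^ 4 :* e1 :^ 4 :* i2 :^ 4) refl e₁ i₂ ⟩
      e₁ ^ 4 * e₁ ^ 4 * i₂ ^ 4
        ≈⟨ *-congʳ (*-cong norm-e₁ norm-e₁) ⟨
      N₁ * e₃ * (N₁ * e₃) * i₂ ^ 4
        ≈⟨ solve 3 (λ n e i → n :* e :* (n :* e) :* i := n :* n :* (e :* e :* i)) refl _ _ _ ⟩
      N₁ * N₁ * (e₃ * e₃ * i₂ ^ 4)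
        ≈⟨ *-congʳ norms ⟨
      norm P * N₂ * (e₃ * e₃ * i₂ ^ 4)
        ≈⟨ trans (*-identityʳ _) (*-identityʳ _) ⟨
      norm P * N₂ * (e₃ * e₃ * i₂ ^ 4) * 1# * 1#
        ≈⟨ *-congʳ (*-congˡ e₆i₆) ⟨
      norm P * N₂ * (e₃ * e₃ * i₂ ^ 4) * (e₆ * i₆) * 1#
        ≈⟨ solve 6 (λ n n2 e3 i2 e6 i6 → n :* n2 :* (e3 :* e3 :* i2) :* (e6 :* i6) :* con (+ 1) := n :* (n2 :* e6 :* i2) :* (e3 :* e3 :* i6)) refl _ _ _ _ _ _ ⟩
      norm P * (N₂ * e₆ * i₂ ^ 4) * (e₃ * e₃ * i₆)
        ≈⟨ *-cong (*-cong normP (*-congʳ norm-e₂)) (sym P₃≈) ⟩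
      P₃ ^ 3 * (1# - ι (+ 8) * q * w ^ 3) * (e₂ ^ 4 * i₂ ^ 4) * P₃
        ≈⟨ *-congʳ (*-congˡ (trans (solve 2 (λ e i → e :^ 4 :* i :^ 4 := (e :* i) :^ 4) refl e₂ i₂) (trans (^-congˡ 4 e₂i₂) (solve 0 (con (+ 1) :^ 4 := con (+ 1)) refl)))) ⟩
      P₃ ^ 3 * (1# - ι (+ 8) * q * w ^ 3) * 1# * P₃
        ≈⟨ solve 2 (λ p x → p :^ 3 :* x :* con (+ 1) :* p := p :^ 4 :* x) refl P₃ _ ⟩
      P₃ ^ 4 * (1# - ι (+ 8) * q * w ^ 3) ∎
      where
      N₁ = norm (e q)
      N₂ = norm (e (q ^ 2))
      norms : norm P * N₂ ≈ N₁ * N₁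
      norms = trans (sym (norm-* P e₂)) (trans (norm-cong (trans (*-assoc _ i₂ e₂) (trans (*-congˡ (trans (*-comm i₂ e₂) e₂i₂)) (*-identityʳ _)))) (norm-* e₁ e₁))
      normP : norm P ≈ P₃ ^ 3 * (1# - ι (+ 8) * q * w ^ 3)
      normP = trans (norm-trisected {a = P₃} { - (ι (+ 2) * (P₃ * w))} {0#}
          (trans P-dissection (trans
            (solve 3 (λ p q w → p :* (con (+ 1) :- con (+ 2) :* q :* w) := p :+ q :* (:- (p :* w :+ p :* w)) :+ q :* (q :* con (+ 0))) refl P₉ q (expand w))
            (sym (+-cong (+-congˡ (*-congˡ double)) (*-congˡ (*-congˡ expand-0)))))))
        (solve 3 (λ p q w → p :^ 3 :+ q :* (:- (con (+ 2) :* (p :* w))) :^ 3 :+ q :^ 2 :* con (+ 0) :^ 3 :- con (+ 3) :* q :* p :* (:- (con (+ 2) :* (p :* w))) :* con (+ 0)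
          := p :^ 3 :* (con (+ 1) :- con (+ 8) :* q :* w :^ 3)) refl P₃ q w)
        where
        double : expand (- (ι (+ 2) * (P₃ * w))) ≈ - (P₉ * expand w + P₉ * expand w)
        double = trans (expand-‿ _) (-‿cong (trans (expand-cong (solve 1 (λ x → con (+ 2) :* x := x :+ x) refl _))
          (trans (expand-+ _ _) (+-cong (expand-* P₃ w) (expand-* P₃ w)))))

  open ThetaDissections

  -- The cubic equation of y over ℤ[y(q³)]

  module ModularEquation where

    -- Coefficient lists, constant term first, make the selection of every third coefficient an
    -- operation on lists. `evalₚ` is the same polynomial in the syntax of the solver.
    eval : List ℤ → Series → Series
    eval []       x = 0#
    eval (c ∷ cs) x = ι c + x * eval cs x

    evalₚ : ∀ {n} → List ℤ → Polynomial n → Polynomial n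
    evalₚ []       x = con (+ 0)
    evalₚ (c ∷ cs) x = con c :+ x :* evalₚ cs x

    section-ι : ∀ r c f → section r (ι c * f) ≈ ι c * section r f
    section-ι r c f = coeffwise λ n → ≡.trans (ι-at c f (n ℕ.* 3 ℕ.+ r)) (≡.sym (ι-at c (section r f) n))

    expand-ι : ∀ c → expand (ι c) ≈ ι c
    expand-ι c = trans (expand-unique {h = ι c * 1#}
      (trans (section-ι 0 c 1#) (trans (*-congˡ (trans (section-cong 0 (sym expand-1)) (section₀-expand 1#))) (*-identityʳ _)))
      (trans (section-ι 1 c 1#) (trans (*-congˡ (trans (section-cong 1 (sym expand-1)) (section₁-expand 1#))) (zeroʳ _)))
      (trans (section-ι 2 c 1#) (trans (*-congˡ (trans (section-cong 2 (sym expand-1)) (section₂-expand 1#))) (zeroʳ _))))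
      (*-identityʳ _)

    expand-eval : ∀ cs x → expand (eval cs x) ≈ eval cs (expand x)
    expand-eval []       x = expand-0
    expand-eval (c ∷ cs) x = trans (expand-+ _ _) (+-cong (expand-ι c) (trans (expand-* _ _) (*-congˡ (expand-eval cs x))))

    thirds₀ thirds₂ : List ℤ → List ℤ
    thirds₀ []                = []
    thirds₀ (c ∷ [])          = c ∷ []
    thirds₀ (c ∷ _ ∷ [])      = c ∷ []
    thirds₀ (c ∷ _ ∷ _ ∷ cs)  = c ∷ thirds₀ cs
    thirds₂ []                = []
    thirds₂ (_ ∷ [])          = []
    thirds₂ (_ ∷ _ ∷ [])      = []
    thirds₂ (_ ∷ _ ∷ c ∷ cs)  = c ∷ thirds₂ cs

    -- Since u³ = T(q³) and u = q w(q³), the class r of a polynomial in `u` is w^r times a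
    -- polynomial in `T`.
    u T : Series
    u = q * expand w
    T = q * w ^ 3

    private
      expand-T : expand T ≈ u ^ 3
      expand-T = trans (expand-* _ _) (trans (*-cong expand-q (expand-^ w 3)) (solve 2 (λ q w → q :^ 3 :* w :^ 3 := (q :* w) :^ 3) refl _ _))

      trisected-u : ∀ c₀ c₁ c₂ → trisected (ι c₀) (ι c₁ * w) (ι c₂ * w ^ 2) ≈ ι c₀ + u * ι c₁ + u ^ 2 * ι c₂
      trisected-u c₀ c₁ c₂ = trans (+-cong (+-cong (expand-ι c₀) (*-congˡ (trans (expand-* _ _) (*-congʳ (expand-ι c₁)))))
          (*-congˡ (*-congˡ (trans (expand-* _ _) (*-cong (expand-ι c₂) (expand-^ w 2))))))
        (solve 5 (λ q w a b c → a :+ q :* (b :* w) :+ q :* (q :* (c :* w :^ 2)) := a :+ q :* w :* b :+ (q :* w) :^ 2 :* c) refl q (expand w) _ _ _)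

      eval-split : ∀ c₀ c₁ c₂ cs → eval (c₀ ∷ c₁ ∷ c₂ ∷ cs) u ≈
        trisected (ι c₀) (ι c₁ * w) (ι c₂ * w ^ 2) + expand T * eval cs u
      eval-split c₀ c₁ c₂ cs = trans
        (solve 5 (λ a b c u x → a :+ u :* (b :+ u :* (c :+ u :* x)) := a :+ u :* b :+ u :^ 2 :* c :+ u :^ 3 :* x) refl _ _ _ u _)
        (sym (+-cong (trisected-u c₀ c₁ c₂) (*-congʳ expand-T)))

      eval₁ : ∀ c → eval (c ∷ []) u ≈ trisected (ι c) (ι (+ 0) * w) (ι (+ 0) * w ^ 2)
      eval₁ c = trans (solve 2 (λ c u → c :+ u :* con (+ 0) := c :+ u :* con (+ 0) :+ u :^ 2 :* con (+ 0)) refl _ u) (sym (trisected-u c (+ 0) (+ 0)))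

      eval₂ : ∀ c d → eval (c ∷ d ∷ []) u ≈ trisected (ι c) (ι d * w) (ι (+ 0) * w ^ 2)
      eval₂ c d = trans (solve 3 (λ c d u → c :+ u :* (d :+ u :* con (+ 0)) := c :+ u :* d :+ u :^ 2 :* con (+ 0)) refl _ _ u) (sym (trisected-u c d (+ 0)))

    section₀-eval : ∀ cs → section 0 (eval cs u) ≈ eval (thirds₀ cs) T
    section₀-eval []                 = coeffwise λ _ → ≡.refl
    section₀-eval (c ∷ [])           = trans (section-cong 0 (eval₁ c)) (trans (section₀-trisected _ _ _) (solve 2 (λ c x → c := c :+ x :* con (+ 0)) refl _ T))
    section₀-eval (c ∷ d ∷ [])       = trans (section-cong 0 (eval₂ c d)) (trans (section₀-trisected _ _ _) (solve 2 (λ c x → c := c :+ x :* con (+ 0)) refl _ T))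
    section₀-eval (c₀ ∷ c₁ ∷ c₂ ∷ cs) = trans (section-cong 0 (eval-split c₀ c₁ c₂ cs)) (trans (section-+ 0 _ _)
      (+-cong (section₀-trisected _ _ _) (trans (section₀-* T _) (*-congˡ (section₀-eval cs)))))

    section₂-eval : ∀ cs → section 2 (eval cs u) ≈ w ^ 2 * eval (thirds₂ cs) T
    section₂-eval []                 = trans (coeffwise λ _ → ≡.refl) (sym (zeroʳ _))
    section₂-eval (c ∷ [])           = trans (section-cong 2 (eval₁ c)) (trans (section₂-trisected _ _ _) (*-comm _ _))
    section₂-eval (c ∷ d ∷ [])       = trans (section-cong 2 (eval₂ c d)) (trans (section₂-trisected _ _ _) (*-comm _ _))
    section₂-eval (c₀ ∷ c₁ ∷ c₂ ∷ cs) = trans (section-cong 2 (eval-split c₀ c₁ c₂ cs)) (trans (section-+ 2 _ _)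
      (trans (+-cong (section₂-trisected _ _ _) (trans (section₂-* T _) (*-congˡ (section₂-eval cs))))
        (solve 4 (λ c w t x → c :* w :+ t :* (w :* x) := w :* (c :+ t :* x)) refl _ _ T _)))

    P₃⁻¹ y s G₀ B : Series
    P₃⁻¹ = expand P⁻¹
    y    = P₃ ^ 4 * P⁻¹ ^ 4
    s    = P ^ 4 * P₃⁻¹ ^ 4
    G₀   = ψ ^ 2 * P⁻¹
    B    = ψ₃ ^ 2 * P₃ ^ 3 * P⁻¹ ^ 4

    P₃-inverse : P₃ * P₃⁻¹ ≈ 1#
    P₃-inverse = trans (sym (expand-* P P⁻¹)) (trans (expand-cong P-inverse) expand-1)

    ^-inverse : ∀ {x x′} n → x * x′ ≈ 1# → x ^ n * x′ ^ n ≈ 1#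
    ^-inverse zero    p = *-identityˡ 1#
    ^-inverse (suc n) p = unit-* p (^-inverse n p)

    y*s : y * s ≈ 1#
    y*s = trans (solve 4 (λ a b c d → a :* b :* (c :* d) := a :* d :* (c :* b)) refl _ _ _ _)
      (trans (*-cong (^-inverse 4 P₃-inverse) (^-inverse 4 P-inverse)) (*-identityˡ 1#))

    -- The norm relation divided by P(q³)⁴. Read as 8T = 1 - s, it brings the polynomials in `T`
    -- that sections produce back to powers of y.
    s≈1-8T : s ≈ 1# - ι (+ 8) * T
    s≈1-8T = trans (*-congʳ P⁴-relation) (trans
      (solve 4 (λ a x b t → a :* x :* b := a :* b :* x) refl _ _ _ T)
      (trans (*-congʳ (^-inverse 4 P₃-inverse)) (solve 2 (λ q w → con (+ 1) :* (con (+ 1) :- con (+ 8) :* q :* w) := con (+ 1) :- con (+ 8) :* (q :* w)) refl q _)))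

    P≈ : P ≈ P₉ * (1# - ι (+ 2) * u)
    P≈ = trans P-dissection (*-congˡ (+-congˡ (-‿cong (*-assoc _ _ _))))

    P₃⁴≈ : P₃ ^ 4 ≈ P₉ ^ 4 * (1# - ι (+ 8) * u ^ 3)
    P₃⁴≈ = trans (sym (expand-^ P 4)) (trans (expand-cong P⁴-relation) (trans (expand-* _ _) (*-cong (expand-^ P₃ 4)
      (trans (expand-+ _ _) (+-cong expand-1 (trans (expand-‿ _) (-‿cong (trans (expand-cong (*-assoc _ _ _)) (trans (expand-* _ _) (*-cong (expand-ι (+ 8)) expand-T))))))))))

    -- With v = P(q⁹)/P(q) and x = 2u we have (1 - x) v = 1 and y(q³) (1 - x³) = 1, so y = v (v³ - (x v)³) with x v = v - 1.
    private
      v Y : Series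
      v = P₉ * P⁻¹
      Y = expand y

      xv : ι (+ 2) * u * v ≈ v - 1#
      xv = begin
        ι (+ 2) * u * v              ≈⟨ solve 3 (λ u p i → con (+ 2) :* u :* (p :* i) := p :* i :- p :* (con (+ 1) :- con (+ 2) :* u) :* i) refl u P₉ P⁻¹ ⟩
        v - P₉ * (1# - ι (+ 2) * u) * P⁻¹  ≈⟨ +-congˡ (-‿cong (trans (*-congʳ (sym P≈)) P-inverse)) ⟩
        v - 1#                       ∎

      Y≈ : Y ≈ P₉ ^ 4 * P₃⁻¹ ^ 4
      Y≈ = trans (expand-* _ _) (*-cong (expand-^ P₃ 4) (expand-^ P⁻¹ 4))

      Y-unit : Y * (1# - (ι (+ 2) * u) ^ 3) ≈ 1#
      Y-unit = begin
        Y * (1# - (ι (+ 2) * u) ^ 3)                        ≈⟨ *-congʳ Y≈ ⟩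
        P₉ ^ 4 * P₃⁻¹ ^ 4 * (1# - (ι (+ 2) * u) ^ 3)        ≈⟨ solve 3 (λ p i u → p :* i :* (con (+ 1) :- (con (+ 2) :* u) :^ 3) := p :* (con (+ 1) :- con (+ 8) :* u :^ 3) :* i) refl _ _ u ⟩
        P₉ ^ 4 * (1# - ι (+ 8) * u ^ 3) * P₃⁻¹ ^ 4          ≈⟨ *-congʳ P₃⁴≈ ⟨
        P₃ ^ 4 * P₃⁻¹ ^ 4                                   ≈⟨ ^-inverse 4 P₃-inverse ⟩
        1#                                                  ∎

      cubes : v ^ 3 - (ι (+ 2) * u * v) ^ 3 ≈ ι (+ 3) * v * v - ι (+ 3) * v + 1#
      cubes = trans (+-congˡ (-‿cong (^-congˡ 3 xv)))
        (solve 1 (λ v → v :^ 3 :- (v :- con (+ 1)) :^ 3 := con (+ 3) :* v :* v :- con (+ 3) :* v :+ con (+ 1)) refl v)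

      v³ : v ^ 3 ≈ Y * (ι (+ 3) * v * v - ι (+ 3) * v + 1#)
      v³ = begin
        v ^ 3                                            ≈⟨ *-identityˡ _ ⟨
        1# * v ^ 3                                       ≈⟨ *-congʳ Y-unit ⟨
        Y * (1# - (ι (+ 2) * u) ^ 3) * v ^ 3             ≈⟨ solve 3 (λ y x v → y :* (con (+ 1) :- x :^ 3) :* v :^ 3 := y :* (v :^ 3 :- (x :* v) :^ 3)) refl Y (ι (+ 2) * u) v ⟩
        Y * (v ^ 3 - (ι (+ 2) * u * v) ^ 3)              ≈⟨ *-congˡ cubes ⟩
        Y * (ι (+ 3) * v * v - ι (+ 3) * v + 1#)         ∎

      yY : y * Y ≈ v ^ 4
      yY = begin
        y * Y                                            ≈⟨ *-congˡ Y≈ ⟩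
        P₃ ^ 4 * P⁻¹ ^ 4 * (P₉ ^ 4 * P₃⁻¹ ^ 4)           ≈⟨ solve 4 (λ a b c d → a :* b :* (c :* d) := a :* d :* (c :* b)) refl _ _ _ _ ⟩
        P₃ ^ 4 * P₃⁻¹ ^ 4 * (P₉ ^ 4 * P⁻¹ ^ 4)           ≈⟨ *-congʳ (^-inverse 4 P₃-inverse) ⟩
        1# * (P₉ ^ 4 * P⁻¹ ^ 4)                          ≈⟨ solve 2 (λ a b → con (+ 1) :* (a :^ 4 :* b :^ 4) := (a :* b) :^ 4) refl P₉ P⁻¹ ⟩
        v ^ 4                                            ∎

      y≈ : y ≈ v * (ι (+ 3) * v * v - ι (+ 3) * v + 1#)
      y≈ = begin
        y                                                ≈⟨ *-identityʳ y ⟨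
        y * 1#                                           ≈⟨ *-congˡ Y-unit ⟨
        y * (Y * (1# - (ι (+ 2) * u) ^ 3))               ≈⟨ *-assoc _ _ _ ⟨
        y * Y * (1# - (ι (+ 2) * u) ^ 3)                 ≈⟨ *-congʳ yY ⟩
        v ^ 4 * (1# - (ι (+ 2) * u) ^ 3)                 ≈⟨ solve 2 (λ x v → v :^ 4 :* (con (+ 1) :- x :^ 3) := v :* (v :^ 3 :- (x :* v) :^ 3)) refl (ι (+ 2) * u) v ⟩
        v * (v ^ 3 - (ι (+ 2) * u * v) ^ 3)              ≈⟨ *-congˡ cubes ⟩
        v * (ι (+ 3) * v * v - ι (+ 3) * v + 1#)         ∎

    -- The first two elementary symmetric functions of the values 3v³ - 3v² + v of y at the three
    -- roots of v³ = Y (3v² - 3v + 1); the third one is Y.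
    σ₁-coeffs σ₂-coeffs : List ℤ
    σ₁-coeffs = + 0 ∷ + 30 ∷ ℤ.- (+ 108) ∷ + 81 ∷ []
    σ₂-coeffs = + 0 ∷ + 12 ∷ ℤ.- (+ 9) ∷ []

    σ₁ σ₂ : Series → Series
    σ₁ = eval σ₁-coeffs
    σ₂ = eval σ₂-coeffs

    private
      σ₁ₚ σ₂ₚ : ∀ {n} → Polynomial n → Polynomial n
      σ₁ₚ = evalₚ σ₁-coeffs
      σ₂ₚ = evalₚ σ₂-coeffs

    -- The explicit cofactor is the quotient of the polynomial division by v³ - Y (3v² - 3v + 1).
    modular-equation : y * (y * y) ≈ expand (σ₁ y) * (y * y) - expand (σ₂ y) * y + expand y
    modular-equation = begin
      y * (y * y)
        ≈⟨ *-cong y≈ (*-cong y≈ y≈) ⟩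
      p * (p * p)
        ≈⟨ solve 2 (λ v Y →
            let c : ℕ → Polynomial 2
                c n = con (+ n)
                p = v :* (c 3 :* v :* v :- c 3 :* v :+ c 1)
            in p :* (p :* p) := (σ₁ₚ Y :* (p :* p) :- σ₂ₚ Y :* p :+ Y) :+
              (v :^ 3 :- Y :* (c 3 :* v :* v :- c 3 :* v :+ c 1)) :*
              (c 27 :* v :^ 6 :+ c 81 :* v :^ 5 :* Y :- c 81 :* v :^ 5
              :+ c 243 :* v :^ 4 :* Y :^ 2 :- c 324 :* v :^ 4 :* Y :+ c 108 :* v :^ 4
              :- c 243 :* v :^ 3 :* Y :^ 2 :+ c 324 :* v :^ 3 :* Y :- c 81 :* v :^ 3
              :+ c 81 :* v :^ 2 :* Y :^ 2 :- c 108 :* v :^ 2 :* Y :+ c 36 :* v :^ 2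
              :+ c 9 :* v :* Y :- c 9 :* v :+ c 1)) refl v Y ⟩
      _ ≈⟨ +-congˡ (trans (*-congʳ (trans (+-congʳ v³) (-‿inverseʳ _))) (zeroˡ _)) ⟩
      σ₁ Y * (p * p) - σ₂ Y * p + Y + 0#
        ≈⟨ +-identityʳ _ ⟩
      σ₁ Y * (p * p) - σ₂ Y * p + Y
        ≈⟨ +-congʳ (+-cong (*-cong (expand-eval σ₁-coeffs y) (*-cong y≈ y≈)) (-‿cong (*-cong (expand-eval σ₂-coeffs y) y≈))) ⟨
      expand (σ₁ y) * (y * y) - expand (σ₂ y) * y + expand y ∎
      where
      p = v * (ι (+ 3) * v * v - ι (+ 3) * v + 1#)

  open ModularEquation

  -- Explicit sections at non-positive powers of y

  module InitialSections where

    section₀-form : ∀ {f} c cs → f ≈ expand c * eval cs u → section 0 f ≈ c * eval (thirds₀ cs) T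
    section₀-form c cs p = trans (section-cong 0 p) (trans (section₀-* c _) (*-congˡ (section₀-eval cs)))

    -- The class 2 of a polynomial in `u` carries w², and ψ² carries a². As w a = 1 they cancel, and
    -- no `w` survives outside `T`.
    section₂-form : ∀ {f} c cs → f ≈ expand ((ψ₃ * a) ^ 2 * c) * eval cs u → section 2 f ≈ ψ₃ ^ 2 * c * eval (thirds₂ cs) T
    section₂-form {f} c cs p = begin
      section 2 f                                    ≈⟨ section-cong 2 p ⟩
      _                                              ≈⟨ trans (section₂-* _ _) (*-congˡ (section₂-eval cs)) ⟩
      (ψ₃ * a) ^ 2 * c * (w ^ 2 * X)                 ≈⟨ solve 5 (λ p a c w x → (p :* a) :^ 2 :* c :* (w :^ 2 :* x) := (w :* a) :^ 2 :* (p :^ 2 :* c :* x)) refl ψ₃ a c w X ⟩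
      (w * a) ^ 2 * (ψ₃ ^ 2 * c * X)                 ≈⟨ *-congʳ (trans (^-congˡ 2 wa≈1) (solve 0 (con (+ 1) :^ 2 := con (+ 1)) refl)) ⟩
      1# * (ψ₃ ^ 2 * c * X)                          ≈⟨ *-identityˡ _ ⟩
      ψ₃ ^ 2 * c * X                                 ∎
      where X = eval (thirds₂ cs) T

    -- Since w a = 1, taking a(q³) out of a(q³) + q leaves 1 + u.
    ψ≈ : ψ ≈ expand (ψ₃ * a) * (1# + u)
    ψ≈ = begin
      ψ                                              ≈⟨ ψ-dissection ⟩
      ψ₉ * (expand a + q)                            ≈⟨ *-congˡ (+-congˡ (trans (sym (*-identityʳ q)) (*-congˡ (sym ŵâ)))) ⟩
      ψ₉ * (expand a + q * (expand w * expand a))    ≈⟨ solve 4 (λ p a q w → p :* (a :+ q :* (w :* a)) := p :* a :* (con (+ 1) :+ q :* w)) refl ψ₉ (expand a) q (expand w) ⟩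
      ψ₉ * expand a * (1# + u)                       ≈⟨ *-congʳ (expand-* ψ₃ a) ⟨
      expand (ψ₃ * a) * (1# + u)                     ∎
      where
      ŵâ : expand w * expand a ≈ 1#
      ŵâ = trans (sym (expand-* w a)) (trans (expand-cong wa≈1) expand-1)

    -- 1/(1 - 2u) equals (1 + 2u + 4u²)/(1 - 8u³), and by the norm relation at q³ the new
    -- denominator is P(q³)⁴/P(q⁹)⁴, a series in q³.
    P⁻¹≈ : P⁻¹ ≈ P₉ ^ 3 * P₃⁻¹ ^ 4 * (1# + ι (+ 2) * u + ι (+ 4) * u ^ 2)
    P⁻¹≈ = begin
      P⁻¹                                            ≈⟨ *-identityʳ _ ⟨
      P⁻¹ * 1#                                       ≈⟨ *-congˡ (trans (*-congʳ (sym P₃⁴≈)) (^-inverse 4 P₃-inverse)) ⟨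
      P⁻¹ * (P₉ ^ 4 * (1# - ι (+ 8) * u ^ 3) * P₃⁻¹ ^ 4)
        ≈⟨ solve 4 (λ i p j u → i :* (p :^ 4 :* (con (+ 1) :- con (+ 8) :* u :^ 3) :* j :^ 4)
             := p :* (con (+ 1) :- con (+ 2) :* u) :* i :* (p :^ 3 :* j :^ 4 :* (con (+ 1) :+ con (+ 2) :* u :+ con (+ 4) :* u :^ 2))) refl P⁻¹ P₉ P₃⁻¹ u ⟩
      P₉ * (1# - ι (+ 2) * u) * P⁻¹ * X              ≈⟨ *-congʳ (trans (*-congʳ (sym P≈)) P-inverse) ⟩
      1# * X                                         ≈⟨ *-identityˡ _ ⟩
      X                                              ∎
      where X = P₉ ^ 3 * P₃⁻¹ ^ 4 * (1# + ι (+ 2) * u + ι (+ 4) * u ^ 2)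

    private
      cancel₁ : ∀ {x y f h} → x * y ≈ 1# → f ≈ x * y * h → f ≈ h
      cancel₁ p r = trans r (trans (*-congʳ p) (*-identityˡ _))

      expand-monomial : ∀ m n → expand ((ψ₃ * a) ^ 2 * (P₃ ^ m * P⁻¹ ^ n)) ≈ expand (ψ₃ * a) ^ 2 * (P₉ ^ m * P₃⁻¹ ^ n)
      expand-monomial m n = trans (expand-* _ _) (*-cong (expand-^ _ 2) (trans (expand-* _ _) (*-cong (expand-^ _ m) (expand-^ _ n))))

      8T : ι (+ 8) * T ≈ 1# - s
      8T = trans (solve 1 (λ x → x := con (+ 1) :- (con (+ 1) :- x)) refl _) (+-congˡ (-‿cong (sym s≈1-8T)))

    -- Here the first 9 originates: it is the coefficient of u² in (1 + u)² (1 + 2u + 4u²), and the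
    -- degree is too small for a further term in the class 2.
    section₂-G : section 2 G₀ ≈ ι (+ 9) * B
    section₂-G = trans
      (section₂-form (P₃ ^ 3 * P⁻¹ ^ 4) (+ 1 ∷ + 4 ∷ + 9 ∷ + 10 ∷ + 4 ∷ [])
        (trans (*-cong (^-congˡ 2 ψ≈) P⁻¹≈) (trans
          (solve 4 (λ m p j u → (m :* (con (+ 1) :+ u)) :^ 2 :* (p :^ 3 :* j :^ 4 :* (con (+ 1) :+ con (+ 2) :* u :+ con (+ 4) :* u :^ 2))
            := m :^ 2 :* (p :^ 3 :* j :^ 4) :* evalₚ (+ 1 ∷ + 4 ∷ + 9 ∷ + 10 ∷ + 4 ∷ []) u) refl (expand (ψ₃ * a)) P₉ P₃⁻¹ u)
          (*-congʳ (sym (expand-monomial 3 4))))))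
      (solve 4 (λ ψ p i T → ψ :^ 2 :* (p :^ 3 :* i :^ 4) :* (con (+ 9) :+ T :* con (+ 0)) := con (+ 9) :* (ψ :^ 2 :* p :^ 3 :* i :^ 4)) refl ψ₃ P₃ P⁻¹ T)

    -- In (1 + u)² (1 - 2u)³ the coefficients of u² and u⁵ are 1 and -8, so the selected polynomial
    -- is 1 - 8T = s.
    section₂-Gs : section 2 (G₀ * s) ≈ B * s
    section₂-Gs = trans
      (section₂-form (P₃ ^ 3 * P⁻¹ ^ 4) (+ 1 ∷ ℤ.- (+ 4) ∷ + 1 ∷ + 10 ∷ ℤ.- (+ 4) ∷ ℤ.- (+ 8) ∷ [])
        (begin
          G₀ * s
            ≈⟨ cancel₁ P-inverse (solve 4 (λ ψ i p j → ψ :^ 2 :* i :* (p :^ 4 :* j :^ 4) := p :* i :* (ψ :^ 2 :* p :^ 3 :* j :^ 4)) refl ψ P⁻¹ P P₃⁻¹) ⟩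
          ψ ^ 2 * P ^ 3 * P₃⁻¹ ^ 4
            ≈⟨ *-congʳ (*-cong (^-congˡ 2 ψ≈) (^-congˡ 3 P≈)) ⟩
          _ ≈⟨ solve 4 (λ m p j u → (m :* (con (+ 1) :+ u)) :^ 2 :* (p :* (con (+ 1) :- con (+ 2) :* u)) :^ 3 :* j :^ 4
                 := m :^ 2 :* (p :^ 3 :* j :^ 4) :* evalₚ (+ 1 ∷ ℤ.- (+ 4) ∷ + 1 ∷ + 10 ∷ ℤ.- (+ 4) ∷ ℤ.- (+ 8) ∷ []) u) refl (expand (ψ₃ * a)) P₉ P₃⁻¹ u ⟩
          _ ≈⟨ *-congʳ (expand-monomial 3 4) ⟨
          _ ∎))
      (*-cong (sym (*-assoc _ _ _)) (trans (solve 1 (λ T → con (+ 1) :+ T :* (con (ℤ.- (+ 8)) :+ T :* con (+ 0)) := con (+ 1) :- con (+ 8) :* T) refl T) (sym s≈1-8T)))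

    private
      -- (1 + u)² (1 - 2u)⁷
      coeffs₂₇ : List ℤ
      coeffs₂₇ = + 1 ∷ ℤ.- (+ 12) ∷ + 57 ∷ ℤ.- (+ 126) ∷ + 84 ∷ + 168 ∷ ℤ.- (+ 336) ∷ + 96 ∷ + 192 ∷ ℤ.- (+ 128) ∷ []

    section₂-Gs² : section 2 (G₀ * s ^ 2) ≈ B * y * (ι (+ 81) - ι (+ 27) * s + ι (+ 3) * s ^ 2)
    section₂-Gs² = trans
      (section₂-form (P₃ ^ 7 * P⁻¹ ^ 8) coeffs₂₇
        (begin
          G₀ * s ^ 2
            ≈⟨ cancel₁ P-inverse (solve 4 (λ ψ i p j → ψ :^ 2 :* i :* (p :^ 4 :* j :^ 4) :^ 2 := p :* i :* (ψ :^ 2 :* p :^ 7 :* j :^ 8)) refl ψ P⁻¹ P P₃⁻¹) ⟩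
          ψ ^ 2 * P ^ 7 * P₃⁻¹ ^ 8
            ≈⟨ *-congʳ (*-cong (^-congˡ 2 ψ≈) (^-congˡ 7 P≈)) ⟩
          _ ≈⟨ solve 4 (λ m p j u → (m :* (con (+ 1) :+ u)) :^ 2 :* (p :* (con (+ 1) :- con (+ 2) :* u)) :^ 7 :* j :^ 8
                 := m :^ 2 :* (p :^ 7 :* j :^ 8) :* evalₚ coeffs₂₇ u) refl (expand (ψ₃ * a)) P₉ P₃⁻¹ u ⟩
          _ ≈⟨ *-congʳ (expand-monomial 7 8) ⟨
          _ ∎))
      (*-cong (solve 3 (λ ψ p i → ψ :^ 2 :* (p :^ 7 :* i :^ 8) := ψ :^ 2 :* p :^ 3 :* i :^ 4 :* (p :^ 4 :* i :^ 4)) refl ψ₃ P₃ P⁻¹)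
        -- The coefficients of u², u⁵ and u⁸, arranged in powers of 8T so that 1 - s can be
        -- substituted.
        (trans (solve 1 (λ T → evalₚ (+ 57 ∷ + 168 ∷ + 192 ∷ []) T := con (+ 57) :+ con (+ 21) :* (con (+ 8) :* T) :+ con (+ 3) :* (con (+ 8) :* T) :^ 2) refl T)
          (trans (+-cong (+-congˡ (*-congˡ 8T)) (*-congˡ (^-congˡ 2 8T)))
            (solve 1 (λ s → con (+ 57) :+ con (+ 21) :* (con (+ 1) :- s) :+ con (+ 3) :* (con (+ 1) :- s) :^ 2 := con (+ 81) :- con (+ 27) :* s :+ con (+ 3) :* s :^ 2) refl s))))

    private
      ψ₃² : ∀ m n → expand (ψ ^ 2 * (P₃ ^ m * P⁻¹ ^ n)) ≈ ψ₃ ^ 2 * (P₉ ^ m * P₃⁻¹ ^ n)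
      ψ₃² m n = trans (expand-* _ _) (*-cong (expand-^ _ 2) (trans (expand-* _ _) (*-cong (expand-^ _ m) (expand-^ _ n))))

    -- B/y = ψ(q³)²/P(q³) is G at q³, with no other residue class present. Thus this section leads
    -- from `B` back to G.
    section₀-Bs : section 0 (B * s) ≈ G₀
    section₀-Bs = trans (section-cong 0 (begin
      B * s
        ≈⟨ cancel₁ (unit-* (^-inverse 3 P₃-inverse) (^-inverse 4 P-inverse))
             (solve 5 (λ ψ p i p₃ j → ψ :^ 2 :* p₃ :^ 3 :* i :^ 4 :* (p :^ 4 :* j :^ 4) := p₃ :^ 3 :* p :^ 4 :* (j :^ 3 :* i :^ 4) :* (ψ :^ 2 :* j)) refl ψ₃ P P⁻¹ P₃ P₃⁻¹) ⟩
      ψ₃ ^ 2 * P₃⁻¹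
        ≈⟨ trans (expand-* _ _) (*-congʳ (expand-^ ψ 2)) ⟨
      expand G₀ ∎)) (section₀-expand G₀)

    section₀-Bs² : section 0 (B * s ^ 2) ≈ G₀ * y * (ι (+ 4) * s - ι (+ 3))
    section₀-Bs² = trans
      -- The list holds the coefficients of (1 - 2u)⁴.
      (section₀-form (ψ ^ 2 * (P₃ ^ 4 * P⁻¹ ^ 5)) (+ 1 ∷ ℤ.- (+ 8) ∷ + 24 ∷ ℤ.- (+ 32) ∷ + 16 ∷ [])
        (begin
          B * s ^ 2
            ≈⟨ cancel₁ (unit-* (^-inverse 3 P₃-inverse) (^-inverse 4 P-inverse))
                 (solve 5 (λ ψ p i p₃ j → ψ :^ 2 :* p₃ :^ 3 :* i :^ 4 :* (p :^ 4 :* j :^ 4) :^ 2 := p₃ :^ 3 :* p :^ 4 :* (j :^ 3 :* i :^ 4) :* (ψ :^ 2 :* j :^ 5 :* p :^ 4)) refl ψ₃ P P⁻¹ P₃ P₃⁻¹) ⟩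
          ψ₃ ^ 2 * P₃⁻¹ ^ 5 * P ^ 4
            ≈⟨ *-congˡ (^-congˡ 4 P≈) ⟩
          _ ≈⟨ solve 4 (λ ψ j p u → ψ :^ 2 :* j :^ 5 :* (p :* (con (+ 1) :- con (+ 2) :* u)) :^ 4
                 := ψ :^ 2 :* (p :^ 4 :* j :^ 5) :* evalₚ (+ 1 ∷ ℤ.- (+ 8) ∷ + 24 ∷ ℤ.- (+ 32) ∷ + 16 ∷ []) u) refl ψ₃ P₃⁻¹ P₉ u ⟩
          _ ≈⟨ *-congʳ (ψ₃² 4 5) ⟨
          _ ∎))
      (*-cong (solve 3 (λ ψ p i → ψ :^ 2 :* (p :^ 4 :* i :^ 5) := ψ :^ 2 :* i :* (p :^ 4 :* i :^ 4)) refl ψ P₃ P⁻¹)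
        (trans (solve 1 (λ T → evalₚ (+ 1 ∷ ℤ.- (+ 32) ∷ []) T := con (+ 1) :- con (+ 4) :* (con (+ 8) :* T)) refl T)
          (trans (+-congˡ (-‿cong (*-congˡ 8T))) (solve 1 (λ s → con (+ 1) :- con (+ 4) :* (con (+ 1) :- s) := con (+ 4) :* s :- con (+ 3)) refl s))))

    private
      -- (1 - 2u)⁸
      coeffs₈ : List ℤ
      coeffs₈ = + 1 ∷ ℤ.- (+ 16) ∷ + 112 ∷ ℤ.- (+ 448) ∷ + 1120 ∷ ℤ.- (+ 1792) ∷ + 1792 ∷ ℤ.- (+ 1024) ∷ + 256 ∷ []

    section₀-Bs³ : section 0 (B * s ^ 3) ≈ G₀ * y ^ 2 * (ι (+ 28) * s ^ 2 - ι (+ 27))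
    section₀-Bs³ = trans
      (section₀-form (ψ ^ 2 * (P₃ ^ 8 * P⁻¹ ^ 9)) coeffs₈
        (begin
          B * s ^ 3
            ≈⟨ cancel₁ (unit-* (^-inverse 3 P₃-inverse) (^-inverse 4 P-inverse))
                 (solve 5 (λ ψ p i p₃ j → ψ :^ 2 :* p₃ :^ 3 :* i :^ 4 :* (p :^ 4 :* j :^ 4) :^ 3 := p₃ :^ 3 :* p :^ 4 :* (j :^ 3 :* i :^ 4) :* (ψ :^ 2 :* j :^ 9 :* p :^ 8)) refl ψ₃ P P⁻¹ P₃ P₃⁻¹) ⟩
          ψ₃ ^ 2 * P₃⁻¹ ^ 9 * P ^ 8
            ≈⟨ *-congˡ (^-congˡ 8 P≈) ⟩
          _ ≈⟨ solve 4 (λ ψ j p u → ψ :^ 2 :* j :^ 9 :* (p :* (con (+ 1) :- con (+ 2) :* u)) :^ 8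
                 := ψ :^ 2 :* (p :^ 8 :* j :^ 9) :* evalₚ coeffs₈ u) refl ψ₃ P₃⁻¹ P₉ u ⟩
          _ ≈⟨ *-congʳ (ψ₃² 8 9) ⟨
          _ ∎))
      (*-cong (solve 3 (λ ψ p i → ψ :^ 2 :* (p :^ 8 :* i :^ 9) := ψ :^ 2 :* i :* (p :^ 4 :* i :^ 4) :^ 2) refl ψ P₃ P⁻¹)
        (trans (solve 1 (λ T → evalₚ (+ 1 ∷ ℤ.- (+ 448) ∷ + 1792 ∷ []) T := con (+ 1) :- con (+ 56) :* (con (+ 8) :* T) :+ con (+ 28) :* (con (+ 8) :* T) :^ 2) refl T)
          (trans (+-cong (+-congˡ (-‿cong (*-congˡ 8T))) (*-congˡ (^-congˡ 2 8T)))
            (solve 1 (λ s → con (+ 1) :- con (+ 56) :* (con (+ 1) :- s) :+ con (+ 28) :* (con (+ 1) :- s) :^ 2 := con (+ 28) :* s :^ 2 :- con (+ 27)) refl s))))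

  open InitialSections

  -- The two lattices and their behaviour under the sections

  module Lattices where

    open import Data.Product using (_×_)

    data Span (b : ℕ → Series) : Series → Set where
      gen   : ∀ k → Span b (b k)
      add   : ∀ {f h} → Span b f → Span b h → Span b (f + h)
      scale : ∀ {f} c → Span b f → Span b (ι c * f)
      resp  : ∀ {f h} → f ≈ h → Span b f → Span b h

    span-closed : ∀ {b} m → (∀ k → Span b (m * b k)) → ∀ {f} → Span b f → Span b (m * f)
    span-closed m p (gen k)     = p k
    span-closed m p (add x z)   = resp (sym (distribˡ m _ _)) (add (span-closed m p x) (span-closed m p z))
    span-closed m p (scale c x) = resp (solve 3 (λ c m f → c :* (m :* f) := m :* (c :* f)) refl _ m _) (scale c (span-closed m p x))
    span-closed m p (resp r x)  = resp (*-congˡ r) (span-closed m p x)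

    3y : Series
    3y = ι (+ 3) * y

    -- In the first lattice y^(k+1) has weight 3^k. In the second, y has weight 1 and y^(k+2) has
    -- weight 3^(k+2): the surplus 9 over the weight 3^k used with the recurrence is what the
    -- section 2 brings out.
    basisB basisG : ℕ → Series
    basisB zero    = B
    basisB (suc k) = B * (y * 3y ^ k)
    basisG zero    = G₀ * y
    basisG (suc k) = G₀ * (ι (+ 9) * y * y * 3y ^ k)

    ΛB ΛG : Series → Set
    ΛB = Span basisB
    ΛG = Span basisG

    3y-ΛB : ∀ {f} → ΛB f → ΛB (3y * f)
    3y-ΛB = span-closed 3y λ where
      zero    → resp (solve 2 (λ y b → con (+ 3) :* (b :* (y :* con (+ 1))) := con (+ 3) :* y :* b) refl y B) (scale (+ 3) (gen 1))
      (suc k) → resp (solve 3 (λ y b m → b :* (y :* (con (+ 3) :* y :* m)) := con (+ 3) :* y :* (b :* (y :* m))) refl y B (3y ^ k)) (gen (suc (suc k)))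

    -- Multiplication by 3y suits `ΛB` but takes G₀ y to 3 G₀ y², where the weight is 9. Both
    -- lattices admit 9y and 27y², and 3σ₁, 3σ₂ and 27y are integer polynomials in these.
    record Closed (Λ : Series → Set) : Set where
      field
        times-9y   : ∀ {f} → Λ f → Λ (ι (+ 9) * y * f)
        times-27y² : ∀ {f} → Λ f → Λ (ι (+ 27) * y ^ 2 * f)

    ΛB-closed : Closed ΛB
    ΛB-closed = record
      { times-9y   = λ x → resp (solve 2 (λ y f → con (+ 3) :* (con (+ 3) :* y :* f) := con (+ 9) :* y :* f) refl y _) (scale (+ 3) (3y-ΛB x))
      ; times-27y² = λ x → resp (solve 2 (λ y f → con (+ 3) :* (con (+ 3) :* y :* (con (+ 3) :* y :* f)) := con (+ 27) :* y :^ 2 :* f) refl y _) (scale (+ 3) (3y-ΛB (3y-ΛB x)))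
      }

    ΛG-closed : Closed ΛG
    ΛG-closed = record
      { times-9y   = span-closed _ λ where
          zero    → resp (solve 2 (λ y g → g :* (con (+ 9) :* y :* y :* con (+ 1)) := con (+ 9) :* y :* (g :* y)) refl y G₀) (gen 1)
          (suc k) → resp (solve 3 (λ y g m → con (+ 3) :* (g :* (con (+ 9) :* y :* y :* (con (+ 3) :* y :* m))) := con (+ 9) :* y :* (g :* (con (+ 9) :* y :* y :* m))) refl y G₀ (3y ^ k))
                      (scale (+ 3) (gen (suc (suc k))))
      ; times-27y² = span-closed _ λ where
          zero    → resp (solve 2 (λ y g → g :* (con (+ 9) :* y :* y :* (con (+ 3) :* y :* con (+ 1))) := con (+ 27) :* y :^ 2 :* (g :* y)) refl y G₀) (gen 2)
          (suc k) → resp (solve 3 (λ y g m → con (+ 3) :* (g :* (con (+ 9) :* y :* y :* (con (+ 3) :* y :* (con (+ 3) :* y :* m)))) := con (+ 27) :* y :^ 2 :* (g :* (con (+ 9) :* y :* y :* m))) refl y G₀ (3y ^ k))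
                      (scale (+ 3) (gen (suc (suc (suc k)))))
      }

    Recurrent : (ℕ → Series) → Set
    Recurrent t = ∀ k → t (3 ℕ.+ k) ≈ σ₁ y * t (2 ℕ.+ k) - σ₂ y * t (1 ℕ.+ k) + y * t k

    -- The modular equation is multiplied by h y^k; its coefficients are series in q³ and pass
    -- through the section.
    section-recurrent : ∀ r → (∀ f h → section r (expand f * h) ≈ f * section r h) →
      ∀ h → Recurrent (λ k → section r (h * y ^ k))
    section-recurrent r section-* h k = begin
      section r (h * y ^ (3 ℕ.+ k))
        ≈⟨ section-cong r (trans (solve 3 (λ h y m → h :* (y :* (y :* (y :* m))) := h :* m :* (y :* (y :* y))) refl h y (y ^ k)) (trans (*-congˡ modular-equation)
             (solve 6 (λ h y m a b c → h :* m :* (a :* (y :* y) :- b :* y :+ c) := a :* (h :* (y :* (y :* m))) :+ :- (b :* (h :* (y :* m))) :+ c :* (h :* m)) refl h y (y ^ k) _ _ _))) ⟩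
      section r (expand (σ₁ y) * (h * y ^ (2 ℕ.+ k)) + - (expand (σ₂ y) * (h * y ^ (1 ℕ.+ k))) + expand y * (h * y ^ k))
        ≈⟨ trans (section-+ r _ _) (+-cong (trans (section-+ r _ _) (+-cong (section-* _ _) (trans (section-‿ r _) (-‿cong (section-* _ _))))) (section-* y _)) ⟩
      σ₁ y * section r (h * y ^ (2 ℕ.+ k)) - σ₂ y * section r (h * y ^ (1 ℕ.+ k)) + y * section r (h * y ^ k) ∎

    private
      σ₁ₚ σ₂ₚ : ∀ {n} → Polynomial n → Polynomial n
      σ₁ₚ = evalₚ σ₁-coeffs
      σ₂ₚ = evalₚ σ₂-coeffs

    module _ {b : ℕ → Series} (closed : Closed (Span b)) where

      open Closed closed

      3σ₁-closed : ∀ {f} → Span b f → Span b (ι (+ 3) * σ₁ y * f)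
      3σ₁-closed x = resp
        (solve 2 (λ y f → con (+ 27) :* y :^ 2 :* (con (+ 9) :* y :* f) :+ con (ℤ.- (+ 12)) :* (con (+ 27) :* y :^ 2 :* f) :+ con (+ 10) :* (con (+ 9) :* y :* f)
          := con (+ 3) :* σ₁ₚ y :* f) refl y _)
        (add (add (times-27y² (times-9y x)) (scale (ℤ.- (+ 12)) (times-27y² x))) (scale (+ 10) (times-9y x)))

      3σ₂-closed : ∀ {f} → Span b f → Span b (ι (+ 3) * σ₂ y * f)
      3σ₂-closed x = resp
        (solve 2 (λ y f → con (+ 4) :* (con (+ 9) :* y :* f) :+ con (ℤ.- (+ 1)) :* (con (+ 27) :* y :^ 2 :* f) := con (+ 3) :* σ₂ₚ y :* f) refl y _)
        (add (scale (+ 4) (times-9y x)) (scale (ℤ.- (+ 1)) (times-27y² x)))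

      recurrent-span : ∀ t → Recurrent t → Span b (t 0) → Span b (ι (+ 3) * t 1) → Span b (ι (+ 9) * t 2) →
        ∀ k → Span b (ι (+ 3) ^ k * t k)
      recurrent-span t rec x₀ x₁ x₂ k = proj₁ (triple k)
        where
        3^ : ℕ → Series
        3^ k = ι (+ 3) ^ k
        X : ℕ → Set
        X k = Span b (3^ k * t k)
        -- The recurrence has order three, so three consecutive memberships are carried along.
        triple : ∀ k → X k × X (1 ℕ.+ k) × X (2 ℕ.+ k)
        triple zero = resp (sym (*-identityˡ _)) x₀ , resp (*-congʳ (sym (*-identityʳ _))) x₁
          , resp (*-congʳ (solve 0 (con (+ 9) := con (+ 3) :^ 2) refl)) x₂
        triple (suc k) with triple k
        ... | x , x′ , x″ = x′ , x″ , resp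
          (trans (solve 6 (λ m a b s₁ s₂ c →
              con (+ 3) :* s₁ :* (con (+ 3) :* (con (+ 3) :* m) :* a) :+ con (ℤ.- (+ 3)) :* (con (+ 3) :* s₂ :* (con (+ 3) :* m :* b)) :+ con (+ 3) :* (con (+ 9) :* c)
              := con (+ 3) :* (con (+ 3) :* (con (+ 3) :* m)) :* (s₁ :* a :- s₂ :* b) :+ con (+ 27) :* c) refl (3^ k) _ _ (σ₁ y) (σ₂ y) (y * (3^ k * t k)))
            (trans (solve 4 (λ m c y t → con (+ 3) :* (con (+ 3) :* (con (+ 3) :* m)) :* c :+ con (+ 27) :* (y :* (m :* t)) := con (+ 3) :* (con (+ 3) :* (con (+ 3) :* m)) :* (c :+ y :* t)) refl (3^ k) _ y (t k))
              (*-congˡ (sym (rec k)))))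
          (add (add (3σ₁-closed x″) (scale (ℤ.- (+ 3)) (3σ₂-closed x′))) (resp (*-congˡ (*-assoc _ _ _)) (scale (+ 3) (times-9y x))))

    private
      -- The solver knows nothing of y s = 1. The relation is supplied as an explicit multiple of y
      -- s - 1, with the quotient of a polynomial division as cofactor `c`.
      drop-unit : ∀ {x z c} → x ≈ z + (y * s - 1#) * c → x ≈ z
      drop-unit {x} {z} {c} p = trans p (trans (+-congˡ (trans (*-congʳ (trans (+-congʳ y*s) (-‿inverseʳ 1#))) (zeroˡ c))) (+-identityʳ z))

      shift-s : ∀ h n k → h * s ^ suc n * y ^ suc k ≈ h * s ^ n * y ^ k
      shift-s h n k = trans (solve 5 (λ h s y a b → h :* (s :* a) :* (y :* b) := y :* s :* (h :* a :* b)) refl h s y (s ^ n) (y ^ k))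
        (trans (*-congʳ y*s) (*-identityˡ _))

    -- The powers of `s` only shift the index: `τ k` is the section 2 of G₀ y^(k-2) and `β k` the
    -- section 0 of B y^(k-3). So the indices 0, 1, 2 are the explicit sections.
    τ β : ℕ → Series
    τ k = section 2 (G₀ * s ^ 2 * y ^ k)
    β k = section 0 (B * s ^ 3 * y ^ k)

    private
      τ-rec : Recurrent τ
      τ-rec = section-recurrent 2 section₂-* (G₀ * s ^ 2)

      β-rec : Recurrent β
      β-rec = section-recurrent 0 section₀-* (B * s ^ 3)

      s^1 : s ^ 1 ≈ s
      s^1 = *-identityʳ s

      τ₀ : τ 0 ≈ B * y * (ι (+ 81) - ι (+ 27) * s + ι (+ 3) * s ^ 2)
      τ₀ = trans (section-cong 2 (*-identityʳ _)) section₂-Gs²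

      τ₁ : τ 1 ≈ B * s
      τ₁ = trans (section-cong 2 (trans (shift-s G₀ 1 0) (trans (*-identityʳ _) (*-congˡ s^1)))) section₂-Gs

      G-shift : ∀ k → G₀ * s ^ 2 * y ^ (2 ℕ.+ k) ≈ G₀ * y ^ k
      G-shift k = trans (shift-s G₀ 1 (suc k)) (trans (shift-s G₀ 0 k) (*-congʳ (*-identityʳ G₀)))

      τ₂ : τ 2 ≈ ι (+ 9) * B
      τ₂ = trans (section-cong 2 (trans (G-shift 0) (*-identityʳ G₀))) section₂-G

      ℓ : Series
      ℓ = ι (+ 9) * basisB 3 + ι (ℤ.- (+ 33)) * basisB 2 + ι (+ 28) * basisB 1 + ι (ℤ.- (+ 1)) * basisB 0

      ℓ∈ΛB : ΛB ℓ
      ℓ∈ΛB = add (add (add (scale (+ 9) (gen 3)) (scale (ℤ.- (+ 33)) (gen 2))) (scale (+ 28) (gen 1))) (scale (ℤ.- (+ 1)) (gen 0))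

      -- The recurrence yields B (729y³ - 891y² + 252y - 9), in which every coefficient is divisible
      -- by 9. This is the gain for G₀ y, the generator without a weight.
      τ₃ : τ 3 ≈ ι (+ 9) * ℓ
      τ₃ = drop-unit (trans (τ-rec 0) (trans
        (+-cong (+-cong (*-congˡ τ₂) (-‿cong (*-congˡ τ₁))) (*-congˡ τ₀))
        (solve 3 (λ y s B →
          let gens : ℕ → Polynomial 3
              gens k = B :* (y :* (con (+ 3) :* y) :^ k) in
          σ₁ₚ y :* (con (+ 9) :* B) :- σ₂ₚ y :* (B :* s) :+ y :* (B :* y :* (con (+ 81) :- con (+ 27) :* s :+ con (+ 3) :* s :^ 2))
          := con (+ 9) :* (con (+ 9) :* gens 2 :+ con (ℤ.- (+ 33)) :* gens 1 :+ con (+ 28) :* gens 0 :+ con (ℤ.- (+ 1)) :* B)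
             :+ (y :* s :- con (+ 1)) :* (B :* (con (+ 3) :* (y :* s :+ con (+ 1)) :- con (+ 12) :+ con (+ 9) :* y :- con (+ 27) :* y))) refl y s B)))

      -- On this lattice no extra factor 3 is required: 30y = 10 (3y), 108y² = 12 (3y)² and 81y³ = 3
      -- (3y)³, and likewise for σ₂.
      σ₁-ΛB : ∀ {f} → ΛB f → ΛB (σ₁ y * f)
      σ₁-ΛB x = resp
        (solve 2 (λ y f → let z = con (+ 3) :* y in con (+ 3) :* (z :* (z :* (z :* f))) :+ con (ℤ.- (+ 12)) :* (z :* (z :* f)) :+ con (+ 10) :* (z :* f) := σ₁ₚ y :* f) refl y _)
        (add (add (scale (+ 3) (3y-ΛB (3y-ΛB (3y-ΛB x)))) (scale (ℤ.- (+ 12)) (3y-ΛB (3y-ΛB x)))) (scale (+ 10) (3y-ΛB x)))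

      σ₂-ΛB : ∀ {f} → ΛB f → ΛB (σ₂ y * f)
      σ₂-ΛB x = resp
        (solve 2 (λ y f → let z = con (+ 3) :* y in con (+ 4) :* (z :* f) :+ con (ℤ.- (+ 1)) :* (z :* (z :* f)) := σ₂ₚ y :* f) refl y _)
        (add (scale (+ 4) (3y-ΛB x)) (scale (ℤ.- (+ 1)) (3y-ΛB (3y-ΛB x))))

      -‿span : ∀ {b f} → Span b f → Span b (- f)
      -‿span x = resp (solve 1 (λ f → con (ℤ.- (+ 1)) :* f := :- f) refl _) (scale (ℤ.- (+ 1)) x)

      τ₂∈ΛB : ΛB (τ 2)
      τ₂∈ΛB = resp (sym τ₂) (scale (+ 9) (gen 0))

      τ₃∈ΛB : ΛB (τ 3)
      τ₃∈ΛB = resp (sym τ₃) (scale (+ 9) ℓ∈ΛB)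

      τ₄∈ΛB : ΛB (τ 4)
      τ₄∈ΛB = resp (sym (τ-rec 1)) (add (add (σ₁-ΛB τ₃∈ΛB) (-‿span (σ₂-ΛB τ₂∈ΛB)))
        (resp (sym (trans (*-congˡ τ₁) (trans (solve 3 (λ y s b → y :* (b :* s) := y :* s :* b) refl y s B) (trans (*-congʳ y*s) (*-identityˡ B))))) (gen 0)))

      3τ₅∈ΛB : ΛB (ι (+ 3) * τ 5)
      3τ₅∈ΛB = resp (trans (solve 4 (λ a b y c → con (+ 3) :* (a :- b) :+ con (+ 3) :* y :* c := con (+ 3) :* (a :- b :+ y :* c)) refl _ _ y _) (*-congˡ (sym (τ-rec 2))))
        (add (scale (+ 3) (add (σ₁-ΛB τ₄∈ΛB) (-‿span (σ₂-ΛB τ₃∈ΛB)))) (3y-ΛB τ₂∈ΛB))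

      9τ₆∈ΛB : ΛB (ι (+ 9) * τ 6)
      9τ₆∈ΛB = resp (trans (solve 6 (λ s₁ a s₂ b y c → con (+ 3) :* (s₁ :* (con (+ 3) :* a)) :- con (+ 9) :* (s₂ :* b) :+ con (+ 3) :* (con (+ 3) :* y :* c) := con (+ 9) :* (s₁ :* a :- s₂ :* b :+ y :* c)) refl (σ₁ y) _ (σ₂ y) _ y _) (*-congˡ (sym (τ-rec 3))))
        (add (add (scale (+ 3) (σ₁-ΛB 3τ₅∈ΛB)) (-‿span (scale (+ 9) (σ₂-ΛB τ₄∈ΛB)))) (scale (+ 3) (3y-ΛB τ₃∈ΛB)))

    τ-ΛB : ∀ k → ΛB (ι (+ 3) ^ k * τ (4 ℕ.+ k))
    τ-ΛB = recurrent-span ΛB-closed (λ k → τ (4 ℕ.+ k)) (λ k → τ-rec (4 ℕ.+ k)) τ₄∈ΛB 3τ₅∈ΛB 9τ₆∈ΛB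

    private
      β₀ : β 0 ≈ G₀ * y ^ 2 * (ι (+ 28) * s ^ 2 - ι (+ 27))
      β₀ = trans (section-cong 0 (*-identityʳ _)) section₀-Bs³

      β₁ : β 1 ≈ G₀ * y * (ι (+ 4) * s - ι (+ 3))
      β₁ = trans (section-cong 0 (trans (shift-s B 2 0) (*-identityʳ _))) section₀-Bs²

      β₂ : β 2 ≈ G₀
      β₂ = trans (section-cong 0 (trans (shift-s B 2 1) (trans (shift-s B 1 0) (trans (*-identityʳ _) (*-congˡ s^1))))) section₀-Bs

      B-shift : ∀ k → B * s ^ 3 * y ^ (3 ℕ.+ k) ≈ B * y ^ k
      B-shift k = trans (shift-s B 2 (2 ℕ.+ k)) (trans (shift-s B 1 (suc k)) (trans (shift-s B 0 k) (*-congʳ (*-identityʳ B))))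

      gensG : ∀ {n} → Polynomial n → Polynomial n → ℕ → Polynomial n
      gensG G y k = G :* (con (+ 9) :* y :* y :* (con (+ 3) :* y) :^ k)

      -- Values of the recurrence in the weighted basis; `b₃` is G₀ (10y - 36y² + 27y³). That the
      -- coefficients are integers here means that the weights of `basisG` are respected.
      b₃ b₄ : Series
      b₃ = basisG 2 + ι (ℤ.- (+ 4)) * basisG 1 + ι (+ 10) * basisG 0
      b₄ = ι (+ 3) * basisG 5 + ι (ℤ.- (+ 24)) * basisG 4 + ι (+ 68) * basisG 3 + ι (ℤ.- (+ 80)) * basisG 2 + ι (+ 34) * basisG 1 + ι (ℤ.- (+ 8)) * basisG 0

      β₃ : β 3 ≈ b₃
      β₃ = drop-unit (trans (β-rec 0) (trans
        (+-cong (+-cong (*-congˡ β₂) (-‿cong (*-congˡ β₁))) (*-congˡ β₀))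
        (solve 3 (λ y s G →
          σ₁ₚ y :* G :- σ₂ₚ y :* (G :* y :* (con (+ 4) :* s :- con (+ 3))) :+ y :* (G :* y :^ 2 :* (con (+ 28) :* s :^ 2 :- con (+ 27)))
          := gensG G y 1 :+ con (ℤ.- (+ 4)) :* gensG G y 0 :+ con (+ 10) :* (G :* y)
             :+ (y :* s :- con (+ 1)) :* (G :* (con (+ 28) :* y :* (y :* s :+ con (+ 1)) :- con (+ 4) :* σ₂ₚ y))) refl y s G₀)))

      β₄ : β 4 ≈ b₄
      β₄ = drop-unit (trans (β-rec 1) (trans
        (+-cong (+-cong (*-congˡ β₃) (-‿cong (*-congˡ β₂))) (*-congˡ β₁))
        (solve 3 (λ y s G →
          σ₁ₚ y :* (gensG G y 1 :+ con (ℤ.- (+ 4)) :* gensG G y 0 :+ con (+ 10) :* (G :* y)) :- σ₂ₚ y :* G :+ y :* (G :* y :* (con (+ 4) :* s :- con (+ 3)))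
          := con (+ 3) :* gensG G y 4 :+ con (ℤ.- (+ 24)) :* gensG G y 3 :+ con (+ 68) :* gensG G y 2 :+ con (ℤ.- (+ 80)) :* gensG G y 1
               :+ con (+ 34) :* gensG G y 0 :+ con (ℤ.- (+ 8)) :* (G :* y)
             :+ (y :* s :- con (+ 1)) :* (con (+ 4) :* y :* G)) refl y s G₀)))

      open Closed ΛG-closed

      β₃∈ΛG : ΛG (β 3)
      β₃∈ΛG = resp (sym β₃) (add (add (gen 2) (scale (ℤ.- (+ 4)) (gen 1))) (scale (+ 10) (gen 0)))

      β₄∈ΛG : ΛG (β 4)
      β₄∈ΛG = resp (sym β₄) (add (add (add (add (add (scale (+ 3) (gen 5)) (scale (ℤ.- (+ 24)) (gen 4))) (scale (+ 68) (gen 3))) (scale (ℤ.- (+ 80)) (gen 2))) (scale (+ 34) (gen 1))) (scale (ℤ.- (+ 8)) (gen 0)))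

      3β₅∈ΛG : ΛG (ι (+ 3) * β 5)
      -- `β 2` is G₀, which is not a generator, but the recurrence only asks for y G₀, which is.
      3β₅∈ΛG = resp (trans (+-congˡ (*-congˡ (trans (*-comm G₀ y) (*-congˡ (sym β₂)))))
          (trans (solve 6 (λ s₁ a s₂ b y c → con (+ 3) :* s₁ :* a :- con (+ 3) :* s₂ :* b :+ con (+ 3) :* (y :* c) := con (+ 3) :* (s₁ :* a :- s₂ :* b :+ y :* c)) refl (σ₁ y) _ (σ₂ y) _ y _)
            (*-congˡ (sym (β-rec 2)))))
        (add (add (3σ₁-closed ΛG-closed β₄∈ΛG) (-‿span (3σ₂-closed ΛG-closed β₃∈ΛG))) (scale (+ 3) (gen 0)))

      9β₆∈ΛG : ΛG (ι (+ 9) * β 6)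
      9β₆∈ΛG = resp (trans (solve 6 (λ s₁ a s₂ b y c → con (+ 3) :* s₁ :* (con (+ 3) :* a) :- con (+ 3) :* (con (+ 3) :* s₂ :* b) :+ con (+ 9) :* y :* c := con (+ 9) :* (s₁ :* a :- s₂ :* b :+ y :* c)) refl (σ₁ y) _ (σ₂ y) _ y _)
          (*-congˡ (sym (β-rec 3))))
        (add (add (3σ₁-closed ΛG-closed 3β₅∈ΛG) (-‿span (scale (+ 3) (3σ₂-closed ΛG-closed β₄∈ΛG)))) (times-9y β₃∈ΛG))

    β-ΛG : ∀ k → ΛG (ι (+ 3) ^ k * β (4 ℕ.+ k))
    β-ΛG = recurrent-span ΛG-closed (λ k → β (4 ℕ.+ k)) (λ k → β-rec (4 ℕ.+ k)) β₄∈ΛG 3β₅∈ΛG 9β₆∈ΛG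

    private
      section-ι^ : ∀ r c k f → section r (ι c ^ k * f) ≈ ι c ^ k * section r f
      section-ι^ r c zero    f = trans (section-cong r (*-identityˡ f)) (sym (*-identityˡ _))
      section-ι^ r c (suc k) f = trans (section-cong r (*-assoc _ _ f)) (trans (section-ι r c _) (trans (*-congˡ (section-ι^ r c k f)) (sym (*-assoc _ _ _))))

      3y^ : ∀ k → 3y ^ k ≈ ι (+ 3) ^ k * y ^ k
      3y^ zero    = sym (*-identityˡ 1#)
      3y^ (suc k) = trans (*-congˡ (3y^ k)) (solve 4 (λ c y a b → c :* y :* (a :* b) := c :* a :* (y :* b)) refl _ _ _ _)

    section₂-ΛG : ∀ {f} → ΛG f → ∃ λ h → ΛB h × section 2 f ≈ ι (+ 9) * h
    section₂-ΛG (gen zero) = ℓ , ℓ∈ΛB ,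
      trans (section-cong 2 (sym (trans (G-shift 1) (*-congˡ (*-identityʳ y))))) τ₃
    section₂-ΛG (gen (suc k)) = _ , τ-ΛB k , (begin
      section 2 (basisG (suc k))
        ≈⟨ section-cong 2 (trans (*-congˡ (*-congˡ (3y^ k)))
             (solve 4 (λ g y m n → g :* (con (+ 9) :* y :* y :* (m :* n)) := con (+ 9) :* (m :* (g :* (y :* (y :* n))))) refl G₀ y _ (y ^ k))) ⟩
      section 2 (ι (+ 9) * (ι (+ 3) ^ k * (G₀ * y ^ (2 ℕ.+ k))))
        ≈⟨ trans (section-ι 2 (+ 9) _) (*-congˡ (section-ι^ 2 (+ 3) k _)) ⟩
      ι (+ 9) * (ι (+ 3) ^ k * section 2 (G₀ * y ^ (2 ℕ.+ k)))
        ≈⟨ *-congˡ (*-congˡ (section-cong 2 (G-shift (2 ℕ.+ k)))) ⟨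
      ι (+ 9) * (ι (+ 3) ^ k * τ (4 ℕ.+ k)) ∎)
    section₂-ΛG (add x z) with section₂-ΛG x | section₂-ΛG z
    ... | _ , x′ , p | _ , z′ , r = _ , add x′ z′ , trans (section-+ 2 _ _) (trans (+-cong p r) (sym (distribˡ _ _ _)))
    section₂-ΛG (scale c x) with section₂-ΛG x
    ... | _ , x′ , p = _ , scale c x′ , trans (section-ι 2 c _) (trans (*-congˡ p) (solve 3 (λ c n f → c :* (n :* f) := n :* (c :* f)) refl _ _ _))
    section₂-ΛG (resp r x) with section₂-ΛG x
    ... | _ , x′ , p = _ , x′ , trans (section-cong 2 (sym r)) p

    section₀-ΛB : ∀ {f} → ΛB f → ΛG (section 0 f)
    section₀-ΛB (gen zero) = resp (section-cong 0 (trans (B-shift 0) (*-identityʳ B))) β₃∈ΛG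
    section₀-ΛB (gen (suc k)) = resp (sym (begin
      section 0 (basisB (suc k))
        ≈⟨ section-cong 0 (trans (*-congˡ (*-congˡ (3y^ k))) (solve 4 (λ b y m n → b :* (y :* (m :* n)) := m :* (b :* (y :* n))) refl B y _ (y ^ k))) ⟩
      section 0 (ι (+ 3) ^ k * (B * y ^ suc k))
        ≈⟨ section-ι^ 0 (+ 3) k _ ⟩
      ι (+ 3) ^ k * section 0 (B * y ^ suc k)
        ≈⟨ *-congˡ (section-cong 0 (B-shift (suc k))) ⟨
      ι (+ 3) ^ k * β (4 ℕ.+ k) ∎)) (β-ΛG k)
    section₀-ΛB (add x z)   = resp (sym (section-+ 0 _ _)) (add (section₀-ΛB x) (section₀-ΛB z))
    section₀-ΛB (scale c x) = resp (sym (section-ι 0 c _)) (scale c (section₀-ΛB x))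
    section₀-ΛB (resp r x)  = resp (section-cong 0 r) (section₀-ΛB x)

    -- The generating function and its iterated sections

    G≈G₀ : G ≈ G₀
    G≈G₀ = begin
      (qPoch 2 ^ˢ 5) * inv (qPoch 1 ^ˢ 4)   ≈⟨ *-cong (pow 5 e₂≈) i₁⁴ ⟩
      e₂ ^ 5 * i₁ ^ 4                       ≈⟨ solve 2 (λ e i → e :^ 5 :* i :^ 4 := (e :* e :* i) :^ 2 :* (e :* (i :* i))) refl e₂ i₁ ⟩
      G₀                                    ∎
      where
      e₂≈ : qPoch 2 ≈ e₂
      e₂≈ = qPoch≈e 1
      e₁≈ : qPoch 1 ≈ e₁
      e₁≈ = trans (qPoch≈e 0) (pochhammer-cong (*-identityʳ q) (*-identityʳ q))
      pow : ∀ {f h} n → f ≈ h → f ^ˢ n ≈ h ^ n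
      pow zero    p = refl
      pow (suc n) p = *-cong p (pow n p)
      unit : (qPoch 1 ^ˢ 4) ≈[ 1 ] 1#
      unit = ≈⇒≈[] (pow 4 e₁≈) ⊙ ^-cong[] 4 (e-unit q-order) ⊙ ≈⇒≈[] (solve 0 (con (+ 1) :^ 4 := con (+ 1)) refl)
      i₁⁴ : inv (qPoch 1 ^ˢ 4) ≈ i₁ ^ 4
      i₁⁴ = inverse-unique (inv-inverse (qPoch 1 ^ˢ 4) unit) (trans (*-congʳ (pow 4 e₁≈)) (^-inverse 4 e₁i₁))

    -- (9^(α+1) - 1)/4 is twice 1 + 9 + ... + 9^α, so its base 3 digits, from the lowest, are 2, 0,
    -- 2, 0, ..., 2. The progression is reached by extracting these residues in turn.
    iterated : ℕ → Series
    iterated zero    = section 2 G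
    iterated (suc α) = section 2 (section 0 (iterated α))

    iterated-divisible : ∀ α → ∃ λ h → ΛB h × iterated α ≈ ι (+ 9) ^ suc α * h
    iterated-divisible zero    = B , gen 0 , trans (section-cong 2 G≈G₀) (trans section₂-G (*-congʳ (sym (*-identityʳ _))))
    iterated-divisible (suc α) with iterated-divisible α
    ... | h , h∈ΛB , p with section₂-ΛG (section₀-ΛB h∈ΛB)
    ... | h′ , h′∈ΛB , r = h′ , h′∈ΛB , (begin
      section 2 (section 0 (iterated α))                     ≈⟨ section-cong 2 (trans (section-cong 0 p) (section-ι^ 0 (+ 9) (suc α) h)) ⟩
      section 2 (ι (+ 9) ^ suc α * section 0 h)              ≈⟨ trans (section-ι^ 2 (+ 9) (suc α) _) (*-congˡ r) ⟩
      ι (+ 9) ^ suc α * (ι (+ 9) * h′)                       ≈⟨ solve 3 (λ c n h → n :* (c :* h) := c :* n :* h) refl _ _ _ ⟩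
      ι (+ 9) ^ suc (suc α) * h′                             ∎)

    ι^-divides : ∀ k f n → + (9 ℕ.^ k) ∣ (ι (+ 9) ^ k * f) n
    ι^-divides zero    f n = ℕᵈ.divides ℤ.∣ (1# * f) n ∣ (≡.sym (ℕₚ.*-identityʳ _))
    ι^-divides (suc k) f n = ≡.subst (+ (9 ℕ.^ suc k) ∣_)
      (≡.sym (≡.trans (at (*-assoc (ι (+ 9)) (ι (+ 9) ^ k) f) n) (ι-at (+ 9) (ι (+ 9) ^ k * f) n)))
      (≡.subst (9 ℕ.* 9 ℕ.^ k ℕᵈ.∣_) (≡.sym (ℤₚ.abs-* (+ 9) ((ι (+ 9) ^ k * f) n)))
        (ℕᵈ.*-monoʳ-∣ 9 (ι^-divides k f n)))

    offset : ℕ → ℕ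
    offset zero    = 2
    offset (suc α) = 6 ℕ.* 3 ℕ.^ (1 ℕ.+ 2 ℕ.* α) ℕ.+ offset α

    iterated-at : ∀ α n → iterated α n ≡ G (3 ℕ.^ (1 ℕ.+ 2 ℕ.* α) ℕ.* n ℕ.+ offset α)
    iterated-at zero    n = ≡.cong (λ m → G (m ℕ.+ 2)) (ℕₚ.*-comm n 3)
    iterated-at (suc α) n = ≡.trans (iterated-at α ((n ℕ.* 3 ℕ.+ 2) ℕ.* 3 ℕ.+ 0)) (≡.cong G (≡.trans
      (S.solve 3 (λ p n c → p S.:* ((n S.:* S.con 3 S.:+ S.con 2) S.:* S.con 3 S.:+ S.con 0) S.:+ c S.:= (S.con 3 S.:* (S.con 3 S.:* p)) S.:* n S.:+ (S.con 6 S.:* p S.:+ c)) ≡.refl (3 ℕ.^ (1 ℕ.+ 2 ℕ.* α)) n (offset α))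
      (≡.cong (λ k → 3 ℕ.^ k ℕ.* n ℕ.+ offset (suc α)) (≡.cong (λ m → suc m) (≡.sym (ℕₚ.*-suc 2 α))))))
      where module S = +-*-Solver

    section-iterate-divisible : ∀ α n → + (9 ℕ.^ suc α) ∣ g (3 ℕ.^ (1 ℕ.+ 2 ℕ.* α) ℕ.* n ℕ.+ offset α)
    section-iterate-divisible α n with iterated-divisible α
    ... | h , _ , p = ≡.subst (+ (9 ℕ.^ suc α) ∣_) (≡.trans (≡.sym (at p n)) (iterated-at α n)) (ι^-divides (suc α) h n)

  open Lattices public

-- The arithmetic progression of the exponents

open import Data.Nat using (ℕ; _+_; _*_; _^_; _∸_; _/_; _≤_)
open import Data.Integer using (+_)
open Congruence using (offset; section-iterate-divisible)

-- The successor on the left makes the truncated subtraction of 1 and the division by 4 exact.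
4*offset : ∀ α → suc (offset α * 4) ≡ 3 ^ (2 * suc α)
4*offset zero    = ≡.refl
4*offset (suc α) = begin
  suc ((6 * p + offset α) * 4)         ≡⟨ solve 2 (λ p c → con 1 :+ (con 6 :* p :+ c) :* con 4 := con 24 :* p :+ (con 1 :+ c :* con 4)) ≡.refl p (offset α) ⟩
  24 * p + suc (offset α * 4)          ≡⟨ ≡.cong (λ m → 24 * p + m) (≡.trans (4*offset α) (≡.cong (3 ^_) (ℕₚ.*-suc 2 α))) ⟩
  24 * p + 3 * p                       ≡⟨ solve 1 (λ p → con 24 :* p :+ con 3 :* p := con 3 :* (con 3 :* (con 3 :* p))) ≡.refl p ⟩
  3 ^ (4 + 2 * α)                      ≡⟨ ≡.cong (3 ^_) (≡.trans (ℕₚ.*-suc 2 (suc α)) (≡.cong (λ m → 2 + m) (ℕₚ.*-suc 2 α))) ⟨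
  3 ^ (2 * suc (suc α))                ∎
  where
  open ≡.≡-Reasoning
  open +-*-Solver
  p = 3 ^ (1 + 2 * α)

offset-quotient : ∀ α → (3 ^ (2 * suc α) ∸ 1) / 4 ≡ offset α
offset-quotient α = ≡.trans (≡.cong (λ m → (m ∸ 1) / 4) (≡.sym (4*offset α))) (m*n/n≡m (offset α) 4)

theorem3p4 : (α n : ℕ) → 1 ≤ α →
    (+ (3 ^ (2 * α))) ∣ g (3 ^ (2 * α ∸ 1) * n + (3 ^ (2 * α) ∸ 1) / 4)
theorem3p4 zero    n ()
theorem3p4 (suc α) n _ = ≡.subst₂ (λ m k → + m ∣ g k) (ℕₚ.^-*-assoc 3 2 (suc α))
  (≡.cong₂ (λ k c → 3 ^ k * n + c) (≡.cong (_∸ 1) (≡.sym (ℕₚ.*-suc 2 α))) (≡.sym (offset-quotient α)))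
  (section-iterate-divisible α n)
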